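{- Let $c$ be a Coxeter element of a finite Coxeter group $W$, and let $w$ be a $c$-sortable element. The following are equivalent: (1) the descents of $w$ pairwise commute; (2) the interval $[\mathrm{pop}^{\downarrow}_{\mathrm{Weak}(W)}(w),w]$ of $\mathrm{Weak}(W)$ is a distributive lattice; (3) the interval $[\mathrm{pop}^{\downarrow}_{\mathrm{Weak}(W)}(w),w]$ of $\mathrm{Weak}(W)$ is a Boolean lattice; (4) the interval $[\mathrm{pop}^{\downarrow}_{\mathrm{Camb}_c}(w),w]$ of $\mathrm{Camb}_c$ is a distributive lattice; (5) the interval $[\mathrm{pop}^{\downarrow}_{\mathrm{Camb}_c}(w),w]$ of $\mathrm{Camb}_c$ is a Boolean lattice; (6) the interval $[\mathrm{pop}^{\downarrow}_{\mathrm{Camb}_c}(w),w]$ of $\mathrm{Camb}_c$ equals the interval $[\mathrm{pop}^{\downarrow}_{\mathrm{Weak}(W)}(w),w]$ of $\mathrm{Weak}(W)$.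
   Context: For a finite Coxeter system $(W,S)$: $\ell$ is length; reflections are conjugates of simple reflections; a left inversion of $w$ is a reflection $t$ with $\ell(tw)<\ell(w)$; a descent of $w$ is $s\in S$ with $\ell(ws)<\ell(w)$. $\mathrm{Weak}(W)$ is the (right) weak order: $u\le v$ iff every left inversion of $u$ is one of $v$; it is a lattice. A Coxeter element is a product of all simple reflections each once in some order. Fixing a reduced word $\mathsf c$ for $c$, the $c$-sorting word of $w$ is the reduced word for $w$ lexicographically first (by positions) as a subword of $\mathsf c^\infty$; $I^{(k)}(w)$ is the set of letters used from the $k$-th copy of $\mathsf c$; $w$ is $c$-sortable if $I^{(1)}(w)\supseteq I^{(2)}(w)\supseteq\cdots$. $\mathrm{Camb}_c$ (the $c$-Cambrian lattice) is the set of $c$-sortable elements, a sublattice of $\mathrm{Weak}(W)$. For a finite lattice $L$, $\mathrm{pop}^{\downarrow}_L(x)=x\wedge\bigwedge\{y\mid y\lessdot x\text{ in }L\}$. -}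

module Defs where

open import Level using (0ℓ)
open import Data.Nat using (ℕ; zero; suc; _≤_; _<_)
open import Data.Fin as F using (Fin)
open import Data.Vec using (Vec; lookup)
open import Data.List using (List; []; _∷_; length; map)
open import Data.List.Membership.Propositional using (_∈_)
open import Data.Product using (Σ; ∃; ∃-syntax; _×_; _,_; proj₂)
open import Data.Sum using (_⊎_)
open import Relation.Binary.PropositionalEquality using (_≡_; _≢_)
open import Relation.Nullary using (¬_)
open import Function.Bundles using (_⇔_)
open import Algebra.Bundles using (Group)

-- Finite Coxeter systems (W,S).
-- W is a finite group with carrier Fin N (equality is ≡); S is given by an
-- injective map gen : Fin n → W.  (W,S) is a Coxeter system: S consists of
-- nontrivial involutions, generates W, and W is presented by the Coxeter
-- relations (s s')^{m(s,s')} = e, m(s,s') = order of s s' in W.  The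
-- presentation is expressed by its universal property: every assignment
-- S → G (G any group) satisfying the relations (s s')^k = e that hold in W
-- extends to a group homomorphism W → G.

module _ {A : Set} (_·_ : A → A → A) (e : A) where
  powW : A → ℕ → A
  powW x zero    = e
  powW x (suc k) = x · powW x k

  wordProd : {I : Set} → (I → A) → List I → A
  wordProd g []       = e
  wordProd g (i ∷ is) = g i · wordProd g is

record CoxeterSystem : Set₁ where
  field
    N     : ℕ
    n     : ℕ
    _·_   : Fin N → Fin N → Fin N
    e     : Fin N
    inv   : Fin N → Fin N
    assoc : ∀ x y z → (x · y) · z ≡ x · (y · z)
    idˡ   : ∀ x → e · x ≡ x
    idʳ   : ∀ x → x · e ≡ x
    invˡ  : ∀ x → inv x · x ≡ e
    invʳ  : ∀ x → x · inv x ≡ e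
    gen   : Fin n → Fin N
    gen-injective : ∀ i j → gen i ≡ gen j → i ≡ j
    gen-involution : ∀ i → gen i · gen i ≡ e
    gen-nontrivial : ∀ i → gen i ≢ e
    generates : ∀ (w : Fin N) → ∃[ ws ] wordProd _·_ e gen ws ≡ w
    presentation :
      (G : Group 0ℓ 0ℓ) (f : Fin n → Group.Carrier G) →
      (∀ i j k → powW _·_ e (gen i · gen j) k ≡ e →
         Group._≈_ G (powW (Group._∙_ G) (Group.ε G) (Group._∙_ G (f i) (f j)) k) (Group.ε G)) →
      Σ (Fin N → Group.Carrier G) λ φ →
        (∀ x y → Group._≈_ G (φ (x · y)) (Group._∙_ G (φ x) (φ y))) ×
        (∀ i → Group._≈_ G (φ (gen i)) (f i))

module _ {N : ℕ} (D : Fin N → Set) (_⊑_ : Fin N → Fin N → Set) where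

  -- y ⋖ x in the poset D
  Covers : Fin N → Fin N → Set
  Covers y x = D y × D x × y ⊑ x × y ≢ x ×
               (∀ z → D z → y ⊑ z → z ⊑ x → z ≡ y ⊎ z ≡ x)

  IsGLB : (Fin N → Set) → Fin N → Set
  IsGLB A m = D m × (∀ a → A a → m ⊑ a) ×
              (∀ z → D z → (∀ a → A a → z ⊑ a) → z ⊑ m)

  IsLUB : (Fin N → Set) → Fin N → Set
  IsLUB A m = D m × (∀ a → A a → a ⊑ m) ×
              (∀ z → D z → (∀ a → A a → a ⊑ z) → m ⊑ z)

  IsMeet : Fin N → Fin N → Fin N → Set
  IsMeet a b m = IsGLB (λ z → z ≡ a ⊎ z ≡ b) m

  IsJoin : Fin N → Fin N → Fin N → Set
  IsJoin a b m = IsLUB (λ z → z ≡ a ⊎ z ≡ b) m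

  IsPopDown : Fin N → Fin N → Set
  IsPopDown x p = IsGLB (λ y → y ≡ x ⊎ Covers y x) p

  Interval : Fin N → Fin N → Fin N → Set
  Interval a b z = D z × a ⊑ z × z ⊑ b

  IsLattice : Set
  IsLattice = ∀ a b → D a → D b → (∃[ m ] IsMeet a b m) × (∃[ j ] IsJoin a b j)

  IsDistributiveLattice : Set
  IsDistributiveLattice = IsLattice ×
    (∀ a b c → D a → D b → D c →
     ∀ j l m₁ m₂ r → IsJoin b c j → IsMeet a j l →
       IsMeet a b m₁ → IsMeet a c m₂ → IsJoin m₁ m₂ r → l ≡ r)

  IsBottom IsTop : Fin N → Set
  IsBottom z = D z × (∀ y → D y → z ⊑ y)
  IsTop z = D z × (∀ y → D y → y ⊑ z)

  IsBooleanLattice : Set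
  IsBooleanLattice = IsDistributiveLattice ×
    (∃[ bot ] IsBottom bot) × (∃[ top ] IsTop top) ×
    (∀ a → D a → ∃[ b ] D b × (∀ bot top → IsBottom bot → IsTop top →
                                 IsMeet a b bot × IsJoin a b top))

module _ (C : CoxeterSystem) where
  open CoxeterSystem C

  prod : List (Fin n) → Fin N
  prod = wordProd _·_ e gen

  IsLength : Fin N → ℕ → Set
  IsLength w k = (∃[ ws ] length ws ≡ k × prod ws ≡ w) ×
                 (∀ ws → prod ws ≡ w → k ≤ length ws)

  Reduced : List (Fin n) → Set
  Reduced ws = IsLength (prod ws) (length ws)

  ShorterThan : Fin N → Fin N → Set
  ShorterThan u v = ∃[ a ] ∃[ b ] IsLength u a × IsLength v b × a < b

  IsReflection : Fin N → Set
  IsReflection t = ∃[ x ] ∃[ i ] t ≡ (x · gen i) · inv x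

  IsLeftInversion : Fin N → Fin N → Set
  IsLeftInversion w t = IsReflection t × ShorterThan (t · w) w

  IsDescent : Fin N → Fin n → Set
  IsDescent w i = ShorterThan (w · gen i) w

  DescentsCommute : Fin N → Set
  DescentsCommute w = ∀ i j → IsDescent w i → IsDescent w j →
                      gen i · gen j ≡ gen j · gen i

  _≤W_ : Fin N → Fin N → Set
  u ≤W v = ∀ t → IsLeftInversion u t → IsLeftInversion v t


  -- Coxeter element given by a reduced word cw : each simple reflection
  -- exactly once (cw is a permutation of Fin n)
  IsCoxeterWord : Vec (Fin n) n → Set
  IsCoxeterWord cw = ∀ a b → lookup cw a ≡ lookup cw b → a ≡ b

  -- positions in c^∞: (k , a) = the a-th letter of the k-th copy (k from 0)
  Pos : Set
  Pos = ℕ × Fin n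

  _<P_ : Pos → Pos → Set
  (k , a) <P (k' , a') = k < k' ⊎ (k ≡ k' × F._<_ a a')

  data Increasing : List Pos → Set where
    []  : Increasing []
    [_] : ∀ p → Increasing (p ∷ [])
    _∷_ : ∀ {p q ps} → p <P q → Increasing (q ∷ ps) → Increasing (p ∷ q ∷ ps)

  data LexLt : List Pos → List Pos → Set where
    nil  : ∀ {q qs} → LexLt [] (q ∷ qs)
    here : ∀ {p q ps qs} → p <P q → LexLt (p ∷ ps) (q ∷ qs)
    next : ∀ {p ps qs} → LexLt ps qs → LexLt (p ∷ ps) (p ∷ qs)

  module _ (cw : Vec (Fin n) n) where
    letters : List Pos → List (Fin n)
    letters ps = map (λ p → lookup cw (proj₂ p)) ps

    ReducedSubword : Fin N → List Pos → Set
    ReducedSubword w ps = Increasing ps × prod (letters ps) ≡ w × Reduced (letters ps)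

    IsSortingWord : Fin N → List Pos → Set
    IsSortingWord w ps = ReducedSubword w ps ×
                         (∀ qs → ReducedSubword w qs → ¬ LexLt qs ps)

    -- s ∈ I^{(k+1)}(w) where ps is the sorting word (copies numbered from 0)
    InI : List Pos → ℕ → Fin n → Set
    InI ps k s = ∃[ a ] (k , a) ∈ ps × lookup cw a ≡ s

    IsSortable : Fin N → Set
    IsSortable w = ∃[ ps ] IsSortingWord w ps ×
                   (∀ k s → InI ps (suc k) s → InI ps k s)

{-# OPTIONS --safe #-}

-- Instead of the real geometric representation we use an integral unfolding of it: the
-- coefficient 2 cos (π/m) is replaced by the adjacency operator A of a disjoint union of
-- paths with m - 1 vertices, acting on integer sequences. Its Chebyshev polynomials U_k are
-- nonnegative for k < m and U_{m-1} vanishes, which is all that is needed for the dihedral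
-- relations and for the usual proof that every root is positive or negative.
--
-- Let E be the Euler form of c. The cover roots β_p = -w α_p (p a descent of a c-sortable
-- w) form an exceptional sequence for E, and below each w · p there is a largest c-sortable
-- element y_p; its inversions are the inversions β of w with E(β, β_p) ≤ 0, and the y_p are
-- the elements covered by w in the Cambrian lattice.
--
-- If the descents commute, then both intervals consist of all elements obtained from w by
-- deleting cover reflections from its inversion set: deleting any set of them is possible
-- and preserves sortability, so the intervals are equal and Boolean.
--
-- If p and q do not commute and E(β_p, β_q) = 0, let β be the cover root of w · p at q, a
-- positive combination of β_q and β_p. Then β is an inversion of y_p but not of y_q. Hence
-- w · q lies in the weak interval without being sortable, and y_p, y_q and the largest
-- sortable element below y_p and w · p · q form a pentagon, as do w · p, w · q and w · p · q
-- in the weak order.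

module Submission where

open import Defs
open import Data.Fin using (Fin)
open import Data.Vec using (Vec)
open import Data.Unit using (⊤)
open import Data.Product using (_×_)
open import Function.Bundles using (_⇔_)

open import Level using (0ℓ)
open import Algebra.Bundles using (Group; CommutativeRing)
open import Data.Bool using (Bool; true; false; not; _xor_)
import Data.Bool.Properties as Bₚ
open import Data.Empty using (⊥; ⊥-elim)
open import Data.Fin as F using (toℕ)
open import Data.Fin.Properties as Fₚ using (_≟_; any?; pigeonhole)
open import Data.Integer as ℤ using (ℤ; 0ℤ; 1ℤ; +_; _+_; _*_; -_; _-_; _≤_)
import Data.Integer.Properties as ℤₚ
open import Data.Integer.Tactic.RingSolver using (solve-∀)
open import Data.List using (List; []; _∷_; _++_; length; _∷ʳ_; allFin; filter; map; tabulate)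
import Data.List.Properties as Lₚ
open import Data.List.Membership.Propositional using (_∈_; _∉_)
open import Data.List.Membership.Propositional.Properties using (∈-map⁺; ∈-tabulate⁺; ∈-tabulate⁻; ∈-++⁻; ∈-++⁺ˡ; ∈-++⁺ʳ; ∈-filter⁺; ∈-filter⁻; ∈-allFin)
open import Data.List.Relation.Unary.All as All using (All; []; _∷_)
open import Data.List.Relation.Unary.AllPairs as AP using (AllPairs; []; _∷_)
import Data.List.Relation.Unary.AllPairs.Properties as APₚ
open import Data.List.Relation.Unary.Any as Any using (here; there)
open import Data.List.Relation.Unary.Unique.Propositional using (Unique)
import Data.List.Relation.Unary.Unique.Propositional.Properties as Uₚ
open import Data.Nat as ℕ using (ℕ; zero; suc; pred; z≤n; s≤s; _!)
import Data.Nat.Properties as ℕₚ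
open import Data.Nat.Divisibility using (∣-trans; m≤n⇒m!∣n!; m∣m*n; n∣m*n; n∣m⇒m%n≡0)
open import Data.Nat.DivMod using (_%_; _/_; m≡m%n+[m/n]*n; [m+kn]%n≡m%n; m<n⇒m%n≡m; m%n<n; n%n≡0)
open import Data.Product using (Σ; ∃-syntax; _,_; proj₁; proj₂)
open import Data.Product.Properties using (≡-dec)
open import Data.Sum using (_⊎_; inj₁; inj₂)
open import Data.Unit using (tt)
open import Data.Vec using (lookup)
open import Function using (_∘_)
open import Function.Bundles using (mk⇔; Equivalence)
open import Relation.Binary.PropositionalEquality hiding (J)
open import Relation.Nullary using (¬_; Dec; yes; no)
open import Relation.Nullary.Decidable using (_×-dec_; _⊎-dec_; ¬?)
open ≡-Reasoning

-- Multiples of a root are indexed by sequences: `α i m` plays the role of m times a simple root.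
-- The operators `A e` for different `e` need not commute, which is harmless because every rank-two
-- computation involves a single `e`. The price is that equal directions agree only up to a linear
-- map of sequences. Hence identities are stated for all `m`, signs for nonnegative `m`, and forms
-- for every cut `c`, where the cuts are chosen so that all `A (ee i j)` are self-adjoint.
--
-- The inductions follow the recursion for sortable elements: reflecting in the first letter moves
-- it to the end of the Coxeter word, as a reflection functor turns a source into a sink, and an
-- absent first letter is dropped, which passes to a parabolic subgroup. The obstacle is a first
-- letter that is present but has to be removed: restricting a sortable element to the parabolic
-- subgroup without that letter uses Cambrian covers, while the maximality of these covers uses
-- restriction. Both are therefore proved in one induction on length plus number of letters.

module PathOperators where

  -- Path operators on integer sequences and their Chebyshev polynomials.

  M : Set
  M = ℕ → ℤ

  NN : M → Set
  NN x = ∀ k → 0ℤ ≤ x k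

  link : ℕ → ℤ
  link zero    = 0ℤ
  link (suc _) = 1ℤ

  opaque
    -- The edge between `k - 1` and `k`, absent when `k` starts a new path. It is absent at 0 in
    -- particular, so the default `pred 0` in `A` is multiplied by zero.
    edge : ℕ → ℕ → ℤ
    edge e k = link (k % suc e)

    -- Adjacency operator of the graph on ℕ consisting of consecutive paths with e + 1
    -- vertices: this plays the role of 2cos(π/m), m = e + 2, with integral coefficients.
    A : ℕ → M → M
    A e x k = edge e (suc k) * x (suc k) + edge e k * x (pred k)

  -- The path starting at `B`, moved to the positions 1 to `e + 1` and bordered by zeros. In these
  -- coordinates `A e` is the plain sum of the two neighbours, at the ends of the path as well.
  ext : ℕ → ℕ → M → ℕ → ℤ
  ext e B x zero = 0ℤ
  ext e B x (suc a) with a ℕ.≤? e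
  ... | yes _ = x (B ℕ.+ a)
  ... | no  _ = 0ℤ

  ext-in : ∀ e B x {a} → a ℕ.≤ e → ext e B x (suc a) ≡ x (B ℕ.+ a)
  ext-in e B x {a} p with a ℕ.≤? e
  ... | yes _ = refl
  ... | no ¬p = ⊥-elim (¬p p)

  ext-out : ∀ e B x → ext e B x (suc (suc e)) ≡ 0ℤ
  ext-out e B x with suc e ℕ.≤? e
  ... | yes p = ⊥-elim (ℕₚ.<-irrefl refl p)
  ... | no _  = refl

  ext-NN : ∀ e B x → NN x → ∀ a → 0ℤ ≤ ext e B x a
  ext-NN e B x h zero = ℤₚ.≤-refl
  ext-NN e B x h (suc a) with a ℕ.≤? e
  ... | yes _ = h _
  ... | no  _ = ℤₚ.≤-refl

  mod-block : ∀ e q {a} → a ℕ.≤ e → (q ℕ.* suc e ℕ.+ a) % suc e ≡ a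
  mod-block e q {a} p = trans (cong (_% suc e) (ℕₚ.+-comm (q ℕ.* suc e) a))
    (trans ([m+kn]%n≡m%n a q (suc e)) (m<n⇒m%n≡m (s≤s p)))

  mod-end : ∀ e q → suc (q ℕ.* suc e ℕ.+ e) % suc e ≡ 0
  mod-end e q = trans (cong (_% suc e) (trans (sym (ℕₚ.+-suc (q ℕ.* suc e) e)) (ℕₚ.+-comm (q ℕ.* suc e) (suc e))))
    (trans ([m+kn]%n≡m%n (suc e) q (suc e)) (n%n≡0 (suc e)))

  link-NN : ∀ k y → 0ℤ ≤ y → 0ℤ ≤ link k * y
  link-NN zero y h = ℤₚ.≤-reflexive (sym (ℤₚ.*-zeroˡ y))
  link-NN (suc k) y h = subst (0ℤ ≤_) (sym (ℤₚ.*-identityˡ y)) h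

  +-NN : ∀ {x y} → 0ℤ ≤ x → 0ℤ ≤ y → 0ℤ ≤ x + y
  +-NN = ℤₚ.+-mono-≤

  distr4 : ∀ p q u v w z → p * (u + v) + q * (w + z) ≡ (p * u + q * w) + (p * v + q * z)
  distr4 = solve-∀

  neg2 : ∀ p q u w → p * (- u) + q * (- w) ≡ - (p * u + q * w)
  neg2 = solve-∀

  opaque
    unfolding A

    A-ext : ∀ e q x {a} → a ℕ.≤ e → let B = q ℕ.* suc e in
      A e x (B ℕ.+ a) ≡ ext e B x (suc (suc a)) + ext e B x a
    A-ext e q x {a} a≤e = cong₂ _+_ up (down a a≤e)
      where
      B : ℕ
      B = q ℕ.* suc e
      up : edge e (suc (B ℕ.+ a)) * x (suc (B ℕ.+ a)) ≡ ext e B x (suc (suc a))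
      up with ℕₚ.m≤n⇒m<n∨m≡n a≤e
      ... | inj₁ a<e = trans (cong (λ t → link t * x (suc (B ℕ.+ a))) (trans (cong (_% suc e) (sym (ℕₚ.+-suc B a))) (mod-block e q a<e)))
              (trans (ℤₚ.*-identityˡ _) (trans (cong x (sym (ℕₚ.+-suc B a))) (sym (ext-in e B x a<e))))
      ... | inj₂ refl = trans (cong (λ t → link t * x (suc (B ℕ.+ a))) (mod-end e q))
              (trans (ℤₚ.*-zeroˡ (x (suc (B ℕ.+ a)))) (sym (ext-out e B x)))
      down : ∀ a → a ℕ.≤ e → edge e (B ℕ.+ a) * x (pred (B ℕ.+ a)) ≡ ext e B x a
      down zero p = trans (cong (λ t → link t * x (pred (B ℕ.+ 0))) (mod-block e q p)) (ℤₚ.*-zeroˡ (x (pred (B ℕ.+ 0))))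
      down (suc a) p = trans (cong (λ t → link t * x (pred (B ℕ.+ suc a))) (mod-block e q p))
        (trans (ℤₚ.*-identityˡ _) (trans (cong (λ t → x (pred t)) (ℕₚ.+-suc B a)) (sym (ext-in e B x (ℕₚ.≤-trans (ℕₚ.n≤1+n a) p)))))

    A-cong : ∀ e {x y} → (∀ k → x k ≡ y k) → ∀ k → A e x k ≡ A e y k
    A-cong e h k = cong₂ _+_ (cong (edge e (suc k) *_) (h (suc k))) (cong (edge e k *_) (h (pred k)))

    A-+ : ∀ e x y k → A e (λ j → x j + y j) k ≡ A e x k + A e y k
    A-+ e x y k = distr4 (edge e (suc k)) (edge e k) (x (suc k)) (y (suc k)) (x (pred k)) (y (pred k))

    A-neg : ∀ e x k → A e (λ j → - x j) k ≡ - A e x k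
    A-neg e x k = neg2 (edge e (suc k)) (edge e k) (x (suc k)) (x (pred k))

    A-0 : ∀ e k → A e (λ _ → 0ℤ) k ≡ 0ℤ
    A-0 e k = cong₂ _+_ (ℤₚ.*-zeroʳ (edge e (suc k))) (ℤₚ.*-zeroʳ (edge e k))

    A-NN : ∀ e {x} → NN x → NN (A e x)
    A-NN e {x} h k = +-NN (link-NN (suc k % suc e) (x (suc k)) (h (suc k))) (link-NN (k % suc e) (x (pred k)) (h (pred k)))

    A-triv : ∀ x k → A 0 x k ≡ 0ℤ
    A-triv x k = cong₂ _+_ (lem (suc k) (x (suc k))) (lem k (x (pred k)))
      where
      lem : ∀ j y → link (j % 1) * y ≡ 0ℤ
      lem j y = trans (cong (λ t → link t * y) (ℕₚ.n<1⇒n≡0 (m%n<n j 1))) (ℤₚ.*-zeroˡ y)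

  nn-sum0 : ∀ {x y} → 0ℤ ≤ x → 0ℤ ≤ y → x + y ≡ 0ℤ → x ≡ 0ℤ × y ≡ 0ℤ
  nn-sum0 {x} {y} hx hy eq =
    ℤₚ.≤-antisym (subst (x ≤_) eq (subst (_≤ x + y) (ℤₚ.+-identityʳ x) (ℤₚ.+-monoʳ-≤ x hy))) hx ,
    ℤₚ.≤-antisym (subst (y ≤_) eq (subst (_≤ x + y) (ℤₚ.+-identityˡ y) (ℤₚ.+-monoˡ-≤ y hx))) hy

  blockOf : ∀ e k → ∃[ q ] ∃[ a ] a ℕ.≤ e × k ≡ q ℕ.* suc e ℕ.+ a
  blockOf e k = k / suc e , k % suc e , ℕₚ.≤-pred (m%n<n k (suc e)) ,
    trans (m≡m%n+[m/n]*n k (suc e)) (ℕₚ.+-comm (k % suc e) _)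

  -- In a path with at least two vertices each vertex has a neighbour, and the value of `A` there is
  -- a sum of nonnegative terms, one of them the given coefficient. Without the sign condition paths
  -- of odd size have a kernel.
  A-inj-NN : ∀ e x → NN x → (∀ k → A (suc e) x k ≡ 0ℤ) → ∀ k → x k ≡ 0ℤ
  A-inj-NN e x h az k with blockOf (suc e) k
  ... | q , zero , a≤ , refl = trans (sym (ext-in (suc e) B x a≤)) (proj₂ (nn-sum0 (ext-NN (suc e) B x h 3) (ext-NN (suc e) B x h 1)
          (trans (sym (A-ext (suc e) q x {1} (s≤s z≤n))) (az (B ℕ.+ 1)))))
    where B = q ℕ.* suc (suc e)
  ... | q , suc a , a≤ , refl = trans (sym (ext-in (suc e) B x a≤)) (proj₁ (nn-sum0 (ext-NN (suc e) B x h (suc (suc a))) (ext-NN (suc e) B x h a)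
          (trans (sym (A-ext (suc e) q x {a} (ℕₚ.≤-trans (ℕₚ.n≤1+n a) a≤))) (az (B ℕ.+ a)))))
    where B = q ℕ.* suc (suc e)

  -- The discrete wave equation on a segment with fixed ends 0 and m = e + 2; g and h are the
  -- two travelling waves, which are reflected at the ends.
  module Wave (e : ℕ) (G : ℕ → ℕ → ℤ) (G0 : ∀ k → G k 0 ≡ 0ℤ) (Gm : ∀ k → G k (2 ℕ.+ e) ≡ 0ℤ)
    (wave : ∀ k a → a ℕ.≤ e → G (2 ℕ.+ k) (suc a) + G k (suc a) ≡ G (suc k) (2 ℕ.+ a) + G (suc k) a) where

    g : ℕ → ℕ → ℤ
    g k a = G (suc k) (suc a) - G k a

    h : ℕ → ℕ → ℤ
    h k a = G (suc k) a - G k (suc a)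

    private
      mv : ∀ w x y z → w + x ≡ y + z → w - z ≡ y - x
      mv w x y z eq = trans (l1 w x z) (trans (cong (_- (x + z)) eq) (l2 y z x))
        where
        l1 : ∀ w x z → w - z ≡ (w + x) - (x + z)
        l1 = solve-∀
        l2 : ∀ y z x → (y + z) - (x + z) ≡ y - x
        l2 = solve-∀
      mv' : ∀ w x y z → w + x ≡ y + z → w - y ≡ z - x
      mv' w x y z eq = mv w x z y (trans eq (ℤₚ.+-comm y z))
      step : ∀ u v → u ≡ v + (u - v)
      step = solve-∀

    g-step : ∀ k a → a ℕ.≤ e → g (suc k) a ≡ g k (suc a)
    g-step k a p = mv (G (2 ℕ.+ k) (suc a)) (G k (suc a)) (G (suc k) (2 ℕ.+ a)) (G (suc k) a) (wave k a p)

    h-step : ∀ k a → a ℕ.≤ e → h (suc k) (suc a) ≡ h k a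
    h-step k a p = mv' (G (2 ℕ.+ k) (suc a)) (G k (suc a)) (G (suc k) (2 ℕ.+ a)) (G (suc k) a) (wave k a p)

    g-shift : ∀ j k i → i ℕ.+ j ℕ.≤ suc e → g (j ℕ.+ k) i ≡ g k (i ℕ.+ j)
    g-shift zero k i p = cong (g k) (sym (ℕₚ.+-identityʳ i))
    g-shift (suc j) k i p = trans (g-step (j ℕ.+ k) i (ℕₚ.≤-trans (ℕₚ.m≤m+n i j) (ℕₚ.≤-pred (subst (ℕ._≤ suc e) (ℕₚ.+-suc i j) p))))
      (trans (g-shift j k (suc i) (subst (ℕ._≤ suc e) (ℕₚ.+-suc i j) p)) (cong (g k) (sym (ℕₚ.+-suc i j))))

    -- The parallelogram rule of the wave equation for a rectangle bounded by characteristics; its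
    -- fourth corner, at time `a' + k`, lies on the wall 0 and contributes nothing.
    anti′ : ∀ k a' i → i ℕ.+ a' ℕ.≤ 2 ℕ.+ e → G (a' ℕ.+ (i ℕ.+ k)) i ≡ G (i ℕ.+ k) (i ℕ.+ a') - G k a'
    anti′ k a' zero p = trans (G0 _) (sym (ℤₚ.+-inverseʳ (G k a')))
    anti′ k a' (suc i) p = begin
      G (a' ℕ.+ suc (i ℕ.+ k)) (suc i) ≡⟨ cong (λ t → G t (suc i)) (ℕₚ.+-suc a' (i ℕ.+ k)) ⟩
      G (suc (a' ℕ.+ (i ℕ.+ k))) (suc i) ≡⟨ step _ (G (a' ℕ.+ (i ℕ.+ k)) i) ⟩
      G (a' ℕ.+ (i ℕ.+ k)) i + g (a' ℕ.+ (i ℕ.+ k)) i ≡⟨ cong₂ _+_ (anti′ k a' i (ℕₚ.≤-trans (ℕₚ.n≤1+n _) p)) (g-shift a' (i ℕ.+ k) i (ℕₚ.≤-pred p)) ⟩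
      (G (i ℕ.+ k) (i ℕ.+ a') - G k a') + g (i ℕ.+ k) (i ℕ.+ a') ≡⟨ l (G (i ℕ.+ k) (i ℕ.+ a')) (G k a') (G (suc (i ℕ.+ k)) (suc (i ℕ.+ a'))) ⟩
      G (suc (i ℕ.+ k)) (suc (i ℕ.+ a')) - G k a' ∎
      where
      l : ∀ u v w → (u - v) + (w - u) ≡ w - v
      l = solve-∀

    -- The rectangle of `anti′` now has a second corner on the far wall, so only two opposite
    -- corners are left.
    antiperiodic : ∀ k a a' → a ℕ.+ a' ≡ 2 ℕ.+ e → G (2 ℕ.+ e ℕ.+ k) a ≡ - G k a'
    antiperiodic k a a' eq = begin
      G (2 ℕ.+ e ℕ.+ k) a ≡⟨ cong (λ t → G t a) (trans (cong (ℕ._+ k) (trans (sym eq) (ℕₚ.+-comm a a'))) (ℕₚ.+-assoc a' a k)) ⟩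
      G (a' ℕ.+ (a ℕ.+ k)) a ≡⟨ anti′ k a' a (ℕₚ.≤-reflexive eq) ⟩
      G (a ℕ.+ k) (a ℕ.+ a') - G k a' ≡⟨ cong (_- G k a') (trans (cong (G (a ℕ.+ k)) eq) (Gm _)) ⟩
      0ℤ - G k a' ≡⟨ ℤₚ.+-identityˡ _ ⟩
      - G k a' ∎

    module Start (G00 : ∀ a → G 0 a ≡ 0ℤ) where

      -- Time reversal for a string starting at rest position. Antiperiodicity determines the rows m
      -- and m + 1 from the rows 0 and 1, and from there the wave equation is run backwards.
      reflect : ∀ j j' → j ℕ.+ j' ≡ 2 ℕ.+ e → ∀ a a' → a ℕ.+ a' ≡ 2 ℕ.+ e → G j' a ≡ G j a'
      reflect zero j' refl a a' eq = trans (cong (λ t → G t a) (sym (ℕₚ.+-identityʳ (2 ℕ.+ e))))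
        (trans (antiperiodic 0 a a' eq) (trans (cong -_ (G00 a')) (sym (G00 a'))))
      reflect (suc j) j' ej zero a' refl = trans (G0 _) (sym (Gm _))
      reflect (suc j) j' ej (suc a) zero eq = trans (cong (G j') (trans (sym (ℕₚ.+-identityʳ _)) eq)) (trans (Gm _) (sym (G0 _)))
      reflect (suc zero) j' refl (suc a) (suc a') eq = trans (sym (l _ _ (trans (wave (suc e) a a≤e) (cong₂ _+_ (z (2 ℕ.+ a) a' e2) (z a (2 ℕ.+ a') e3))))) (trans (cong -_ lem) (ℤₚ.neg-involutive _))
        where
        a≤e : a ℕ.≤ e
        a≤e = subst (a ℕ.≤_) (ℕₚ.suc-injective (ℕₚ.suc-injective (trans (cong suc (sym (ℕₚ.+-suc a a'))) eq))) (ℕₚ.m≤m+n a a')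
        e2 : 2 ℕ.+ a ℕ.+ a' ≡ 2 ℕ.+ e
        e2 = trans (cong suc (sym (ℕₚ.+-suc a a'))) eq
        e3 : a ℕ.+ (2 ℕ.+ a') ≡ 2 ℕ.+ e
        e3 = trans (ℕₚ.+-suc a (suc a')) eq
        z : ∀ x y → x ℕ.+ y ≡ 2 ℕ.+ e → G (2 ℕ.+ e) x ≡ 0ℤ
        z x y p = trans (reflect zero (2 ℕ.+ e) refl x y p) (G00 y)
        lem : G (3 ℕ.+ e) (suc a) ≡ - G 1 (suc a')
        lem = trans (cong (λ t → G t (suc a)) (ℕₚ.+-comm 1 (2 ℕ.+ e))) (antiperiodic 1 (suc a) (suc a') eq)
        l : ∀ u v → u + v ≡ 0ℤ + 0ℤ → - u ≡ v
        l u v p = trans (l1 u v) (trans (cong (λ t → v - t) p) (l2 v))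
          where
          l1 : ∀ u v → - u ≡ v - (u + v)
          l1 = solve-∀
          l2 : ∀ v → v - (0ℤ + 0ℤ) ≡ v
          l2 = solve-∀
      reflect (suc (suc j)) j' ej (suc a) (suc a') eq = begin
        G j' (suc a) ≡⟨ l _ _ _ (wave j' a a≤e) ⟩
        (G (suc j') (2 ℕ.+ a) + G (suc j') a) - G (2 ℕ.+ j') (suc a)
          ≡⟨ cong₂ _-_ (cong₂ _+_ (reflect (suc j) (suc j') ej1 (2 ℕ.+ a) a' e2) (reflect (suc j) (suc j') ej1 a (2 ℕ.+ a') e3)) (reflect j (2 ℕ.+ j') ej2 (suc a) (suc a') eq) ⟩
        (G (suc j) a' + G (suc j) (2 ℕ.+ a')) - G j (suc a') ≡⟨ cong (_- G j (suc a')) (ℤₚ.+-comm (G (suc j) a') _) ⟩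
        (G (suc j) (2 ℕ.+ a') + G (suc j) a') - G j (suc a') ≡⟨ cong (_- G j (suc a')) (sym (wave j a' a'≤e)) ⟩
        (G (2 ℕ.+ j) (suc a') + G j (suc a')) - G j (suc a') ≡⟨ l3 (G (2 ℕ.+ j) (suc a')) _ ⟩
        G (2 ℕ.+ j) (suc a') ∎
        where
        e2 : 2 ℕ.+ a ℕ.+ a' ≡ 2 ℕ.+ e
        e2 = trans (cong suc (sym (ℕₚ.+-suc a a'))) eq
        e3 : a ℕ.+ (2 ℕ.+ a') ≡ 2 ℕ.+ e
        e3 = trans (ℕₚ.+-suc a (suc a')) eq
        a≤e : a ℕ.≤ e
        a≤e = subst (a ℕ.≤_) (ℕₚ.suc-injective (ℕₚ.suc-injective e2)) (ℕₚ.m≤m+n a a')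
        a'≤e : a' ℕ.≤ e
        a'≤e = subst (a' ℕ.≤_) (ℕₚ.suc-injective (ℕₚ.suc-injective e2)) (ℕₚ.m≤n+m a' a)
        ej1 : suc j ℕ.+ suc j' ≡ 2 ℕ.+ e
        ej1 = trans (cong suc (ℕₚ.+-suc j j')) ej
        ej2 : j ℕ.+ (2 ℕ.+ j') ≡ 2 ℕ.+ e
        ej2 = trans (ℕₚ.+-suc j (suc j')) ej1
        l : ∀ u v w → u + v ≡ w → v ≡ w - u
        l u v w p = trans (l1 u v) (cong (_- u) p)
          where
          l1 : ∀ u v → v ≡ (u + v) - u
          l1 = solve-∀
        l3 : ∀ u v → (u + v) - v ≡ u
        l3 = solve-∀

      module Positive (G1 : ∀ a → 0ℤ ≤ G 1 a) where

        -- Each step along the diagonal adds a value of `g`, which is constant along characteristics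
        -- and can be traced back to an entry of `G 1` as long as the trace does not meet the far
        -- wall. `regionII` is the same argument with `h`, coming from the other side.
        regionI : ∀ k a → a ℕ.+ k ℕ.≤ 2 ℕ.+ e → 0ℤ ≤ G k a
        regionI zero a p = ℤₚ.≤-reflexive (sym (G00 a))
        regionI (suc k) zero p = ℤₚ.≤-reflexive (sym (G0 _))
        regionI (suc k) (suc a) p = subst (0ℤ ≤_) (sym (step _ (G k a)))
          (+-NN (regionI k a (ℕₚ.≤-trans (ℕₚ.n≤1+n _) (ℕₚ.≤-trans (ℕₚ.≤-reflexive (sym (ℕₚ.+-suc a k))) (ℕₚ.≤-trans (ℕₚ.n≤1+n _) p))))
            (subst (0ℤ ≤_) (sym eq) (G1 _)))
          where
          q : a ℕ.+ k ℕ.≤ suc e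
          q = ℕₚ.≤-pred (ℕₚ.≤-trans (ℕₚ.n≤1+n _) (subst (ℕ._≤ 2 ℕ.+ e) (cong suc (ℕₚ.+-suc a k)) p))
          eq : g k a ≡ G 1 (suc (a ℕ.+ k))
          eq = trans (cong (λ t → g t a) (sym (ℕₚ.+-identityʳ k))) (trans (g-shift k 0 a q)
            (trans (cong (λ t → G 1 (suc (a ℕ.+ k)) - t) (G00 _)) (ℤₚ.+-identityʳ _)))

        h-diag : ∀ k c → k ℕ.+ c ℕ.≤ suc e → h k (k ℕ.+ c) ≡ G 1 c
        h-diag zero c p = trans (cong (λ t → G 1 c - t) (G00 _)) (ℤₚ.+-identityʳ _)
        h-diag (suc k) c p = trans (h-step k (k ℕ.+ c) (ℕₚ.≤-pred p)) (h-diag k c (ℕₚ.≤-trans (ℕₚ.n≤1+n _) p))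

        regionII : ∀ k c → k ℕ.+ c ℕ.≤ suc e → 0ℤ ≤ G (suc k) (k ℕ.+ c)
        regionII zero c p = G1 c
        regionII (suc k) c p = subst (0ℤ ≤_) (sym (step _ (G (suc k) (suc (suc k ℕ.+ c)))))
          (+-NN prev (subst (0ℤ ≤_) (sym (h-diag (suc k) c p)) (G1 c)))
          where
          prev : 0ℤ ≤ G (suc k) (suc (suc k ℕ.+ c))
          prev with ℕₚ.m≤n⇒m<n∨m≡n p
          ... | inj₂ eq = ℤₚ.≤-reflexive (sym (trans (cong (λ t → G (suc k) (suc t)) eq) (Gm _)))
          ... | inj₁ lt = subst (λ t → 0ℤ ≤ G (suc k) t) eq (regionII k (2 ℕ.+ c) (subst (ℕ._≤ suc e) (sym eq) lt))
            where
            eq : k ℕ.+ (2 ℕ.+ c) ≡ suc (suc k ℕ.+ c)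
            eq = trans (ℕₚ.+-suc k (suc c)) (cong suc (ℕₚ.+-suc k c))

        -- Up to half of the antiperiod the two regions cover the whole segment; `reflect` then
        -- carries the signs to the other half.
        half : ∀ k a → k ℕ.+ k ℕ.≤ 2 ℕ.+ e → a ℕ.≤ suc e → 0ℤ ≤ G k a
        half zero a p q = ℤₚ.≤-reflexive (sym (G00 a))
        half (suc k) a p q with ℕₚ.≤-total k a
        ... | inj₁ k≤a = subst (λ t → 0ℤ ≤ G (suc k) t) (ℕₚ.m+[n∸m]≡n k≤a)
                (regionII k (a ℕ.∸ k) (subst (ℕ._≤ suc e) (sym (ℕₚ.m+[n∸m]≡n k≤a)) q))
        ... | inj₂ a≤k = regionI (suc k) a (ℕₚ.≤-trans (ℕₚ.+-monoˡ-≤ (suc k) (ℕₚ.≤-trans a≤k (ℕₚ.n≤1+n k))) p)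

        positive : ∀ k a → k ℕ.≤ 2 ℕ.+ e → a ℕ.≤ 2 ℕ.+ e → 0ℤ ≤ G k a
        positive k a p q with k ℕ.+ k ℕ.≤? 2 ℕ.+ e | ℕₚ.m≤n⇒m<n∨m≡n q
        ... | yes r | inj₁ lt = half k a r (ℕₚ.≤-pred lt)
        ... | _ | inj₂ refl = ℤₚ.≤-reflexive (sym (Gm k))
        ... | no r | inj₁ lt = subst (0ℤ ≤_) (sym (reflect j k ej a (2 ℕ.+ e ℕ.∸ a) (ℕₚ.m+[n∸m]≡n q))) (pos2 a q)
          where
          j = 2 ℕ.+ e ℕ.∸ k
          ej : j ℕ.+ k ≡ 2 ℕ.+ e
          ej = ℕₚ.m∸n+n≡m p
          jj : j ℕ.+ j ℕ.≤ 2 ℕ.+ e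
          jj = ℕₚ.≤-trans (ℕₚ.+-monoʳ-≤ j j≤k) (ℕₚ.≤-reflexive ej)
            where
            j≤k : j ℕ.≤ k
            j≤k = ℕₚ.≮⇒≥ λ k<j → r (ℕₚ.≤-trans (ℕₚ.+-monoˡ-≤ k (ℕₚ.<⇒≤ k<j)) (ℕₚ.≤-reflexive ej))
          pos2 : ∀ a → a ℕ.≤ 2 ℕ.+ e → 0ℤ ≤ G j (2 ℕ.+ e ℕ.∸ a)
          pos2 zero _ = ℤₚ.≤-reflexive (sym (Gm j))
          pos2 (suc a) _ = half j _ jj (ℕₚ.m∸n≤m (suc e) a)

  chain : ℕ → M → M → ℕ → M
  chain e x y zero          = x
  chain e x y (suc zero)    = y
  chain e x y (suc (suc k)) = λ j → A e (chain e x y (suc k)) j - chain e x y k j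

  module Chain (e : ℕ) (x y : M) (q : ℕ) where
    private B = q ℕ.* suc e
    G : ℕ → ℕ → ℤ
    G k a = ext e B (chain e x y k) a

    private
      cancel : ∀ u v → (u - v) + v ≡ u
      cancel = solve-∀

    open Wave e G (λ _ → refl) (λ k → ext-out e B (chain e x y k))
      (λ k a p → trans (cong₂ _+_ (ext-in e B (chain e x y (2 ℕ.+ k)) p) (ext-in e B (chain e x y k) p))
        (trans (cancel (A e (chain e x y (suc k)) (B ℕ.+ a)) _) (A-ext e q (chain e x y (suc k)) p))) public

  chain-periodic : ∀ e x y k j → chain e x y ((2 ℕ.+ e) ℕ.+ ((2 ℕ.+ e) ℕ.+ k)) j ≡ chain e x y k j
  chain-periodic e x y k j with blockOf e j
  ... | q , a , p , refl = begin
    chain e x y (m ℕ.+ (m ℕ.+ k)) (B ℕ.+ a) ≡⟨ sym (ext-in e B (chain e x y (m ℕ.+ (m ℕ.+ k))) p) ⟩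
    C.G (m ℕ.+ (m ℕ.+ k)) (suc a) ≡⟨ C.antiperiodic (m ℕ.+ k) (suc a) (suc (e ℕ.∸ a)) eq ⟩
    - C.G (m ℕ.+ k) (suc (e ℕ.∸ a)) ≡⟨ cong -_ (C.antiperiodic k (suc (e ℕ.∸ a)) (suc a) (trans (ℕₚ.+-comm (suc (e ℕ.∸ a)) (suc a)) eq)) ⟩
    - - C.G k (suc a) ≡⟨ ℤₚ.neg-involutive _ ⟩
    C.G k (suc a) ≡⟨ ext-in e B (chain e x y k) p ⟩
    chain e x y k (B ℕ.+ a) ∎
    where
    m = 2 ℕ.+ e
    B = q ℕ.* suc e
    module C = Chain e x y q
    eq : suc a ℕ.+ suc (e ℕ.∸ a) ≡ 2 ℕ.+ e
    eq = trans (ℕₚ.+-suc (suc a) (e ℕ.∸ a)) (cong (λ t → suc (suc t)) (ℕₚ.m+[n∸m]≡n p))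

  cheb : ℕ → M → ℕ → M
  cheb e x = chain e (λ _ → 0ℤ) x

  ext-0 : ∀ e B a → ext e B (λ _ → 0ℤ) a ≡ 0ℤ
  ext-0 e B zero = refl
  ext-0 e B (suc a) with a ℕ.≤? e
  ... | yes _ = refl
  ... | no _ = refl

  cheb-NN : ∀ e x → NN x → ∀ k → k ℕ.≤ 2 ℕ.+ e → NN (cheb e x k)
  cheb-NN e x h k p j with blockOf e j
  ... | q , a , a≤ , refl = subst (0ℤ ≤_) (ext-in e B (cheb e x k) a≤)
      (C.Start.Positive.positive (ext-0 e B) (ext-NN e B x h) k (suc a) p (s≤s (ℕₚ.≤-trans a≤ (ℕₚ.n≤1+n e))))
    where
    B = q ℕ.* suc e
    module C = Chain e (λ _ → 0ℤ) x q

  harmonic0 : ∀ e (S : ℕ → ℤ) → S 0 ≡ 0ℤ → S (2 ℕ.+ e) ≡ 0ℤ →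
    (∀ a → a ℕ.≤ e → S (2 ℕ.+ a) ≡ + 2 * S (suc a) - S a) → ∀ a → a ℕ.≤ 2 ℕ.+ e → S a ≡ 0ℤ
  harmonic0 e S S0 Sm rec a p = trans (lin a p) (trans (cong (+ a *_) S1) (ℤₚ.*-zeroʳ (+ a)))
    where
    l1 : ∀ n s → + 2 * ((1ℤ + n) * s) - n * s ≡ (1ℤ + (1ℤ + n)) * s
    l1 = solve-∀
    lin : ∀ a → a ℕ.≤ 2 ℕ.+ e → S a ≡ + a * S 1
    lin zero _ = trans S0 (sym (ℤₚ.*-zeroˡ (S 1)))
    lin (suc zero) _ = sym (ℤₚ.*-identityˡ (S 1))
    lin (suc (suc a)) p = trans (rec a (ℕₚ.≤-pred (ℕₚ.≤-pred p)))
      (trans (cong₂ (λ u v → + 2 * u - v) (lin (suc a) (ℕₚ.≤-trans (ℕₚ.n≤1+n _) p)) (lin a (ℕₚ.≤-trans (ℕₚ.≤-trans (ℕₚ.n≤1+n _) (ℕₚ.n≤1+n _)) p)))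
        (l1 (+ a) (S 1)))
    S1 : S 1 ≡ 0ℤ
    S1 with ℤₚ.i*j≡0⇒i≡0∨j≡0 (+ (2 ℕ.+ e)) (trans (sym (lin (2 ℕ.+ e) ℕₚ.≤-refl)) Sm)
    ... | inj₂ r = r

  sgn : ℕ → ℤ
  sgn zero = 1ℤ
  sgn (suc k) = - sgn k

  sgn² : ∀ k → sgn k * sgn k ≡ 1ℤ
  sgn² zero = refl
  sgn² (suc k) = trans (l (sgn k)) (sgn² k)
    where
    l : ∀ s → (- s) * (- s) ≡ s * s
    l = solve-∀

  -- The Cartan matrix of a dihedral pair has no kernel: `Y + Z`, and `Y - Z` taken with alternating
  -- signs, are discrete harmonic on a segment and vanish at its ends.
  coupled0 : ∀ e y z → (∀ k → + 2 * y k ≡ A e z k) → (∀ k → + 2 * z k ≡ A e y k) → ∀ k → y k ≡ 0ℤ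
  coupled0 e y z h₁ h₂ k with blockOf e k
  ... | q , a , a≤ , refl = trans (sym (ext-in e B y a≤)) (final (Y (suc a)) (Z (suc a)) (S0 (suc a) a≤') (D0 (suc a) a≤'))
    where
    B = q ℕ.* suc e
    Y = ext e B y
    Z = ext e B z
    a≤' : suc a ℕ.≤ 2 ℕ.+ e
    a≤' = s≤s (ℕₚ.≤-trans a≤ (ℕₚ.n≤1+n e))
    rY : ∀ a → a ℕ.≤ e → + 2 * Y (suc a) ≡ Z (2 ℕ.+ a) + Z a
    rY a p = trans (cong (+ 2 *_) (ext-in e B y p)) (trans (h₁ _) (A-ext e q z p))
    rZ : ∀ a → a ℕ.≤ e → + 2 * Z (suc a) ≡ Y (2 ℕ.+ a) + Y a
    rZ a p = trans (cong (+ 2 *_) (ext-in e B z p)) (trans (h₂ _) (A-ext e q y p))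
    m = 2 ℕ.+ e
    S0 : ∀ a → a ℕ.≤ m → Y a + Z a ≡ 0ℤ
    S0 = harmonic0 e (λ a → Y a + Z a) refl (cong₂ _+_ (ext-out e B y) (ext-out e B z))
      (λ a p → trans (l1 (Y (2 ℕ.+ a)) (Y a) (Z (2 ℕ.+ a)) (Z a)) (trans (cong₂ (λ u v → (u + v) - (Y a + Z a)) (sym (rZ a p)) (sym (rY a p))) (l2 (Y (suc a)) (Z (suc a)) (Y a + Z a))))
      where
      l1 : ∀ u v w x → u + w ≡ ((u + v) + (w + x)) - (v + x)
      l1 = solve-∀
      l2 : ∀ y z r → (+ 2 * z + + 2 * y) - r ≡ + 2 * (y + z) - r
      l2 = solve-∀
    D0' : ∀ a → a ℕ.≤ m → sgn a * (Y a - Z a) ≡ 0ℤ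
    D0' = harmonic0 e (λ a → sgn a * (Y a - Z a)) refl
      (trans (cong₂ (λ u v → sgn m * (u - v)) (ext-out e B y) (ext-out e B z)) (ℤₚ.*-zeroʳ (sgn m)))
      (λ a p → trans (l1 (sgn a) (Y (2 ℕ.+ a)) (Y a) (Z (2 ℕ.+ a)) (Z a))
         (trans (cong₂ (λ u v → sgn a * ((u - v) - (Y a - Z a))) (sym (rZ a p)) (sym (rY a p))) (l2 (sgn a) (Y (suc a)) (Z (suc a)) (Y a - Z a))))
      where
      l1 : ∀ s u v w x → (- - s) * (u - w) ≡ s * (((u + v) - (w + x)) - (v - x))
      l1 = solve-∀
      l2 : ∀ s y z r → s * ((+ 2 * z - + 2 * y) - r) ≡ + 2 * ((- s) * (y - z)) - s * r
      l2 = solve-∀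
    D0 : ∀ a → a ℕ.≤ m → Y a - Z a ≡ 0ℤ
    D0 a p = trans (sym (ℤₚ.*-identityˡ _)) (trans (cong (_* (Y a - Z a)) (sym (sgn² a)))
      (trans (ℤₚ.*-assoc (sgn a) (sgn a) _) (trans (cong (sgn a *_) (D0' a p)) (ℤₚ.*-zeroʳ (sgn a)))))
    final : ∀ u v → u + v ≡ 0ℤ → u - v ≡ 0ℤ → u ≡ 0ℤ
    final u v p r with ℤₚ.i*j≡0⇒i≡0∨j≡0 (+ 2) (trans (l u v) (cong₂ _+_ p r))
      where
      l : ∀ u v → + 2 * u ≡ (u + v) + (u - v)
      l = solve-∀
    ... | inj₂ s = s

  interchange : ∀ u v w x → (u + v) + (w + x) ≡ (u + w) + (v + x)
  interchange = solve-∀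

  opaque
    sumTo : ℕ → (ℕ → ℤ) → ℤ
    sumTo zero f = 0ℤ
    sumTo (suc K) f = sumTo K f + f K

    sumTo-cong : ∀ K {f g} → (∀ k → f k ≡ g k) → sumTo K f ≡ sumTo K g
    sumTo-cong zero h = refl
    sumTo-cong (suc K) h = cong₂ _+_ (sumTo-cong K h) (h K)

    sumTo-+ : ∀ K f g → sumTo K (λ k → f k + g k) ≡ sumTo K f + sumTo K g
    sumTo-+ zero f g = refl
    sumTo-+ (suc K) f g = trans (cong (_+ (f K + g K)) (sumTo-+ K f g)) (interchange (sumTo K f) (sumTo K g) (f K) (g K))

    sumTo-neg : ∀ K f → sumTo K (λ k → - f k) ≡ - sumTo K f
    sumTo-neg zero f = refl
    sumTo-neg (suc K) f = trans (cong (_+ (- f K)) (sumTo-neg K f)) (sym (ℤₚ.neg-distrib-+ (sumTo K f) (f K)))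

    sumTo-0 : ∀ K f → (∀ k → f k ≡ 0ℤ) → sumTo K f ≡ 0ℤ
    sumTo-0 zero f h = refl
    sumTo-0 (suc K) f h = cong₂ _+_ (sumTo-0 K f h) (h K)

    sumTo-NN : ∀ K f → (∀ k → 0ℤ ≤ f k) → 0ℤ ≤ sumTo K f
    sumTo-NN zero f h = ℤₚ.≤-refl
    sumTo-NN (suc K) f h = +-NN (sumTo-NN K f h) (h K)

    sumTo-single : ∀ K f j → j ℕ.< K → (∀ k → k ≢ j → f k ≡ 0ℤ) → sumTo K f ≡ f j
    sumTo-single (suc K) f j p h with j ℕ.≟ K
    ... | yes refl = trans (cong (_+ f j) (below K ℕₚ.≤-refl)) (ℤₚ.+-identityˡ _)
      where
      below : ∀ k → k ℕ.≤ j → sumTo k f ≡ 0ℤ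
      below zero _ = refl
      below (suc k) q = cong₂ _+_ (below k (ℕₚ.<⇒≤ q)) (h k (ℕₚ.<⇒≢ q))
    ... | no j≢K = trans (cong₂ _+_ (sumTo-single K f j (ℕₚ.≤∧≢⇒< (ℕₚ.≤-pred p) j≢K) h) (h K (λ q → j≢K (sym q)))) (ℤₚ.+-identityʳ _)

    ⟪_⟫ : ℕ → M → M → ℤ
    ⟪ K ⟫ x y = sumTo K (λ k → x k * y k)

    pair-cong : ∀ K {x x' y y'} → (∀ k → x k ≡ x' k) → (∀ k → y k ≡ y' k) → ⟪ K ⟫ x y ≡ ⟪ K ⟫ x' y'
    pair-cong K h h' = sumTo-cong K (λ k → cong₂ _*_ (h k) (h' k))

    pair-comm : ∀ K x y → ⟪ K ⟫ x y ≡ ⟪ K ⟫ y x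
    pair-comm K x y = sumTo-cong K (λ k → ℤₚ.*-comm (x k) (y k))

    pair-+ʳ : ∀ K x y z → ⟪ K ⟫ x (λ k → y k + z k) ≡ ⟪ K ⟫ x y + ⟪ K ⟫ x z
    pair-+ʳ K x y z = trans (sumTo-cong K (λ k → ℤₚ.*-distribˡ-+ (x k) (y k) (z k))) (sumTo-+ K (λ k → x k * y k) (λ k → x k * z k))

    pair-negʳ : ∀ K x y → ⟪ K ⟫ x (λ k → - y k) ≡ - ⟪ K ⟫ x y
    pair-negʳ K x y = trans (sumTo-cong K (λ k → sym (ℤₚ.neg-distribʳ-* (x k) (y k)))) (sumTo-neg K (λ k → x k * y k))

    pair-0ʳ : ∀ K x {y} → (∀ k → y k ≡ 0ℤ) → ⟪ K ⟫ x y ≡ 0ℤ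
    pair-0ʳ K x {y} h = sumTo-0 K _ (λ k → trans (cong (x k *_) (h k)) (ℤₚ.*-zeroʳ (x k)))

    *-NN : ∀ {x y} → 0ℤ ≤ x → 0ℤ ≤ y → 0ℤ ≤ x * y
    *-NN {+ x} {+ y} p q = subst (0ℤ ≤_) (ℤₚ.pos-* x y) (ℤ.+≤+ z≤n)

    pair-NN : ∀ K {x y} → NN x → NN y → 0ℤ ≤ ⟪ K ⟫ x y
    pair-NN K hx hy = sumTo-NN K _ (λ k → *-NN (hx k) (hy k))

    δ : ℕ → M
    δ j k with k ℕ.≟ j
    ... | yes _ = 1ℤ
    ... | no _ = 0ℤ

    δ-NN : ∀ j → NN (δ j)
    δ-NN j k with k ℕ.≟ j
    ... | yes _ = ℤ.+≤+ z≤n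
    ... | no _ = ℤₚ.≤-refl

    pair-δ : ∀ K j y → j ℕ.< K → ⟪ K ⟫ (δ j) y ≡ y j
    pair-δ K j y p = trans (sumTo-single K (λ k → δ j k * y k) j p off) on
      where
      off : ∀ k → k ≢ j → δ j k * y k ≡ 0ℤ
      off k q with k ℕ.≟ j
      ... | yes r = ⊥-elim (q r)
      ... | no _ = ℤₚ.*-zeroˡ (y k)
      on : δ j j * y j ≡ y j
      on with j ℕ.≟ j
      ... | yes _ = ℤₚ.*-identityˡ (y j)
      ... | no q = ⊥-elim (q refl)

  tele-step : ∀ L R b' b₀ x₀ x₁ x₂ y₀ y₁ y₂ → L + b₀ * (x₀ * y₁) ≡ R + b₀ * (x₁ * y₀) →
    (L + (b' * x₂ + b₀ * x₀) * y₁) + b' * (x₁ * y₂) ≡ (R + x₁ * (b' * y₂ + b₀ * y₀)) + b' * (x₂ * y₁)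
  tele-step L R b' b₀ x₀ x₁ x₂ y₀ y₁ y₂ h = trans (l1 L b' b₀ x₀ x₁ x₂ y₁ y₂) (trans (cong (_+ (b' * (x₂ * y₁) + b' * (x₁ * y₂))) h) (l2 R b' b₀ x₁ x₂ y₀ y₁ y₂))
    where
    l1 : ∀ L b' b₀ x₀ x₁ x₂ y₁ y₂ → (L + (b' * x₂ + b₀ * x₀) * y₁) + b' * (x₁ * y₂) ≡ (L + b₀ * (x₀ * y₁)) + (b' * (x₂ * y₁) + b' * (x₁ * y₂))
    l1 = solve-∀
    l2 : ∀ R b' b₀ x₁ x₂ y₀ y₁ y₂ → (R + b₀ * (x₁ * y₀)) + (b' * (x₂ * y₁) + b' * (x₁ * y₂)) ≡ (R + x₁ * (b' * y₂ + b₀ * y₀)) + b' * (x₂ * y₁)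
    l2 = solve-∀

  opaque
    unfolding A ⟪_⟫

    -- Summation by parts with boundary terms `P` and `Q`. Both vanish at `K` because a new path
    -- starts there.
    A-adjoint : ∀ e K → K % suc e ≡ 0 → ∀ x y → ⟪ K ⟫ (A e x) y ≡ ⟪ K ⟫ x (A e y)
    A-adjoint e K K0 x y = begin
      L K ≡⟨ sym (ℤₚ.+-identityʳ _) ⟩
      L K + 0ℤ ≡⟨ cong (λ t → L K + t) (sym (z (x (pred K) * y K))) ⟩
      L K + Q K ≡⟨ tele K ⟩
      R K + P K ≡⟨ cong (λ t → R K + t) (z (x K * y (pred K))) ⟩
      R K + 0ℤ ≡⟨ ℤₚ.+-identityʳ _ ⟩
      R K ∎
      where
      L R P Q : ℕ → ℤ
      L k = ⟪ k ⟫ (A e x) y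
      R k = ⟪ k ⟫ x (A e y)
      P k = edge e k * (x k * y (pred k))
      Q k = edge e k * (x (pred k) * y k)
      z : ∀ v → edge e K * v ≡ 0ℤ
      z v = trans (cong (λ t → link t * v) K0) (ℤₚ.*-zeroˡ v)
      tele : ∀ k → L k + Q k ≡ R k + P k
      tele zero = cong (λ t → 0ℤ + t) (trans (ℤₚ.*-zeroˡ (x 0 * y 0)) (sym (ℤₚ.*-zeroˡ (x 0 * y 0))))
      tele (suc k) = tele-step (L k) (R k) (edge e (suc k)) (edge e k) (x (pred k)) (x k) (x (suc k)) (y (pred k)) (y k) (y (suc k)) (tele k)

  pair-+ˡ : ∀ K x y z → ⟪ K ⟫ (λ k → x k + y k) z ≡ ⟪ K ⟫ x z + ⟪ K ⟫ y z
  pair-+ˡ K x y z = trans (pair-comm K _ z) (trans (pair-+ʳ K z x y) (cong₂ _+_ (pair-comm K z x) (pair-comm K z y)))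

  pair-negˡ : ∀ K x y → ⟪ K ⟫ (λ k → - x k) y ≡ - ⟪ K ⟫ x y
  pair-negˡ K x y = trans (pair-comm K _ y) (trans (pair-negʳ K y x) (cong -_ (pair-comm K y x)))

  pair-0ˡ : ∀ K {x} y → (∀ k → x k ≡ 0ℤ) → ⟪ K ⟫ x y ≡ 0ℤ
  pair-0ˡ K y h = trans (pair-comm K _ y) (pair-0ʳ K y h)

open PathOperators

-- The reflection representation with coefficients in sequences.

module Representation (C : CoxeterSystem) where

  open CoxeterSystem C public

  prodW : List (Fin n) → Fin N
  prodW = prod C

  pow : Fin N → ℕ → Fin N
  pow = powW _·_ e

  cancelˡ : ∀ x {y z} → x · y ≡ x · z → y ≡ z
  cancelˡ x {y} {z} eq = begin
    y ≡⟨ sym (idˡ y) ⟩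
    e · y ≡⟨ cong (_· y) (sym (invˡ x)) ⟩
    (inv x · x) · y ≡⟨ assoc _ _ _ ⟩
    inv x · (x · y) ≡⟨ cong (inv x ·_) eq ⟩
    inv x · (x · z) ≡⟨ sym (assoc _ _ _) ⟩
    (inv x · x) · z ≡⟨ cong (_· z) (invˡ x) ⟩
    e · z ≡⟨ idˡ z ⟩
    z ∎

  cancelʳ : ∀ x {y z} → y · x ≡ z · x → y ≡ z
  cancelʳ x {y} {z} eq = begin
    y ≡⟨ sym (idʳ y) ⟩
    y · e ≡⟨ cong (y ·_) (sym (invʳ x)) ⟩
    y · (x · inv x) ≡⟨ sym (assoc _ _ _) ⟩
    (y · x) · inv x ≡⟨ cong (_· inv x) eq ⟩
    (z · x) · inv x ≡⟨ assoc _ _ _ ⟩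
    z · (x · inv x) ≡⟨ cong (z ·_) (invʳ x) ⟩
    z · e ≡⟨ idʳ z ⟩
    z ∎

  gen-cancelˡ : ∀ i x → gen i · (gen i · x) ≡ x
  gen-cancelˡ i x = trans (sym (assoc _ _ _)) (trans (cong (_· x) (gen-involution i)) (idˡ x))

  gen-cancelʳ : ∀ i x → (x · gen i) · gen i ≡ x
  gen-cancelʳ i x = trans (assoc _ _ _) (trans (cong (x ·_) (gen-involution i)) (idʳ x))

  pow-+ : ∀ g a b → pow g (a ℕ.+ b) ≡ pow g a · pow g b
  pow-+ g zero b = sym (idˡ _)
  pow-+ g (suc a) b = trans (cong (g ·_) (pow-+ g a b)) (sym (assoc _ _ _))

  pow-swap : ∀ a b k → pow (b · a) k · b ≡ b · pow (a · b) k
  pow-swap a b zero = trans (idˡ b) (sym (idʳ b))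
  pow-swap a b (suc k) = begin
    ((b · a) · pow (b · a) k) · b ≡⟨ assoc _ _ _ ⟩
    (b · a) · (pow (b · a) k · b) ≡⟨ cong ((b · a) ·_) (pow-swap a b k) ⟩
    (b · a) · (b · pow (a · b) k) ≡⟨ assoc _ _ _ ⟩
    b · (a · (b · pow (a · b) k)) ≡⟨ cong (b ·_) (sym (assoc _ _ _)) ⟩
    b · ((a · b) · pow (a · b) k) ∎

  least : ∀ {P : ℕ → Set} → (∀ k → Dec (P k)) → ∀ k → P k → ∃[ m ] P m × m ℕ.≤ k × (∀ j → j ℕ.< m → ¬ P j)
  least {P} P? k pk = go k 0 (λ j ()) (ℕₚ.+-identityʳ k)
    where
    go : ∀ f m → (∀ j → j ℕ.< m → ¬ P j) → f ℕ.+ m ≡ k → ∃[ m ] P m × m ℕ.≤ k × (∀ j → j ℕ.< m → ¬ P j)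
    go f m h eq with P? m
    ... | yes p = m , p , subst (m ℕ.≤_) eq (ℕₚ.m≤n+m m f) , h
    go zero m h eq | no ¬p = ⊥-elim (¬p (subst P (sym eq) pk))
    go (suc f) m h eq | no ¬p = go f (suc m) (λ j lt → h' j (ℕₚ.m≤n⇒m<n∨m≡n (ℕₚ.≤-pred lt))) (trans (ℕₚ.+-suc f m) eq)
      where
      h' : ∀ j → j ℕ.< m ⊎ j ≡ m → ¬ P j
      h' j (inj₁ lt) = h j lt
      h' j (inj₂ refl) = ¬p

  -- The bound on the exponent is kept because it makes every path length divide `N !`, which is how
  -- the cuts are chosen.
  torsion : ∀ g → ∃[ k ] k ℕ.< N × pow g (suc k) ≡ e
  torsion g with pigeonhole (ℕₚ.n<1+n N) (λ k → pow g (toℕ k))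
  ... | i , j , i<j , eq with toℕ j ℕ.∸ toℕ i in d
  ... | zero = ⊥-elim (ℕₚ.<⇒≱ i<j (ℕₚ.m∸n≡0⇒m≤n d))
  ... | suc k = k , ℕₚ.≤-trans (ℕₚ.≤-reflexive (sym d)) (ℕₚ.≤-trans (ℕₚ.m∸n≤m (toℕ j) (toℕ i)) (ℕₚ.≤-pred (Fₚ.toℕ<n j))) ,
    cancelˡ (pow g (toℕ i)) (begin
      pow g (toℕ i) · pow g (suc k) ≡⟨ sym (pow-+ g (toℕ i) (suc k)) ⟩
      pow g (toℕ i ℕ.+ suc k) ≡⟨ cong (λ t → pow g (toℕ i ℕ.+ t)) (sym d) ⟩
      pow g (toℕ i ℕ.+ (toℕ j ℕ.∸ toℕ i)) ≡⟨ cong (pow g) (ℕₚ.m+[n∸m]≡n (ℕₚ.<⇒≤ i<j)) ⟩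
      pow g (toℕ j) ≡⟨ sym eq ⟩
      pow g (toℕ i) ≡⟨ sym (idʳ _) ⟩
      pow g (toℕ i) · e ∎)

  opaque
    orderData : ∀ i j → ∃[ m ] pow (gen i · gen j) (suc m) ≡ e × m ℕ.< N × (∀ k → k ℕ.< m → pow (gen i · gen j) (suc k) ≢ e)
    orderData i j with torsion (gen i · gen j)
    ... | k , k<N , pk with least (λ k → pow (gen i · gen j) (suc k) ≟ e) k pk
    ... | m , pm , m≤k , h = m , pm , ℕₚ.≤-<-trans m≤k k<N , h

  ord-1 : Fin n → Fin n → ℕ
  ord-1 i j = proj₁ (orderData i j)

  -- m(i,j) - 2 for i ≠ j
  ee : Fin n → Fin n → ℕ
  ee i j = pred (ord-1 i j)

  pow-sym : ∀ i j k → pow (gen i · gen j) k ≡ e → pow (gen j · gen i) k ≡ e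
  pow-sym i j k h = cancelʳ (gen j) (trans (pow-swap (gen i) (gen j) k) (trans (cong (gen j ·_) h) (trans (idʳ _) (sym (idˡ _)))))

  ord-sym : ∀ i j → ord-1 i j ≡ ord-1 j i
  ord-sym i j = ℕₚ.≤-antisym (le i j) (le j i)
    where
    le : ∀ i j → ord-1 i j ℕ.≤ ord-1 j i
    le i j = ℕₚ.≮⇒≥ λ lt → proj₂ (proj₂ (proj₂ (orderData i j))) (ord-1 j i) lt (pow-sym j i (suc (ord-1 j i)) (proj₁ (proj₂ (orderData j i))))

  ee-sym : ∀ i j → ee i j ≡ ee j i
  ee-sym i j = cong pred (ord-sym i j)

  ord-spec : ∀ i j → pow (gen i · gen j) (suc (ord-1 i j)) ≡ e
  ord-spec i j = proj₁ (proj₂ (orderData i j))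

  ord-low : ∀ i j k → k ℕ.< ord-1 i j → pow (gen i · gen j) (suc k) ≢ e
  ord-low i j = proj₂ (proj₂ (proj₂ (orderData i j)))

  ord-pos : ∀ i j → i ≢ j → ord-1 i j ≡ suc (ee i j)
  ord-pos i j i≢j = go (ord-1 i j) (ord-spec i j)
    where
    go : ∀ k → pow (gen i · gen j) (suc k) ≡ e → k ≡ suc (pred k)
    go zero p = ⊥-elim (i≢j (gen-injective i j (cancelʳ (gen j) (trans (trans (sym (idʳ _)) p) (sym (gen-involution j))))))
    go (suc k) p = refl

  ord-diag : ∀ i → ord-1 i i ≡ 0
  ord-diag i = ℕₚ.n<1⇒n≡0 (ℕₚ.≰⇒> λ lt → ord-low i i 0 lt (trans (idʳ _) (gen-involution i)))

  ee-diag : ∀ i → ee i i ≡ 0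
  ee-diag i = cong pred (ord-diag i)

  ord-braid : ∀ i j → i ≢ j → pow (gen i · gen j) (2 ℕ.+ ee i j) ≡ e
  ord-braid i j i≢j = subst (λ t → pow (gen i · gen j) (suc t) ≡ e) (ord-pos i j i≢j) (ord-spec i j)

  ord-min : ∀ i j → i ≢ j → ∀ k → k ℕ.≤ ee i j → pow (gen i · gen j) (suc k) ≢ e
  ord-min i j i≢j k k≤ = ord-low i j k (subst (k ℕ.<_) (sym (ord-pos i j i≢j)) (s≤s k≤))

  sq⇒comm : ∀ i j → pow (gen i · gen j) 2 ≡ e → gen i · gen j ≡ gen j · gen i
  sq⇒comm i j h = cancelʳ (gen i · gen j) (begin
    (gen i · gen j) · (gen i · gen j) ≡⟨ cong ((gen i · gen j) ·_) (sym (idʳ _)) ⟩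
    pow (gen i · gen j) 2 ≡⟨ h ⟩
    e ≡⟨ sym (gen-involution j) ⟩
    gen j · gen j ≡⟨ cong (gen j ·_) (sym (gen-cancelˡ i (gen j))) ⟩
    gen j · (gen i · (gen i · gen j)) ≡⟨ sym (assoc _ _ _) ⟩
    (gen j · gen i) · (gen i · gen j) ∎)

  ee0⇒comm : ∀ i j → ee i j ≡ 0 → gen i · gen j ≡ gen j · gen i
  ee0⇒comm i j h with i ≟ j
  ... | yes refl = refl
  ... | no i≢j = sq⇒comm i j (subst (λ t → pow (gen i · gen j) (2 ℕ.+ t) ≡ e) h (ord-braid i j i≢j))

  comm⇒ee0 : ∀ i j → gen i · gen j ≡ gen j · gen i → ee i j ≡ 0
  comm⇒ee0 i j h with ee i j in eq
  ... | zero = refl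
  ... | suc m with i ≟ j
  ... | yes refl = ⊥-elim (ℕₚ.0≢1+n (trans (sym (ee-diag i)) eq))
  ... | no i≢j = ⊥-elim (ord-min i j i≢j 1 (subst (1 ℕ.≤_) (sym eq) (s≤s z≤n)) (begin
    (gen i · gen j) · ((gen i · gen j) · e) ≡⟨ cong ((gen i · gen j) ·_) (trans (idʳ _) h) ⟩
    (gen i · gen j) · (gen j · gen i) ≡⟨ assoc _ _ _ ⟩
    gen i · (gen j · (gen j · gen i)) ≡⟨ cong (gen i ·_) (gen-cancelˡ j _) ⟩
    gen i · gen i ≡⟨ gen-involution i ⟩
    e ∎))

  -- A multiple of every path length, so that truncating sequences there cuts no edge.
  cut : ℕ → ℕ
  cut c = suc c ℕ.* N !

  cut-ok : ∀ c i j → cut c % suc (ee i j) ≡ 0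
  cut-ok c i j = n∣m⇒m%n≡0 (cut c) (suc (ee i j)) (∣-trans (∣-trans (m∣m*n (ee i j !)) (m≤n⇒m!∣n! le)) (n∣m*n (suc c)))
    where
    le : suc (ee i j) ℕ.≤ N
    le = ℕₚ.≤-trans (s≤s ℕₚ.pred[n]≤n) (proj₁ (proj₂ (proj₂ (orderData i j))))

  cut-big : ∀ c → c ℕ.< cut c
  cut-big c = ℕₚ.≤-trans (ℕₚ.≤-reflexive (sym (ℕₚ.*-identityʳ (suc c)))) (ℕₚ.*-monoʳ-≤ (suc c) (1≤! N))
    where
    1≤! : ∀ k → 1 ℕ.≤ k !
    1≤! zero = s≤s z≤n
    1≤! (suc k) = ℕₚ.≤-trans (1≤! k) (ℕₚ.m≤m+n (k !) (k ℕ.* k !))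

  ∑ : ∀ {k} → (Fin k → ℤ) → ℤ
  ∑ {zero} f = 0ℤ
  ∑ {suc k} f = f F.zero + ∑ (λ i → f (F.suc i))

  ∑-cong : ∀ {k} {f g : Fin k → ℤ} → (∀ i → f i ≡ g i) → ∑ f ≡ ∑ g
  ∑-cong {zero} h = refl
  ∑-cong {suc k} h = cong₂ _+_ (h F.zero) (∑-cong (λ i → h (F.suc i)))

  ∑-+ : ∀ {k} (f g : Fin k → ℤ) → ∑ (λ i → f i + g i) ≡ ∑ f + ∑ g
  ∑-+ {zero} f g = refl
  ∑-+ {suc k} f g = trans (cong (λ t → (f F.zero + g F.zero) + t) (∑-+ (λ i → f (F.suc i)) (λ i → g (F.suc i))))
    (interchange (f F.zero) (g F.zero) (∑ (λ i → f (F.suc i))) (∑ (λ i → g (F.suc i))))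

  ∑-neg : ∀ {k} (f : Fin k → ℤ) → ∑ (λ i → - f i) ≡ - ∑ f
  ∑-neg {zero} f = refl
  ∑-neg {suc k} f = trans (cong (λ t → - f F.zero + t) (∑-neg (λ i → f (F.suc i)))) (sym (ℤₚ.neg-distrib-+ (f F.zero) _))

  ∑-0 : ∀ {k} (f : Fin k → ℤ) → (∀ i → f i ≡ 0ℤ) → ∑ f ≡ 0ℤ
  ∑-0 {zero} f h = refl
  ∑-0 {suc k} f h = cong₂ _+_ (h F.zero) (∑-0 _ (λ i → h (F.suc i)))

  ∑-single : ∀ {k} (f : Fin k → ℤ) j → (∀ i → i ≢ j → f i ≡ 0ℤ) → ∑ f ≡ f j
  ∑-single {suc k} f F.zero h = trans (cong (λ t → f F.zero + t) (∑-0 _ (λ i → h (F.suc i) (λ ())))) (ℤₚ.+-identityʳ _)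
  ∑-single {suc k} f (F.suc j) h = trans (cong₂ _+_ (h F.zero (λ ())) (∑-single _ j (λ i p → h (F.suc i) (p ∘ Fₚ.suc-injective)))) (ℤₚ.+-identityˡ _)

  ∑-NN : ∀ {k} (f : Fin k → ℤ) → (∀ i → 0ℤ ≤ f i) → 0ℤ ≤ ∑ f
  ∑-NN {zero} f h = ℤₚ.≤-refl
  ∑-NN {suc k} f h = +-NN (h F.zero) (∑-NN _ (λ i → h (F.suc i)))

  ∑-NN0 : ∀ {k} (f : Fin k → ℤ) → (∀ i → 0ℤ ≤ f i) → ∑ f ≡ 0ℤ → ∀ i → f i ≡ 0ℤ
  ∑-NN0 {suc k} f h eq F.zero = proj₁ (nn-sum0 (h F.zero) (∑-NN _ (λ i → h (F.suc i))) eq)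
  ∑-NN0 {suc k} f h eq (F.suc i) = ∑-NN0 _ (λ i → h (F.suc i)) (proj₂ (nn-sum0 (h F.zero) (∑-NN _ (λ i → h (F.suc i))) eq)) i

  ∑-swap : ∀ {k l} (f : Fin k → Fin l → ℤ) → ∑ (λ i → ∑ (f i)) ≡ ∑ (λ j → ∑ (λ i → f i j))
  ∑-swap {zero} {l} f = sym (∑-0 {l} (λ j → 0ℤ) (λ _ → refl))
  ∑-swap {suc k} f = trans (cong (λ t → ∑ (f F.zero) + t) (∑-swap (λ i → f (F.suc i)))) (sym (∑-+ (f F.zero) _))

  V : Set
  V = Fin n → M

  infix 4 _≈_
  _≈_ : V → V → Set
  x ≈ y = ∀ i k → x i k ≡ y i k

  infixl 6 _⊕_
  _⊕_ : V → V → V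
  (x ⊕ y) i k = x i k + y i k

  ⊖_ : V → V
  (⊖ x) i k = - x i k

  0V : V
  0V i k = 0ℤ

  ≈-refl : ∀ {x} → x ≈ x
  ≈-refl i k = refl

  ≈-sym : ∀ {x y} → x ≈ y → y ≈ x
  ≈-sym p i k = sym (p i k)

  ≈-trans : ∀ {x y z} → x ≈ y → y ≈ z → x ≈ z
  ≈-trans p q i k = trans (p i k) (q i k)

  upd : V → Fin n → M → V
  upd x i v j with i ≟ j
  ... | yes _ = v
  ... | no _ = x j

  upd-same : ∀ x i v → upd x i v i ≡ v
  upd-same x i v with i ≟ i
  ... | yes _ = refl
  ... | no p = ⊥-elim (p refl)

  upd-other : ∀ x {i} v {j} → i ≢ j → upd x i v j ≡ x j
  upd-other x {i} v {j} p with i ≟ j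
  ... | yes q = ⊥-elim (p q)
  ... | no _ = refl

  updCase : ∀ {i} (P : Fin n → Set) → P i → (∀ j → i ≢ j → P j) → ∀ j → P j
  updCase {i} P p q j with i ≟ j
  ... | yes refl = p
  ... | no r = q j r

  opaque
    α : Fin n → M → V
    α i m = upd 0V i m

    α-same : ∀ i m k → α i m i k ≡ m k
    α-same i m k = cong (λ t → t k) (upd-same 0V i m)

    α-other : ∀ i m {j} → i ≢ j → ∀ k → α i m j k ≡ 0ℤ
    α-other i m p k = cong (λ t → t k) (upd-other 0V m p)

  -- The sum may run over all `j`: truncated subtraction gives `ee i i ≡ 0`, and `A 0` is zero, so
  -- neither `i` itself nor a letter commuting with it contributes.
  Nb : Fin n → V → M
  Nb i x k = ∑ (λ j → A (ee i j) (x j) k)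

  Nb-cong : ∀ i {x y} → x ≈ y → ∀ k → Nb i x k ≡ Nb i y k
  Nb-cong i h k = ∑-cong (λ j → A-cong (ee i j) (h j) k)

  Nb-+ : ∀ i x y k → Nb i (x ⊕ y) k ≡ Nb i x k + Nb i y k
  Nb-+ i x y k = trans (∑-cong (λ j → A-+ (ee i j) (x j) (y j) k)) (∑-+ (λ j → A (ee i j) (x j) k) (λ j → A (ee i j) (y j) k))

  Nb-neg : ∀ i x k → Nb i (⊖ x) k ≡ - Nb i x k
  Nb-neg i x k = trans (∑-cong (λ j → A-neg (ee i j) (x j) k)) (∑-neg (λ j → A (ee i j) (x j) k))

  Nb-α : ∀ i j m k → Nb i (α j m) k ≡ A (ee i j) m k
  Nb-α i j m k = trans (∑-single (λ l → A (ee i l) (α j m l) k) j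
    (λ l p → trans (A-cong (ee i l) (α-other j m (p ∘ sym)) k) (A-0 (ee i l) k)))
    (A-cong (ee i j) (α-same j m) k)

  A-diag : ∀ i m k → A (ee i i) m k ≡ 0ℤ
  A-diag i m k = trans (cong (λ t → A t m k) (ee-diag i)) (A-triv m k)

  -- The pairing with the simple coroot `i`, with values in sequences; the off-diagonal Cartan
  -- entries are the operators `- A (ee i j)`.
  cv : Fin n → V → M
  cv i x k = + 2 * x i k - Nb i x k

  opaque
    r : Fin n → V → V
    r i x = upd x i (λ k → Nb i x k - x i k)

    r-other : ∀ i x {j} → i ≢ j → ∀ k → r i x j k ≡ x j k
    r-other i x p k = cong (λ t → t k) (upd-other x _ p)

    r-same : ∀ i x k → r i x i k ≡ Nb i x k - x i k
    r-same i x k = cong (λ t → t k) (upd-same x i _)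

  r-cv : ∀ i x → r i x ≈ x ⊕ α i (λ k → - cv i x k)
  r-cv i x = updCase (λ j → ∀ k → r i x j k ≡ (x ⊕ α i (λ k → - cv i x k)) j k)
    (λ k → trans (r-same i x k) (trans (l (Nb i x k) (x i k)) (cong (λ t → x i k + t) (sym (α-same i (λ k → - cv i x k) k)))))
    (λ j p k → trans (r-other i x p k) (trans (sym (ℤₚ.+-identityʳ _)) (cong (λ t → x j k + t) (sym (α-other i (λ k → - cv i x k) p k)))))
    where
    l : ∀ u v → u - v ≡ v + - (+ 2 * v - u)
    l = solve-∀

  cv-cong : ∀ i {x y} → x ≈ y → ∀ k → cv i x k ≡ cv i y k
  cv-cong i h k = cong₂ (λ u v → + 2 * u - v) (h i k) (Nb-cong i h k)

  cv-+ : ∀ i x y k → cv i (x ⊕ y) k ≡ cv i x k + cv i y k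
  cv-+ i x y k = trans (cong (λ t → + 2 * (x i k + y i k) - t) (Nb-+ i x y k)) (l (x i k) (y i k) (Nb i x k) (Nb i y k))
    where
    l : ∀ u v w z → + 2 * (u + v) - (w + z) ≡ (+ 2 * u - w) + (+ 2 * v - z)
    l = solve-∀

  cv-neg : ∀ i x k → cv i (⊖ x) k ≡ - cv i x k
  cv-neg i x k = trans (cong (λ t → + 2 * (- x i k) - t) (Nb-neg i x k)) (l (x i k) (Nb i x k))
    where
    l : ∀ u w → + 2 * (- u) - (- w) ≡ - (+ 2 * u - w)
    l = solve-∀

  cv-α-same : ∀ i m k → cv i (α i m) k ≡ + 2 * m k
  cv-α-same i m k = trans (cong₂ (λ u v → + 2 * u - v) (α-same i m k) (trans (Nb-α i i m k) (A-diag i m k))) (ℤₚ.+-identityʳ _)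

  cv-α-other : ∀ i j m → j ≢ i → ∀ k → cv i (α j m) k ≡ - A (ee i j) m k
  cv-α-other i j m p k = trans (cong₂ (λ u v → + 2 * u - v) (α-other j m p k) (Nb-α i j m k)) (ℤₚ.+-identityˡ _)

  ⊕-cong : ∀ {x x' y y'} → x ≈ x' → y ≈ y' → x ⊕ y ≈ x' ⊕ y'
  ⊕-cong p q i k = cong₂ _+_ (p i k) (q i k)

  ⊖-cong : ∀ {x y} → x ≈ y → ⊖ x ≈ ⊖ y
  ⊖-cong p i k = cong -_ (p i k)

  α-cong : ∀ i {m m'} → (∀ k → m k ≡ m' k) → α i m ≈ α i m'
  α-cong i {m} {m'} h = updCase (λ j → ∀ k → α i m j k ≡ α i m' j k)
    (λ k → trans (α-same i m k) (trans (h k) (sym (α-same i m' k))))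
    (λ j p k → trans (α-other i m p k) (sym (α-other i m' p k)))

  α-+ : ∀ i m m' → α i (λ k → m k + m' k) ≈ α i m ⊕ α i m'
  α-+ i m m' = updCase (λ j → ∀ k → α i (λ k → m k + m' k) j k ≡ (α i m ⊕ α i m') j k)
    (λ k → trans (α-same i (λ k → m k + m' k) k) (sym (cong₂ _+_ (α-same i m k) (α-same i m' k))))
    (λ j p k → trans (α-other i (λ k → m k + m' k) p k) (sym (cong₂ _+_ (α-other i m p k) (α-other i m' p k))))

  α-neg : ∀ i m → α i (λ k → - m k) ≈ ⊖ α i m
  α-neg i m = updCase (λ j → ∀ k → α i (λ k → - m k) j k ≡ (⊖ α i m) j k)
    (λ k → trans (α-same i (λ k → - m k) k) (sym (cong -_ (α-same i m k))))
    (λ j p k → trans (α-other i (λ k → - m k) p k) (sym (cong -_ (α-other i m p k))))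

  r-cong : ∀ i {x y} → x ≈ y → r i x ≈ r i y
  r-cong i {x} {y} h = ≈-trans (r-cv i x) (≈-trans (⊕-cong h (α-cong i (λ k → cong -_ (cv-cong i h k)))) (≈-sym (r-cv i y)))

  r-+ : ∀ i x y → r i (x ⊕ y) ≈ r i x ⊕ r i y
  r-+ i x y = ≈-trans (r-cv i (x ⊕ y)) (≈-trans mid (≈-sym (⊕-cong (r-cv i x) (r-cv i y))))
    where
    mid : (x ⊕ y) ⊕ α i (λ k → - cv i (x ⊕ y) k) ≈ (x ⊕ α i (λ k → - cv i x k)) ⊕ (y ⊕ α i (λ k → - cv i y k))
    mid j k = trans (cong (λ t → (x j k + y j k) + t)
        (trans (α-cong i (λ k → trans (cong -_ (cv-+ i x y k)) (ℤₚ.neg-distrib-+ (cv i x k) (cv i y k))) j k) (α-+ i (λ k → - cv i x k) (λ k → - cv i y k) j k)))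
      (interchange (x j k) (y j k) (α i (λ k → - cv i x k) j k) (α i (λ k → - cv i y k) j k))

  r-neg : ∀ i x → r i (⊖ x) ≈ ⊖ r i x
  r-neg i x = ≈-trans (r-cv i (⊖ x)) (≈-trans mid (≈-sym (⊖-cong (r-cv i x))))
    where
    mid : (⊖ x) ⊕ α i (λ k → - cv i (⊖ x) k) ≈ ⊖ (x ⊕ α i (λ k → - cv i x k))
    mid j k = trans (cong (λ t → - x j k + t)
        (trans (α-cong i (λ k → cong -_ (cv-neg i x k)) j k) (α-neg i (λ k → - cv i x k) j k)))
      (sym (ℤₚ.neg-distrib-+ (x j k) (α i (λ k → - cv i x k) j k)))

  cv-r-same : ∀ i x k → cv i (r i x) k ≡ - cv i x k
  cv-r-same i x k = trans (cv-cong i (r-cv i x) k) (trans (cv-+ i x _ k)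
    (trans (cong (λ t → cv i x k + t) (cv-α-same i (λ k → - cv i x k) k)) (l (cv i x k))))
    where
    l : ∀ u → u + + 2 * (- u) ≡ - u
    l = solve-∀

  cv-r-other : ∀ i j x → i ≢ j → ∀ k → cv j (r i x) k ≡ cv j x k + A (ee j i) (cv i x) k
  cv-r-other i j x p k = trans (cv-cong j (r-cv i x) k) (trans (cv-+ j x _ k)
    (cong (λ t → cv j x k + t) (trans (cv-α-other j i (λ k → - cv i x k) p k)
      (trans (cong -_ (A-neg (ee j i) (cv i x) k)) (ℤₚ.neg-involutive _)))))

  r-invol : ∀ i x → r i (r i x) ≈ x
  r-invol i x = ≈-trans (r-cv i (r i x)) λ j k → trans (cong₂ _+_ (r-cv i x j k)
      (trans (α-cong i (λ k → cong -_ (cv-r-same i x k)) j k) (α-neg i (λ k → - cv i x k) j k)))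
    (l (x j k) (α i (λ k → - cv i x k) j k))
    where
    l : ∀ u v → (u + v) + (- v) ≡ u
    l = solve-∀

  iter : (V → V) → ℕ → V → V
  iter f zero x = x
  iter f (suc k) x = f (iter f k x)

  dbl : ℕ → ℕ
  dbl zero = zero
  dbl (suc t) = suc (suc (dbl t))

  dbl-+ : ∀ t → dbl t ≡ t ℕ.+ (t ℕ.+ 0)
  dbl-+ zero = refl
  dbl-+ (suc t) = cong suc (trans (cong suc (dbl-+ t)) (sym (ℕₚ.+-suc t (t ℕ.+ 0))))

  module Dihedral (i j : Fin n) (i≢j : i ≢ j) (x : V) where
    private
      E = ee i j
      m = 2 ℕ.+ E
      f : V → V
      f y = r i (r j y)
      v = chain E (λ k → - cv i x k) (cv j x)
      y = iter f m x

    -- In the two coroot coordinates a single reflection is one step of `chain`, up to signs, so a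
    -- rotation makes two steps and the period 2m of `chain` is reached after m rotations.
    track : ∀ t → (∀ k → cv i (iter f t x) k ≡ - v (dbl t) k) × (∀ k → cv j (iter f t x) k ≡ v (suc (dbl t)) k)
    track zero = (λ k → sym (ℤₚ.neg-involutive _)) , λ k → refl
    track (suc t) = ci , cj
      where
      z = iter f t x
      a : ∀ k → cv i (r j z) k ≡ v (2 ℕ.+ dbl t) k
      a k = trans (cv-r-other j i z (i≢j ∘ sym) k) (trans (cong₂ _+_ (proj₁ (track t) k) (A-cong E (proj₂ (track t)) k))
        (ℤₚ.+-comm (- v (dbl t) k) (A E (v (suc (dbl t))) k)))
      ci : ∀ k → cv i (f z) k ≡ - v (2 ℕ.+ dbl t) k
      ci k = trans (cv-r-same i (r j z) k) (cong -_ (a k))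
      cj : ∀ k → cv j (f z) k ≡ v (3 ℕ.+ dbl t) k
      cj k = trans (cv-r-other i j (r j z) i≢j k) (trans (cong₂ _+_ (trans (cv-r-same j z k) (cong -_ (proj₂ (track t) k)))
          (trans (cong (λ t → A t (cv i (r j z)) k) (ee-sym j i)) (A-cong E a k)))
        (ℤₚ.+-comm (- v (suc (dbl t)) k) (A E (v (2 ℕ.+ dbl t)) k)))

    same-i : ∀ k → cv i y k ≡ cv i x k
    same-i k = trans (proj₁ (track m) k) (trans (cong -_ (trans (cong (λ t → v t k) (dbl-+ m)) (chain-periodic E _ _ 0 k))) (ℤₚ.neg-involutive _))

    same-j : ∀ k → cv j y k ≡ cv j x k
    same-j k = trans (proj₂ (track m) k) (trans (cong (λ t → v t k) eq) (chain-periodic E _ _ 1 k))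
      where
      eq : suc (dbl m) ≡ m ℕ.+ (m ℕ.+ 1)
      eq = trans (cong suc (dbl-+ m)) (trans (sym (ℕₚ.+-suc m (m ℕ.+ 0))) (cong (m ℕ.+_) (sym (ℕₚ.+-suc m 0))))

    off : ∀ t l → i ≢ l → j ≢ l → ∀ k → iter f t x l k ≡ x l k
    off zero l p q k = refl
    off (suc t) l p q k = trans (r-other i (r j (iter f t x)) p k) (trans (r-other j (iter f t x) q k) (off t l p q k))

    private
      Di Dj : M
      Di k = y i k - x i k
      Dj k = y j k - x j k

    diff : y ≈ x ⊕ (α i Di ⊕ α j Dj)
    diff = updCase (λ l → ∀ k → y l k ≡ (x ⊕ (α i Di ⊕ α j Dj)) l k)
      (λ k → trans (l1 (y i k) (x i k)) (cong (λ t → x i k + t) (sym (cong₂ _+_ (α-same i Di k) (α-other j Dj (i≢j ∘ sym) k)))))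
      (λ l p → updCase (λ l → i ≢ l → ∀ k → y l k ≡ (x ⊕ (α i Di ⊕ α j Dj)) l k)
        (λ p k → trans (l2 (y j k) (x j k)) (cong (λ t → x j k + t) (sym (cong₂ _+_ (α-other i Di i≢j k) (α-same j Dj k)))))
        (λ l q p k → trans (off m l p q k) (trans (sym (ℤₚ.+-identityʳ (x l k))) (cong (λ t → x l k + t) (sym (cong₂ _+_ (α-other i Di p k) (α-other j Dj q k)))))) l p)
      where
      l1 : ∀ u v → u ≡ v + ((u - v) + 0ℤ)
      l1 = solve-∀
      l2 : ∀ u v → u ≡ v + (0ℤ + (u - v))
      l2 = solve-∀

    private
      sub0 : ∀ u p q → u ≡ u + (p + q) → p ≡ - q
      sub0 u p q eq = trans (l1 u p q) (trans (cong (λ t → t - (u + q)) (sym eq)) (l2 u q))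
        where
        l1 : ∀ u p q → p ≡ (u + (p + q)) - (u + q)
        l1 = solve-∀
        l2 : ∀ u q → u - (u + q) ≡ - q
        l2 = solve-∀

    eqi : ∀ k → + 2 * Di k ≡ A E Dj k
    eqi k = trans (sub0 (cv i x k) (+ 2 * Di k) (- A E Dj k) (begin
      cv i x k ≡⟨ sym (same-i k) ⟩
      cv i y k ≡⟨ cv-cong i diff k ⟩
      cv i (x ⊕ (α i Di ⊕ α j Dj)) k ≡⟨ cv-+ i x _ k ⟩
      cv i x k + cv i (α i Di ⊕ α j Dj) k ≡⟨ cong (λ t → cv i x k + t) (trans (cv-+ i (α i Di) (α j Dj) k) (cong₂ _+_ (cv-α-same i Di k) (cv-α-other i j Dj (i≢j ∘ sym) k))) ⟩
      cv i x k + (+ 2 * Di k + - A E Dj k) ∎)) (ℤₚ.neg-involutive _)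

    eqj : ∀ k → + 2 * Dj k ≡ A E Di k
    eqj k = trans (sub0 (cv j x k) (+ 2 * Dj k) (- A E Di k) (begin
      cv j x k ≡⟨ sym (same-j k) ⟩
      cv j y k ≡⟨ cv-cong j diff k ⟩
      cv j (x ⊕ (α i Di ⊕ α j Dj)) k ≡⟨ cv-+ j x _ k ⟩
      cv j x k + cv j (α i Di ⊕ α j Dj) k ≡⟨ cong (λ t → cv j x k + t) (trans (cv-+ j (α i Di) (α j Dj) k) (cong₂ _+_ (trans (cv-α-other j i Di i≢j k) (cong (λ t → - A t Di k) (ee-sym j i))) (cv-α-same j Dj k))) ⟩
      cv j x k + (- A E Di k + + 2 * Dj k) ≡⟨ cong (λ t → cv j x k + t) (ℤₚ.+-comm (- A E Di k) (+ 2 * Dj k)) ⟩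
      cv j x k + (+ 2 * Dj k + - A E Di k) ∎)) (ℤₚ.neg-involutive _)

    -- The total displacement lives in the coordinates `i` and `j` and has zero coroot pairings, so
    -- it lies in the kernel of the dihedral Cartan matrix, which is trivial by `coupled0`.
    braid : iter f m x ≈ x
    braid l k = trans (diff l k) (trans (cong (λ t → x l k + t) (cong₂ _+_ (zero-α i Di (coupled0 E Di Dj eqi eqj) l k) (zero-α j Dj (coupled0 E Dj Di eqj eqi) l k))) (ℤₚ.+-identityʳ (x l k)))
      where
      zero-α : ∀ i m → (∀ k → m k ≡ 0ℤ) → ∀ l k → α i m l k ≡ 0ℤ
      zero-α i m h l k = trans (α-cong i h l k) (updCase (λ l → ∀ k → α i (λ _ → 0ℤ) l k ≡ 0ℤ) (α-same i (λ _ → 0ℤ)) (λ j p → α-other i (λ _ → 0ℤ) p) l k)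

  iter-+ : ∀ f a b x → iter f (a ℕ.+ b) x ≡ iter f a (iter f b x)
  iter-+ f zero b x = refl
  iter-+ f (suc a) b x = cong f (iter-+ f a b x)

  -- The presentation asks for every exponent that gives `e` in W, not only for the order. Positive
  -- exponents below m are excluded by minimality, and larger ones are reduced by subtracting m.
  rr-power : ∀ i j k → pow (gen i · gen j) k ≡ e → ∀ x → iter (λ y → r i (r j y)) k x ≈ x
  rr-power i j k h with i ≟ j
  ... | yes refl = go k
    where
    go : ∀ k x → iter (λ y → r i (r i y)) k x ≈ x
    go zero x = ≈-refl
    go (suc k) x = ≈-trans (r-invol i _) (go k x)
  ... | no i≢j = go k k ℕₚ.≤-refl h
    where
    m = 2 ℕ.+ ee i j
    f : V → V
    f y = r i (r j y)
    fc : ∀ {x y} → x ≈ y → f x ≈ f y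
    fc p = r-cong i (r-cong j p)
    go : ∀ b k → k ℕ.≤ b → pow (gen i · gen j) k ≡ e → ∀ x → iter f k x ≈ x
    go b zero _ h x = ≈-refl
    go (suc b) (suc k) k≤b h x with suc k ℕ.<? m
    ... | yes lt = ⊥-elim (ord-min i j i≢j k (ℕₚ.≤-pred (ℕₚ.≤-pred lt)) h)
    ... | no ¬lt = subst (λ t → iter f t x ≈ x) eq
        (subst (_≈ x) (sym (iter-+ f m k' x)) (≈-trans (Dihedral.braid i j i≢j (iter f k' x)) (go b k' (ℕₚ.≤-pred (ℕₚ.≤-trans k'<k k≤b)) h' x)))
      where
      m≤ : m ℕ.≤ suc k
      m≤ = ℕₚ.≮⇒≥ ¬lt
      k' = suc k ℕ.∸ m
      eq : m ℕ.+ k' ≡ suc k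
      eq = ℕₚ.m+[n∸m]≡n m≤
      k'<k : k' ℕ.< suc k
      k'<k = s≤s (ℕₚ.m∸n≤m k (suc (ee i j)))
      h' : pow (gen i · gen j) k' ≡ e
      h' = trans (sym (idˡ _)) (trans (cong (_· pow (gen i · gen j) k') (sym (ord-braid i j i≢j)))
        (trans (sym (pow-+ (gen i · gen j) m k')) (trans (cong (pow (gen i · gen j)) eq) h)))

  record Aut : Set where
    field
      to from   : V → V
      to-cong   : ∀ {x y} → x ≈ y → to x ≈ to y
      from-cong : ∀ {x y} → x ≈ y → from x ≈ from y
      to-from   : ∀ x → to (from x) ≈ x
      from-to   : ∀ x → from (to x) ≈ x
  open Aut

  autGroup : Group 0ℓ 0ℓ
  autGroup = record
    { Carrier = Aut
    ; _≈_ = λ f g → ∀ x → to f x ≈ to g x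
    ; _∙_ = λ f g → record
        { to = λ x → to f (to g x) ; from = λ x → from g (from f x)
        ; to-cong = λ p → to-cong f (to-cong g p) ; from-cong = λ p → from-cong g (from-cong f p)
        ; to-from = λ x → ≈-trans (to-cong f (to-from g (from f x))) (to-from f x)
        ; from-to = λ x → ≈-trans (from-cong g (from-to f (to g x))) (from-to g x) }
    ; ε = record { to = λ x → x ; from = λ x → x ; to-cong = λ p → p ; from-cong = λ p → p
                 ; to-from = λ x → ≈-refl ; from-to = λ x → ≈-refl }
    ; _⁻¹ = λ f → record { to = from f ; from = to f ; to-cong = from-cong f ; from-cong = to-cong f
                         ; to-from = from-to f ; from-to = to-from f }
    ; isGroup = record
      { isMonoid = record
        { isSemigroup = record
          { isMagma = record
            { isEquivalence = record { refl = λ x → ≈-refl ; sym = λ p x → ≈-sym (p x) ; trans = λ p q x → ≈-trans (p x) (q x) }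
            ; ∙-cong = λ {f} {f'} {g} {g'} p q x → ≈-trans (to-cong f (q x)) (p (to g' x)) }
          ; assoc = λ f g h x → ≈-refl }
        ; identity = (λ f x → ≈-refl) , (λ f x → ≈-refl) }
      ; inverse = (λ f x → from-to f x) , (λ f x → to-from f x)
      ; ⁻¹-cong = λ {f} {g} p x → ≈-trans (from-cong f (≈-trans (≈-sym (to-from g x)) (≈-sym (p (from g x))))) (from-to f (from g x)) } }

  rAut : Fin n → Aut
  rAut i = record { to = r i ; from = r i ; to-cong = r-cong i ; from-cong = r-cong i ; to-from = r-invol i ; from-to = r-invol i }

  private
    powAut : ∀ i j k x → to (powW (Group._∙_ autGroup) (Group.ε autGroup) (Group._∙_ autGroup (rAut i) (rAut j)) k) x ≡ iter (λ y → r i (r j y)) k x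
    powAut i j zero x = refl
    powAut i j (suc k) x = cong (λ t → r i (r j t)) (powAut i j k x)

    rep = presentation autGroup rAut (λ i j k h x → subst (_≈ x) (sym (powAut i j k x)) (rr-power i j k h x))

  opaque
    ρ : Fin N → V → V
    ρ w = to (proj₁ rep w)

    ρ-cong : ∀ w {x y} → x ≈ y → ρ w x ≈ ρ w y
    ρ-cong w = to-cong (proj₁ rep w)

    ρ-· : ∀ u v x → ρ (u · v) x ≈ ρ u (ρ v x)
    ρ-· u v x = proj₁ (proj₂ rep) u v x

    ρ-gen : ∀ i x → ρ (gen i) x ≈ r i x
    ρ-gen i x = proj₂ (proj₂ rep) i x

    ρ-e : ∀ x → ρ e x ≈ x
    ρ-e x = ≈-trans (≈-sym (from-to f (ρ e x))) (≈-trans (from-cong f (≈-trans (≈-sym (ρ-· e e x)) (subst (λ t → ρ t x ≈ ρ e x) (sym (idˡ e)) ≈-refl))) (from-to f x))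
      where
      f : Aut
      f = proj₁ rep e

  -- `ρ` comes from a universal property and has no formula, so its properties are transported along
  -- a word for `w`. Closure of `P` under pointwise equality is required because `ρ` is
  -- multiplicative only up to `≈`.
  ρ-word : ∀ (P : (V → V) → Set) → (∀ {f g} → (∀ x → f x ≈ g x) → P f → P g) → P (λ x → x) → (∀ i w → P (ρ w) → P (λ x → r i (ρ w x))) → ∀ w → P (ρ w)
  ρ-word P resp p0 ps w with generates w
  ... | ws , refl = go ws
    where
    go : ∀ ws → P (ρ (prodW ws))
    go [] = resp (λ x → ≈-sym (ρ-e x)) p0
    go (i ∷ ws) = resp (λ x → ≈-trans (≈-sym (ρ-gen i (ρ (prodW ws) x))) (≈-sym (ρ-· (gen i) (prodW ws) x))) (ps i (prodW ws) (go ws))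

  ρ-⊕ : ∀ w x y → ρ w (x ⊕ y) ≈ ρ w x ⊕ ρ w y
  ρ-⊕ = ρ-word (λ f → ∀ x y → f (x ⊕ y) ≈ f x ⊕ f y)
    (λ h p x y → ≈-trans (≈-sym (h (x ⊕ y))) (≈-trans (p x y) (⊕-cong (h x) (h y))))
    (λ x y → ≈-refl) (λ i w p x y → ≈-trans (r-cong i (p x y)) (r-+ i (ρ w x) (ρ w y)))

  ρ-⊖ : ∀ w x → ρ w (⊖ x) ≈ ⊖ ρ w x
  ρ-⊖ = ρ-word (λ f → ∀ x → f (⊖ x) ≈ ⊖ f x)
    (λ h p x → ≈-trans (≈-sym (h (⊖ x))) (≈-trans (p x) (⊖-cong (h x))))
    (λ x → ≈-refl) (λ i w p x → ≈-trans (r-cong i (p x)) (r-neg i (ρ w x)))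

  ρ-inv : ∀ w x → ρ (inv w) (ρ w x) ≈ x
  ρ-inv w x = ≈-trans (≈-sym (ρ-· (inv w) w x)) (subst (λ t → ρ t x ≈ x) (sym (invˡ w)) (ρ-e x))

-- Length, signs of roots, faithfulness and the exchange condition.

module Positivity (C : CoxeterSystem) where

  open Representation C

  prod-++ : ∀ xs ys → prodW (xs ++ ys) ≡ prodW xs · prodW ys
  prod-++ [] ys = sym (idˡ _)
  prod-++ (x ∷ xs) ys = trans (cong (gen x ·_) (prod-++ xs ys)) (sym (assoc _ _ _))

  Reach : ℕ → Fin N → Set
  Reach k w = ∃[ ws ] length ws ≡ k × prodW ws ≡ w

  reach? : ∀ k w → Dec (Reach k w)
  reach? zero w with w ≟ e
  ... | yes p = yes ([] , refl , sym p)
  ... | no ¬p = no λ { ([] , refl , q) → ¬p (sym q) }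
  reach? (suc k) w with any? (λ i → reach? k (gen i · w))
  ... | yes (i , ws , l , p) = yes (i ∷ ws , cong suc l , trans (cong (gen i ·_) p) (gen-cancelˡ i w))
  ... | no ¬p = no λ { (i ∷ ws , l , q) → ¬p (i , ws , ℕₚ.suc-injective l , trans (sym (gen-cancelˡ i _)) (cong (gen i ·_) q)) }

  opaque
    lenData : ∀ w → ∃[ k ] Reach k w × k ℕ.≤ length (proj₁ (generates w)) × (∀ j → j ℕ.< k → ¬ Reach j w)
    lenData w = least (λ k → reach? k w) (length (proj₁ (generates w))) (proj₁ (generates w) , refl , proj₂ (generates w))

    len : Fin N → ℕ
    len w = proj₁ (lenData w)

    len-word : ∀ w → ∃[ ws ] length ws ≡ len w × prodW ws ≡ w
    len-word w = proj₁ (proj₂ (lenData w))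

    len-min : ∀ ws → len (prodW ws) ℕ.≤ length ws
    len-min ws = ℕₚ.≮⇒≥ λ lt → proj₂ (proj₂ (proj₂ (lenData (prodW ws)))) (length ws) lt (ws , refl , refl)

  len-e : len e ≡ 0
  len-e = ℕₚ.n≤0⇒n≡0 (len-min [])

  len-·≤ : ∀ u v → len (u · v) ℕ.≤ len u ℕ.+ len v
  len-·≤ u v with len-word u | len-word v
  ... | us , lu , refl | vs , lv , refl = ℕₚ.≤-trans (subst (λ t → len t ℕ.≤ length (us ++ vs)) (prod-++ us vs) (len-min (us ++ vs)))
    (ℕₚ.≤-reflexive (trans (Lₚ.length-++ us) (cong₂ ℕ._+_ lu lv)))

  len-gen≤ : ∀ i → len (gen i) ℕ.≤ 1
  len-gen≤ i = subst (λ t → len t ℕ.≤ 1) (idʳ (gen i)) (len-min (i ∷ []))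

  len-sˡ : ∀ i w → len (gen i · w) ℕ.≤ suc (len w)
  len-sˡ i w = ℕₚ.≤-trans (len-·≤ (gen i) w) (ℕₚ.+-monoˡ-≤ (len w) (len-gen≤ i))

  len-sʳ : ∀ i w → len (w · gen i) ℕ.≤ suc (len w)
  len-sʳ i w = ℕₚ.≤-trans (len-·≤ w (gen i)) (ℕₚ.≤-trans (ℕₚ.+-monoʳ-≤ (len w) (len-gen≤ i)) (ℕₚ.≤-reflexive (ℕₚ.+-comm (len w) 1)))

  inv-unique : ∀ x y → x · y ≡ e → y ≡ inv x
  inv-unique x y p = cancelˡ x (trans p (sym (invʳ x)))

  inv-· : ∀ x y → inv (x · y) ≡ inv y · inv x
  inv-· x y = sym (inv-unique (x · y) (inv y · inv x) (begin
    (x · y) · (inv y · inv x) ≡⟨ assoc _ _ _ ⟩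
    x · (y · (inv y · inv x)) ≡⟨ cong (x ·_) (sym (assoc _ _ _)) ⟩
    x · ((y · inv y) · inv x) ≡⟨ cong (λ t → x · (t · inv x)) (invʳ y) ⟩
    x · (e · inv x) ≡⟨ cong (x ·_) (idˡ _) ⟩
    x · inv x ≡⟨ invʳ x ⟩
    e ∎))

  inv-gen : ∀ i → inv (gen i) ≡ gen i
  inv-gen i = sym (inv-unique (gen i) (gen i) (gen-involution i))

  inv-e : inv e ≡ e
  inv-e = sym (inv-unique e e (idˡ e))

  inv-inv : ∀ x → inv (inv x) ≡ x
  inv-inv x = sym (inv-unique (inv x) x (invˡ x))

  len-inv≤ : ∀ w → len (inv w) ℕ.≤ len w
  len-inv≤ w with len-word w
  ... | ws , l , refl = ℕₚ.≤-trans (go ws) (ℕₚ.≤-reflexive l)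
    where
    go : ∀ ws → len (inv (prodW ws)) ℕ.≤ length ws
    go [] = subst (λ t → len t ℕ.≤ 0) (sym inv-e) (ℕₚ.≤-reflexive len-e)
    go (i ∷ ws) = subst (λ t → len t ℕ.≤ suc (length ws)) (sym (trans (inv-· (gen i) (prodW ws)) (cong (inv (prodW ws) ·_) (inv-gen i))))
      (ℕₚ.≤-trans (len-sʳ i (inv (prodW ws))) (s≤s (go ws)))

  len-inv : ∀ w → len (inv w) ≡ len w
  len-inv w = ℕₚ.≤-antisym (len-inv≤ w) (subst (λ t → len t ℕ.≤ len (inv w)) (inv-inv w) (len-inv≤ (inv w)))

  private
    xorGroup : Group _ _
    xorGroup = CommutativeRing.+-group Bₚ.xor-∧-commutativeRing

    pow-ff : ∀ k → powW _xor_ false (true xor true) k ≡ false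
    pow-ff zero = refl
    pow-ff (suc k) = pow-ff k

    χdata = presentation xorGroup (λ _ → true) (λ i j k _ → pow-ff k)

    χ : Fin N → Bool
    χ = proj₁ χdata

    χ-e : χ e ≡ false
    χ-e = go (χ e) (trans (cong χ (sym (idˡ e))) (proj₁ (proj₂ χdata) e e))
      where
      go : ∀ b → b ≡ b xor b → b ≡ false
      go false _ = refl
      go true ()

    par : ℕ → Bool
    par zero = false
    par (suc k) = not (par k)

    χ-word : ∀ ws → χ (prodW ws) ≡ par (length ws)
    χ-word [] = χ-e
    χ-word (i ∷ ws) = trans (proj₁ (proj₂ χdata) (gen i) (prodW ws)) (cong₂ _xor_ (proj₂ (proj₂ χdata) i) (χ-word ws))

    χ-len : ∀ w → χ w ≡ par (len w)
    χ-len w with len-word w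
    ... | ws , l , refl = trans (χ-word ws) (cong par l)

    b≢notb : ∀ b → b ≢ b xor true
    b≢notb false ()
    b≢notb true ()

  -- The sign character, obtained from the presentation with values in the two-element group,
  -- records the parity of the length.
  len-≢ : ∀ w i → len (w · gen i) ≢ len w
  len-≢ w i h = b≢notb (χ w) (trans (χ-len w) (trans (cong par (sym h)) (trans (sym (χ-len (w · gen i)))
    (trans (proj₁ (proj₂ χdata) w (gen i)) (cong (χ w xor_) (proj₂ (proj₂ χdata) i))))))

  -- (w , i) stands for the root w(αᵢ); Neg w i says that it is negative.
  Neg : Fin N → Fin n → Set
  Neg w i = len (w · gen i) ℕ.< len w

  Neg? : ∀ w i → Dec (Neg w i)
  Neg? w i = len (w · gen i) ℕ.<? len w

  Neg-len : ∀ w i → Neg w i → len w ≡ suc (len (w · gen i))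
  Neg-len w i h = ℕₚ.≤-antisym (subst (λ t → len t ℕ.≤ suc (len (w · gen i))) (gen-cancelʳ i w) (len-sʳ i (w · gen i))) h

  Pos-len : ∀ w i → ¬ Neg w i → len (w · gen i) ≡ suc (len w)
  Pos-len w i h = ℕₚ.≤-antisym (len-sʳ i w) (ℕₚ.≤∧≢⇒< (ℕₚ.≮⇒≥ h) (len-≢ w i ∘ sym))

  Neg-flip : ∀ w i → Neg w i → ¬ Neg (w · gen i) i
  Neg-flip w i h h' = ℕₚ.<-asym h (subst (λ t → len t ℕ.< len (w · gen i)) (gen-cancelʳ i w) h')

  Pos-flip : ∀ w i → ¬ Neg w i → Neg (w · gen i) i
  Pos-flip w i h = ℕₚ.≤-reflexive (trans (cong (λ t → suc (len t)) (gen-cancelʳ i w)) (sym (Pos-len w i h)))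

  exists-Neg : ∀ w → w ≢ e → ∃[ i ] Neg w i
  exists-Neg w w≢e with len-word (inv w)
  ... | [] , _ , p = ⊥-elim (w≢e (trans (sym (inv-inv w)) (trans (cong inv (sym p)) inv-e)))
  ... | i ∷ ws , l , p = i , (subst₂ ℕ._<_ (trans (cong len eq) (len-inv _)) (trans (sym (cong len refl)) (len-inv w)) lt)
    where
    eq : prodW ws ≡ inv (w · gen i)
    eq = trans (sym (gen-cancelˡ i (prodW ws))) (trans (cong (gen i ·_) p) (sym (trans (inv-· w (gen i)) (cong (_· inv w) (inv-gen i)))))
    lt : len (prodW ws) ℕ.< len (inv w)
    lt = ℕₚ.≤-trans (s≤s (len-min ws)) (ℕₚ.≤-reflexive l)

  alt : Fin n → Fin n → ℕ → Fin n
  alt s t zero = s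
  alt s t (suc k) = alt t s k

  altS altE : Fin n → Fin n → ℕ → Fin N
  altS s t zero = e
  altS s t (suc k) = gen s · altS t s k
  altE s t zero = e
  altE s t (suc k) = altE t s k · gen s

  altS-snoc : ∀ a b k → altS a b (suc k) ≡ altS a b k · gen (alt a b k)
  altS-snoc a b zero = trans (idʳ _) (sym (idˡ _))
  altS-snoc a b (suc k) = trans (cong (gen a ·_) (altS-snoc b a k)) (sym (assoc _ _ _))

  alt-alt : ∀ t s k → alt (alt t s k) (alt s t k) k ≡ t
  alt-alt t s zero = refl
  alt-alt t s (suc k) = alt-alt t s k

  altE-S : ∀ t s k → altE t s k ≡ altS (alt s t k) (alt t s k) k
  altE-S t s zero = refl
  altE-S t s (suc k) = trans (cong (_· gen t) (altE-S s t k))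
    (sym (trans (altS-snoc (alt t s k) (alt s t k) k) (cong (λ u → altS (alt t s k) (alt s t k) k · gen u) (alt-alt t s k))))

  altE-cons : ∀ t s k → altE t s (suc k) ≡ gen (alt s t (suc k)) · altE t s k
  altE-cons t s k = trans (altE-S t s (suc k)) (cong (gen (alt t s k) ·_) (sym (altE-S t s k)))

  altS-+ : ∀ s t a b → altS s t (a ℕ.+ b) ≡ altS s t a · altS (alt s t a) (alt t s a) b
  altS-+ s t zero b = sym (idˡ _)
  altS-+ s t (suc a) b = trans (cong (gen s ·_) (altS-+ t s a b)) (sym (assoc _ _ _))

  altS-dbl : ∀ s t k → altS s t (dbl k) ≡ pow (gen s · gen t) k
  altS-dbl s t zero = refl
  altS-dbl s t (suc k) = trans (sym (assoc _ _ _)) (cong ((gen s · gen t) ·_) (altS-dbl s t k))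

  altSE : ∀ s t k → altE s t k · altS s t k ≡ e
  altSE s t zero = idˡ e
  altSE s t (suc k) = trans (assoc _ _ _) (trans (cong (altE t s k ·_) (gen-cancelˡ s _)) (altSE t s k))

  alt-braid : ∀ s t m → pow (gen s · gen t) m ≡ e → altE t s m ≡ altE s t m
  alt-braid s t m h = cancelʳ (altS s t m) (trans inv1 (sym (altSE s t m)))
    where
    full : altS s t m · altE t s m ≡ e
    full = begin
      altS s t m · altE t s m ≡⟨ cong (altS s t m ·_) (altE-S t s m) ⟩
      altS s t m · altS (alt s t m) (alt t s m) m ≡⟨ sym (altS-+ s t m m) ⟩
      altS s t (m ℕ.+ m) ≡⟨ cong (altS s t) (trans (cong (m ℕ.+_) (sym (ℕₚ.+-identityʳ m))) (sym (dbl-+ m))) ⟩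
      altS s t (dbl m) ≡⟨ altS-dbl s t m ⟩
      pow (gen s · gen t) m ≡⟨ h ⟩
      e ∎
    inv1 : altE t s m · altS s t m ≡ e
    inv1 = trans (cong (_· altS s t m) (inv-unique (altS s t m) (altE t s m) full)) (invˡ _)

  len-altE : ∀ g s t k → len (g · altE s t k) ℕ.≤ len g ℕ.+ k
  len-altE g s t zero = ℕₚ.≤-reflexive (trans (cong len (idʳ g)) (sym (ℕₚ.+-identityʳ _)))
  len-altE g s t (suc k) = ℕₚ.≤-trans (subst (λ u → len u ℕ.≤ suc (len (g · altE t s k))) (assoc g (altE t s k) (gen s)) (len-sʳ s (g · altE t s k)))
    (ℕₚ.≤-trans (s≤s (len-altE g t s k)) (ℕₚ.≤-reflexive (sym (ℕₚ.+-suc (len g) k))))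

  NNV : V → Set
  NNV v = ∀ i k → 0ℤ ≤ v i k

  NNV-≈ : ∀ {x y} → x ≈ y → NNV x → NNV y
  NNV-≈ p h i k = subst (0ℤ ≤_) (p i k) (h i k)

  α-NN : ∀ i {m} → NN m → NNV (α i m)
  α-NN i {m} h = updCase (λ j → ∀ k → 0ℤ ≤ α i m j k) (λ k → subst (0ℤ ≤_) (sym (α-same i m k)) (h k)) (λ j p k → ℤₚ.≤-reflexive (sym (α-other i m p k)))

  α-0 : ∀ i → α i (λ _ → 0ℤ) ≈ 0V
  α-0 i = updCase (λ j → ∀ k → α i (λ _ → 0ℤ) j k ≡ 0ℤ) (α-same i _) (λ j p → α-other i _ p)

  r-α-same : ∀ i m → r i (α i m) ≈ ⊖ α i m
  r-α-same i m = ≈-trans (r-cv i (α i m)) λ j k → trans (cong (λ t → α i m j k + t) (trans (α-cong i (λ k → cong -_ (cv-α-same i m k)) j k)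
      (trans (α-neg i (λ k → + 2 * m k) j k) (cong -_ (trans (α-cong i (λ k → l2 (m k)) j k) (α-+ i m m j k))))))
    (l (α i m j k))
    where
    l : ∀ u → u + - (u + u) ≡ - u
    l = solve-∀
    l2 : ∀ u → + 2 * u ≡ u + u
    l2 = solve-∀

  r-α-other : ∀ i j m → j ≢ i → r i (α j m) ≈ α j m ⊕ α i (A (ee i j) m)
  r-α-other i j m p = ≈-trans (r-cv i (α j m)) (⊕-cong {α j m} ≈-refl (α-cong i (λ k → trans (cong -_ (cv-α-other i j m p k)) (ℤₚ.neg-involutive _))))

  ρ-last : ∀ w i x → ρ (w · gen i) x ≈ ρ w (r i x)
  ρ-last w i x = ≈-trans (ρ-· w (gen i) x) (ρ-cong w (ρ-gen i x))

  ρ-first : ∀ i w x → ρ (gen i · w) x ≈ r i (ρ w x)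
  ρ-first i w x = ≈-trans (ρ-· (gen i) w x) (ρ-gen i _)

  private
    alt-other : ∀ s t k → s ≢ t → alt s t (suc k) ≢ alt s t k
    alt-other s t zero p = p ∘ sym
    alt-other s t (suc k) p = alt-other t s k (p ∘ sym)

    ee-alt : ∀ s t k → ee (alt s t (suc k)) (alt s t k) ≡ ee s t
    ee-alt s t zero = ee-sym t s
    ee-alt s t (suc k) = trans (ee-alt t s k) (ee-sym t s)

    step-αα : ∀ x y a c → x ≢ y → r y (α x a ⊕ α y c) ≈ α y (λ k → A (ee y x) a k - c k) ⊕ α x a
    step-αα x y a c p = ≈-trans (r-+ y (α x a) (α y c)) (≈-trans (⊕-cong (r-α-other y x a p) (r-α-same y c))
      λ j k → trans (l (α x a j k) (α y (A (ee y x) a) j k) (α y c j k))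
        (cong (λ t → t + α x a j k) (sym (trans (α-+ y (A (ee y x) a) (λ k → - c k) j k) (cong (λ t → α y (A (ee y x) a) j k + t) (α-neg y c j k))))))
      where
      l : ∀ u v w → (u + v) + (- w) ≡ (v + - w) + u
      l = solve-∀

  -- Starting with a descent `t`, alternating letters `t`, `s`, `t`, ... are stripped from the right
  -- as long as the length drops. The remaining `g` is shorter than `w` and has neither letter as a
  -- descent, and `w α_s` is the image under `g` of a combination of α_s and α_t with Chebyshev
  -- coefficients, nonnegative by `cheb-NN`.
  pos-vec : ∀ w s → ¬ Neg w s → ∀ {m} → NN m → NNV (ρ w (α s m))
  pos-vec w s = go (len w) w ℕₚ.≤-refl s
    where
    go : ∀ b w → len w ℕ.≤ b → ∀ s → ¬ Neg w s → ∀ {m} → NN m → NNV (ρ w (α s m))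
    go b w w≤b s ¬neg {m} hm with w ≟ e
    ... | yes refl = NNV-≈ (≈-sym (ρ-e (α s m))) (α-NN s hm)
    go b w w≤b s ¬neg {m} hm | no w≢e with exists-Neg w w≢e
    go zero w w≤b s ¬neg {m} hm | no w≢e | t , tneg = ⊥-elim (ℕₚ.n≮0 (ℕₚ.≤-trans tneg w≤b))
    go (suc b) w w≤b s ¬neg {m} hm | no w≢e | t , tneg =
      strip E 0 w (ℕₚ.+-identityʳ (suc E)) (ℕₚ.+-identityʳ (len w)) (sym (idʳ w)) base tneg
      where
      s≢t : s ≢ t
      s≢t refl = ¬neg tneg
      E = ee s t
      f = cheb E m
      x : ℕ → Fin n
      x = alt s t
      base : ρ w (α s m) ≈ ρ w (α s m ⊕ α t (λ _ → 0ℤ))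
      base = ρ-cong w (λ j k → sym (trans (cong (λ u → α s m j k + u) (α-0 t j k)) (ℤₚ.+-identityʳ _)))
      finish : ∀ k g → suc k ℕ.≤ suc E → len g ℕ.+ suc k ≡ len w →
        ρ w (α s m) ≈ ρ g (α (x (suc k)) (f (suc (suc k))) ⊕ α (x (suc (suc k))) (f (suc k))) →
        ¬ Neg g (x (suc k)) → ¬ Neg g (x (suc (suc k))) → NNV (ρ w (α s m))
      finish k g kE lg eq n1 n2 = NNV-≈ (≈-sym (≈-trans eq (ρ-⊕ g _ _))) λ j l → +-NN
          (go b g g≤b (x (suc k)) n1 (cheb-NN E m hm (suc (suc k)) (s≤s kE)) j l)
          (go b g g≤b (x (suc (suc k))) n2 (cheb-NN E m hm (suc k) (ℕₚ.≤-trans kE (ℕₚ.n≤1+n _))) j l)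
        where
        g≤b : len g ℕ.≤ b
        g≤b = ℕₚ.≤-pred (ℕₚ.≤-trans (ℕₚ.≤-trans (s≤s (ℕₚ.m≤m+n (len g) k)) (ℕₚ.≤-reflexive (trans (sym (ℕₚ.+-suc (len g) k)) lg))) w≤b)
      strip : ∀ d k g → suc d ℕ.+ k ≡ suc E → len g ℕ.+ k ≡ len w → w ≡ g · altE t s k →
        ρ w (α s m) ≈ ρ g (α (x k) (f (suc k)) ⊕ α (x (suc k)) (f k)) → Neg g (x (suc k)) → NNV (ρ w (α s m))
      strip d k g dk lg wg eq ng = proceed (Neg? g' (x (suc (suc k))))
        where
        y = x (suc k)
        g' = g · gen y
        lg' : len g' ℕ.+ suc k ≡ len w
        lg' = trans (ℕₚ.+-suc (len g') k) (trans (cong (ℕ._+ k) (sym (Neg-len g y ng))) lg)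
        wg' : w ≡ g' · altE t s (suc k)
        wg' = trans wg (sym (trans (cong (g' ·_) (altE-cons t s k)) (trans (sym (assoc _ _ _)) (cong (_· altE t s k) (gen-cancelʳ y g)))))
        eq' : ρ w (α s m) ≈ ρ g' (α (x (suc k)) (f (suc (suc k))) ⊕ α (x (suc (suc k))) (f (suc k)))
        eq' = ≈-trans eq (≈-trans (subst (λ u → ρ g z ≈ ρ u z) (sym (gen-cancelʳ y g)) ≈-refl)
          (≈-trans (ρ-last g' y z) (ρ-cong g' (≈-trans (step-αα (x k) y (f (suc k)) (f k) (alt-other s t k s≢t ∘ sym))
            (⊕-cong (α-cong y (λ l → cong (λ u → A u (f (suc k)) l - f k l) (ee-alt s t k))) (≈-refl {α (x k) (f (suc k))}))))))
          where
          z = α (x k) (f (suc k)) ⊕ α (x (suc k)) (f k)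
        proceed : Dec (Neg g' (x (suc (suc k)))) → NNV (ρ w (α s m))
        proceed (no ¬p) = finish k g' (ℕₚ.≤-trans (ℕₚ.m≤n+m (suc k) d) (ℕₚ.≤-reflexive (trans (ℕₚ.+-suc d k) dk))) lg' eq' (Neg-flip g y ng) ¬p
        proceed (yes p) = deeper d dk
          where
          deeper : ∀ d → suc d ℕ.+ k ≡ suc E → NNV (ρ w (α s m))
          deeper (suc d) dk = strip d (suc k) g' (trans (ℕₚ.+-suc (suc d) k) dk) lg' wg' eq' p
          -- All m letters have been stripped. By the braid relation the alternating factor can be
          -- rewritten to end in `s`, which would make `s` a descent of `w`.
          deeper zero dk = ⊥-elim (¬neg (ℕₚ.≤-trans (s≤s short) (ℕₚ.≤-reflexive tot)))
            where
            z' = x (suc (suc k))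
            g'' = g' · gen z'
            k≡E : k ≡ E
            k≡E = ℕₚ.suc-injective dk
            wg'' : w ≡ g'' · altE t s (suc (suc k))
            wg'' = trans wg' (sym (trans (cong (g'' ·_) (altE-cons t s (suc k))) (trans (sym (assoc _ _ _)) (cong (_· altE t s (suc k)) (gen-cancelʳ z' g')))))
            wbr : w · gen s ≡ g'' · altE t s (suc k)
            wbr = begin
              w · gen s ≡⟨ cong (_· gen s) (trans wg'' (cong (g'' ·_) (alt-braid s t (2 ℕ.+ k) (subst (λ u → pow (gen s · gen t) (2 ℕ.+ u) ≡ e) (sym k≡E) (ord-braid s t s≢t))))) ⟩
              (g'' · (altE t s (suc k) · gen s)) · gen s ≡⟨ cong (_· gen s) (sym (assoc _ _ _)) ⟩
              ((g'' · altE t s (suc k)) · gen s) · gen s ≡⟨ gen-cancelʳ s _ ⟩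
              g'' · altE t s (suc k) ∎
            short : len (w · gen s) ℕ.≤ len g'' ℕ.+ suc k
            short = subst (λ u → len u ℕ.≤ len g'' ℕ.+ suc k) (sym wbr) (len-altE g'' t s (suc k))
            tot : suc (len g'' ℕ.+ suc k) ≡ len w
            tot = trans (cong (ℕ._+ suc k) (sym (Neg-len g' z' p))) lg'

  neg-vec : ∀ w s → Neg w s → ∀ {m} → NN m → NNV (⊖ ρ w (α s m))
  neg-vec w s h {m} hm = NNV-≈ (≈-trans (ρ-last w s (α s m)) (≈-trans (ρ-cong w (r-α-same s m)) (ρ-⊖ w (α s m)))) (pos-vec (w · gen s) s (Neg-flip w s h) hm)

  𝟙 : M
  𝟙 _ = 1ℤ

  𝟙-NN : NN 𝟙
  𝟙-NN _ = ℤ.+≤+ z≤n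

  ρ-inj0 : ∀ w x → ρ w x ≈ 0V → x ≈ 0V
  ρ-inj0 w x h = ≈-trans (≈-sym (ρ-inv w x)) (≈-trans (ρ-cong (inv w) h) z)
    where
    z : ρ (inv w) 0V ≈ 0V
    z i k = half (ρ (inv w) 0V i k) (trans (sym (ρ-⊕ (inv w) 0V 0V i k)) refl)
      where
      half : ∀ u → u + u ≡ u → u ≡ 0ℤ
      half u p = trans (l u) (trans (cong (λ t → t - u) p) (ℤₚ.+-inverseʳ u))
        where
        l : ∀ u → u ≡ (u + u) - u
        l = solve-∀

  nn-antisym : ∀ {u} → 0ℤ ≤ u → 0ℤ ≤ - u → u ≡ 0ℤ
  nn-antisym {u} p q = proj₁ (nn-sum0 p q (ℤₚ.+-inverseʳ u))

  root-nz : ∀ w s → ¬ (ρ w (α s 𝟙) ≈ 0V)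
  root-nz w s h with trans (sym (α-same s 𝟙 0)) (ρ-inj0 w (α s 𝟙) h s 0)
  ... | ()

  sign-pos : ∀ w s → NNV (ρ w (α s 𝟙)) → ¬ Neg w s
  sign-pos w s h ng = root-nz w s (λ i k → nn-antisym (h i k) (neg-vec w s ng 𝟙-NN i k))

  sign-neg : ∀ w s → NNV (⊖ ρ w (α s 𝟙)) → Neg w s
  sign-neg w s h with Neg? w s
  ... | yes p = p
  ... | no ¬p = ⊥-elim (root-nz w s (λ i k → nn-antisym (pos-vec w s ¬p 𝟙-NN i k) (h i k)))

  faithful : ∀ w → (∀ x → ρ w x ≈ x) → w ≡ e
  faithful w h with w ≟ e
  ... | yes p = p
  ... | no ¬p with exists-Neg w ¬p
  ... | s , ng = ⊥-elim (sign-pos w s (NNV-≈ (≈-sym (h (α s 𝟙))) (α-NN s 𝟙-NN)) ng)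

  -- The invariant symmetric form, truncated at cut c
  module Form (c : ℕ) where
    K = cut c

    ⟨_,_⟩ : M → M → ℤ
    ⟨ x , y ⟩ = ⟪ K ⟫ x y

    B : V → V → ℤ
    B x y = ∑ (λ i → ⟨ x i , cv i y ⟩)

    B-cong : ∀ {x x' y y'} → x ≈ x' → y ≈ y' → B x y ≡ B x' y'
    B-cong p q = ∑-cong (λ i → pair-cong K (p i) (cv-cong i q))

    B-+ˡ : ∀ x y z → B (x ⊕ y) z ≡ B x z + B y z
    B-+ˡ x y z = trans (∑-cong (λ i → pair-+ˡ K (x i) (y i) (cv i z))) (∑-+ (λ i → ⟨ x i , cv i z ⟩) (λ i → ⟨ y i , cv i z ⟩))

    B-αˡ : ∀ i m y → B (α i m) y ≡ ⟨ m , cv i y ⟩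
    B-αˡ i m y = trans (∑-single (λ j → ⟨ α i m j , cv j y ⟩) i (λ j p → pair-0ˡ K (cv j y) (α-other i m (p ∘ sym)))) (pair-cong K (α-same i m) (λ _ → refl))

    pair-∑ : ∀ {l} x (f : Fin l → M) → ⟨ x , (λ k → ∑ (λ j → f j k)) ⟩ ≡ ∑ (λ j → ⟨ x , f j ⟩)
    pair-∑ {zero} x f = pair-0ʳ K x (λ _ → refl)
    pair-∑ {suc l} x f = trans (pair-+ʳ K x (f F.zero) _) (cong (λ t → ⟨ x , f F.zero ⟩ + t) (pair-∑ x (λ j → f (F.suc j))))

    private
      D Q : V → V → ℤ
      D x y = ∑ (λ i → ⟨ x i , y i ⟩ + ⟨ x i , y i ⟩)
      Q x y = ∑ (λ i → ∑ (λ j → ⟨ x i , A (ee i j) (y j) ⟩))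

      B-DQ : ∀ x y → B x y ≡ D x y + - Q x y
      B-DQ x y = trans (∑-cong (λ i → trans (pair-cong K {x i} (λ _ → refl) (λ k → l (y i k) (Nb i y k)))
          (trans (pair-+ʳ K (x i) (λ k → y i k + y i k) (λ k → - Nb i y k)) (cong₂ _+_ (pair-+ʳ K (x i) (y i) (y i))
            (trans (pair-negʳ K (x i) (Nb i y)) (cong -_ (pair-∑ (x i) (λ j → A (ee i j) (y j)))))))))
        (trans (∑-+ (λ i → ⟨ x i , y i ⟩ + ⟨ x i , y i ⟩) (λ i → - ∑ (λ j → ⟨ x i , A (ee i j) (y j) ⟩)))
          (cong (λ t → D x y + t) (∑-neg (λ i → ∑ (λ j → ⟨ x i , A (ee i j) (y j) ⟩)))))
        where
        l : ∀ u v → + 2 * u - v ≡ (u + u) + (- v)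
        l = solve-∀

      D-sym : ∀ x y → D x y ≡ D y x
      D-sym x y = ∑-cong (λ i → cong₂ _+_ (pair-comm K (x i) (y i)) (pair-comm K (x i) (y i)))

      Q-sym : ∀ x y → Q x y ≡ Q y x
      Q-sym x y = trans (∑-swap (λ i j → ⟨ x i , A (ee i j) (y j) ⟩)) (∑-cong (λ j → ∑-cong (λ i →
        trans (sym (A-adjoint (ee i j) K (cut-ok c i j) (x i) (y j))) (trans (pair-comm K _ (y j)) (cong (λ t → ⟨ y j , A t (x i) ⟩) (ee-sym i j))))))

    A-adj : ∀ i j x y → ⟨ A (ee i j) x , y ⟩ ≡ ⟨ x , A (ee j i) y ⟩
    A-adj i j x y = trans (A-adjoint (ee i j) K (cut-ok c i j) x y) (cong (λ t → ⟨ x , A t y ⟩) (ee-sym i j))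

    B-sym : ∀ x y → B x y ≡ B y x
    B-sym x y = trans (B-DQ x y) (trans (cong₂ (λ u v → u + - v) (D-sym x y) (Q-sym x y)) (sym (B-DQ y x)))

    B-rˡ : ∀ i x y → B (r i x) y ≡ B x y + - ⟨ cv i x , cv i y ⟩
    B-rˡ i x y = trans (B-cong {y = y} (r-cv i x) ≈-refl) (trans (B-+ˡ x _ y) (cong (λ t → B x y + t) (trans (B-αˡ i (λ k → - cv i x k) y) (pair-negˡ K (cv i x) (cv i y)))))

    B-r : ∀ i x y → B (r i x) (r i y) ≡ B x y
    B-r i x y = trans (B-rˡ i x (r i y)) (trans (cong₂ (λ u v → u + - v) (trans (B-sym x (r i y)) (B-rˡ i y x))
        (trans (pair-cong K {cv i x} (λ _ → refl) (cv-r-same i y)) (pair-negʳ K (cv i x) (cv i y))))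
      (trans (cong₂ (λ u v → (u + - v) + - - ⟨ cv i x , cv i y ⟩) (B-sym y x) (pair-comm K (cv i y) (cv i x))) (l (B x y) ⟨ cv i x , cv i y ⟩)))
      where
      l : ∀ u v → (u + - v) + - - v ≡ u
      l = solve-∀

    B-ρ : ∀ w x y → B (ρ w x) (ρ w y) ≡ B x y
    B-ρ = ρ-word (λ f → ∀ x y → B (f x) (f y) ≡ B x y)
      (λ h p x y → trans (B-cong (≈-sym (h x)) (≈-sym (h y))) (p x y)) (λ x y → refl) (λ i w p x y → trans (B-r i (ρ w x) (ρ w y)) (p x y))

    isometry : ∀ g i j (φ : M → M) → (∀ m → ρ g (α i m) ≈ α j (φ m)) → ∀ m m' → ⟨ φ m , φ m' ⟩ ≡ ⟨ m , m' ⟩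
    isometry g i j φ h m m' = ℤₚ.*-cancelˡ-≡ (+ 2) ⟨ φ m , φ m' ⟩ ⟨ m , m' ⟩ (trans (dblpair j (φ m) (φ m'))
        (trans (B-cong (≈-sym (h m)) (≈-sym (h m'))) (trans (B-ρ g (α i m) (α i m')) (sym (dblpair i m m')))))
      where
      dblpair : ∀ i m m' → + 2 * ⟨ m , m' ⟩ ≡ B (α i m) (α i m')
      dblpair i m m' = sym (trans (B-αˡ i m (α i m')) (trans (pair-cong K {m} (λ _ → refl) (λ k → trans (cv-α-same i m' k) (l (m' k))))
        (trans (pair-+ʳ K m m' m') (sym (l ⟨ m , m' ⟩)))))
        where
        l : ∀ u → + 2 * u ≡ u + u
        l = solve-∀

  absM : M → M
  absM m k = + ℤ.∣ m k ∣

  absM-NN : ∀ m → NN (absM m)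
  absM-NN m k = ℤ.+≤+ z≤n

  defM : M → M
  defM m k = absM m k - m k

  defM-NN : ∀ m → NN (defM m)
  defM-NN m k = ℤₚ.i≤j⇒0≤j-i (go (m k))
    where
    go : ∀ u → u ≤ + ℤ.∣ u ∣
    go (+ _) = ℤₚ.≤-refl
    go ℤ.-[1+ _ ] = ℤ.-≤+

  splitM : ∀ m k → m k ≡ absM m k + (- defM m k)
  splitM m k = l (m k) (absM m k)
    where
    l : ∀ u v → u ≡ v + - (v - u)
    l = solve-∀

  -- Every sequence is the difference of the nonnegative sequences `absM m` and `defM m`, so a
  -- coefficient may be shown to vanish by sign arguments.
  linear-ext : ∀ g i j → (∀ m → NN m → ∀ k → ρ g (α i m) j k ≡ 0ℤ) → ∀ m k → ρ g (α i m) j k ≡ 0ℤ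
  linear-ext g i j h m k = trans (ρ-cong g (α-cong i (splitM m)) j k) (trans (ρ-cong g (α-+ i (absM m) (λ k → - defM m k)) j k) (trans (ρ-⊕ g _ _ j k)
    (cong₂ _+_ (h (absM m) (absM-NN m) k) (trans (ρ-cong g (α-neg i (defM m)) j k) (trans (ρ-⊖ g _ j k) (cong -_ (h (defM m) (defM-NN m) k)))))))

  supp1 : ∀ g i j → (∀ l → j ≢ l → ∀ m k → ρ g (α i m) l k ≡ 0ℤ) → ∀ m → ρ g (α i m) ≈ α j (λ k → ρ g (α i m) j k)
  supp1 g i j h m = updCase (λ l → ∀ k → ρ g (α i m) l k ≡ α j (λ k → ρ g (α i m) j k) l k)
    (λ k → sym (α-same j _ k)) (λ l p k → trans (h l p m k) (sym (α-other j _ p k)))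

  -- The reflection `r j` changes only the coordinate `j`, so every other coordinate of the root is
  -- both nonnegative and nonpositive.
  Neg-first : ∀ g i j → ¬ Neg g i → Neg (gen j · g) i → ∀ m → ρ g (α i m) ≈ α j (λ k → ρ g (α i m) j k)
  Neg-first g i j p ng = supp1 g i j λ l j≢l → linear-ext g i l λ m hm k → nn-antisym (pos-vec g i p hm l k)
    (subst (0ℤ ≤_) (cong -_ (trans (ρ-first j g (α i m) l k) (r-other j (ρ g (α i m)) j≢l k))) (neg-vec (gen j · g) i ng hm l k))

  -- The scalar map `φ` is an isometry and `ψ` is a right inverse of it, so the coroot pairing with
  -- `j` after `g` is `φ` of the pairing with `i`. Both sides of the claim then act alike, and the
  -- representation is faithful.
  refl-eq : ∀ g i j → (∀ m → ρ g (α i m) ≈ α j (λ k → ρ g (α i m) j k)) → (∀ m → ρ (inv g) (α j m) ≈ α i (λ k → ρ (inv g) (α j m) i k)) →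
    gen j · g ≡ g · gen i
  refl-eq g i j hφ hψ = cancelˡ (inv g · gen j) (begin
    (inv g · gen j) · (gen j · g) ≡⟨ assoc _ _ _ ⟩
    inv g · (gen j · (gen j · g)) ≡⟨ cong (inv g ·_) (gen-cancelˡ j g) ⟩
    inv g · g ≡⟨ invˡ g ⟩
    e ≡⟨ sym (faithful _ triv) ⟩
    (inv g · gen j) · (g · gen i) ∎)
    where
    φ ψ : M → M
    φ m k = ρ g (α i m) j k
    ψ m k = ρ (inv g) (α j m) i k
    ρ-inv' : ∀ x → ρ g (ρ (inv g) x) ≈ x
    ρ-inv' x = ≈-trans (≈-sym (ρ-· g (inv g) x)) (subst (λ t → ρ t x ≈ x) (sym (invʳ g)) (ρ-e x))
    φψ : ∀ m → α j m ≈ ρ g (α i (ψ m))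
    φψ m = ≈-trans (≈-sym (ρ-inv' (α j m))) (ρ-cong g (hψ m))
    key : ∀ x k → cv j (ρ g x) k ≡ φ (cv i x) k
    -- Entry `k` is read off by pairing with `δ k` in the form cut beyond `k`, where the invariance
    -- of `B` moves `g` to the other side.
    key x k = begin
      cv j (ρ g x) k ≡⟨ sym (pair-δ K k (cv j (ρ g x)) (cut-big k)) ⟩
      ⟨ δ k , cv j (ρ g x) ⟩ ≡⟨ sym (B-αˡ j (δ k) (ρ g x)) ⟩
      B (α j (δ k)) (ρ g x) ≡⟨ B-cong {y = ρ g x} (φψ (δ k)) ≈-refl ⟩
      B (ρ g (α i (ψ (δ k)))) (ρ g x) ≡⟨ B-ρ g _ _ ⟩
      B (α i (ψ (δ k))) x ≡⟨ B-αˡ i (ψ (δ k)) x ⟩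
      ⟨ ψ (δ k) , cv i x ⟩ ≡⟨ sym (isometry g i j φ hφ (ψ (δ k)) (cv i x)) ⟩
      ⟨ φ (ψ (δ k)) , φ (cv i x) ⟩ ≡⟨ pair-cong K {y = φ (cv i x)} (λ l → trans (sym (φψ (δ k) j l)) (α-same j (δ k) l)) (λ _ → refl) ⟩
      ⟨ δ k , φ (cv i x) ⟩ ≡⟨ pair-δ K k (φ (cv i x)) (cut-big k) ⟩
      φ (cv i x) k ∎
      where open Form k
    both : ∀ x → ρ (g · gen i) x ≈ r j (ρ g x)
    both x = ≈-trans (ρ-last g i x) (≈-trans (ρ-cong g (r-cv i x)) (≈-trans (ρ-⊕ g x _) (≈-trans
      (⊕-cong {ρ g x} ≈-refl (≈-trans (ρ-cong g (α-neg i (cv i x))) (≈-trans (ρ-⊖ g _) (≈-trans (⊖-cong (≈-trans (hφ (cv i x)) (α-cong j (λ k → sym (key x k)))))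
        (≈-sym (α-neg j (cv j (ρ g x)))))))) (≈-sym (r-cv j (ρ g x))))))
    triv : ∀ x → ρ ((inv g · gen j) · (g · gen i)) x ≈ x
    triv x = ≈-trans (ρ-· (inv g · gen j) (g · gen i) x) (≈-trans (ρ-cong (inv g · gen j) (both x))
      (≈-trans (ρ-last (inv g) j (r j (ρ g x))) (≈-trans (ρ-cong (inv g) (r-invol j (ρ g x))) (ρ-inv g x))))

  -- `Neg-first` is applied to `g` and to `inv g`: the second application provides the inverse
  -- scalar map, since a nonzero map of sequences need not be invertible by itself.
  exchange : ∀ g i j → ¬ Neg g i → Neg (gen j · g) i → gen j · g ≡ g · gen i
  exchange g i j p ng = refl-eq g i j (Neg-first g i j p ng) (Neg-first (inv g) j i p' ng')
    where
    e1 : len (inv g · gen j) ≡ len (gen j · g)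
    e1 = trans (cong len (trans (cong (inv g ·_) (sym (inv-gen j))) (sym (inv-· (gen j) g)))) (len-inv _)
    p' : ¬ Neg (inv g) j
    p' h = p (ℕₚ.≤-trans (s≤s le) (subst₂ ℕ._<_ e1 (len-inv g) h))
      where
      le : len (g · gen i) ℕ.≤ len (gen j · g)
      le = ℕₚ.≤-trans (subst (λ t → len t ℕ.≤ suc (len ((gen j · g) · gen i))) (trans (cong (gen j ·_) (assoc _ _ _)) (gen-cancelˡ j (g · gen i))) (len-sˡ j ((gen j · g) · gen i))) ng
    ng' : Neg (gen i · inv g) j
    ng' = subst₂ ℕ._<_ (sym (trans (cong len e2) (len-inv _))) (sym (trans (cong len e3) (trans (len-inv (g · gen i)) (Pos-len g i p))))
      (ℕₚ.≤-trans ng (len-sˡ j g))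
      where
      e3 : gen i · inv g ≡ inv (g · gen i)
      e3 = trans (cong (_· inv g) (sym (inv-gen i))) (sym (inv-· g (gen i)))
      e2 : (gen i · inv g) · gen j ≡ inv ((gen j · g) · gen i)
      e2 = sym (trans (cong inv (assoc _ _ _)) (trans (inv-· (gen j) (g · gen i)) (cong₂ _·_ (sym e3) (inv-gen j))))

  -- By the commutation relation `g α_i` is an eigenvector of `r j` for -1, and outside the
  -- coordinate `j` the reflection is the identity.
  conj-supp : ∀ g i j → gen j · g ≡ g · gen i → ∀ m → ρ g (α i m) ≈ α j (λ k → ρ g (α i m) j k)
  conj-supp g i j eq = supp1 g i j λ l j≢l m k → self0 (ρ g (α i m) l k) (begin
    ρ g (α i m) l k ≡⟨ sym (r-other j (ρ g (α i m)) j≢l k) ⟩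
    r j (ρ g (α i m)) l k ≡⟨ sym (ρ-first j g (α i m) l k) ⟩
    ρ (gen j · g) (α i m) l k ≡⟨ cong (λ t → ρ t (α i m) l k) eq ⟩
    ρ (g · gen i) (α i m) l k ≡⟨ ρ-last g i (α i m) l k ⟩
    ρ g (r i (α i m)) l k ≡⟨ ρ-cong g (r-α-same i m) l k ⟩
    ρ g (⊖ α i m) l k ≡⟨ ρ-⊖ g (α i m) l k ⟩
    - ρ g (α i m) l k ∎)
    where
    self0 : ∀ u → u ≡ - u → u ≡ 0ℤ
    self0 u p with ℤₚ.i*j≡0⇒i≡0∨j≡0 (+ 2) {u} (trans (l u) (trans (cong (λ t → u + t) p) (ℤₚ.+-inverseʳ u)))
      where
      l : ∀ u → + 2 * u ≡ u + u
      l = solve-∀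
    ... | inj₂ q = q

-- Inversion sets and the weak order.

module WeakOrder (C : CoxeterSystem) where

  open Representation C
  open Positivity C

  -- The pair (x , i) stands for the root x α_i, which has many such names. For positive pairs,
  -- equality of `refl-of` serves as equality of roots; the vectors then agree up to a nonnegative
  -- map of sequences, by `same-vec`.
  Root : Set
  Root = Fin N × Fin n

  PosR : Root → Set
  PosR (x , i) = ¬ Neg x i

  I : Fin N → Root → Set
  I z (x , i) = Neg (inv z · x) i

  I? : ∀ z β → Dec (I z β)
  I? z (x , i) = Neg? (inv z · x) i

  infixr 8 _▸_
  _▸_ : Fin N → Root → Root
  g ▸ (x , i) = (g · x , i)

  vec : Root → M → V
  vec (x , i) m = ρ x (α i m)

  vec-▸ : ∀ g β m → vec (g ▸ β) m ≈ ρ g (vec β m)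
  vec-▸ g (x , i) m = ρ-· g x (α i m)

  refl-of : Root → Fin N
  refl-of (x , i) = (x · gen i) · inv x

  infix 4 _⊑_
  _⊑_ : Fin N → Fin N → Set
  u ⊑ v = ∀ β → PosR β → I u β → I v β

  ⊑-refl : ∀ {u} → u ⊑ u
  ⊑-refl β _ h = h

  ⊑-trans : ∀ {u v w} → u ⊑ v → v ⊑ w → u ⊑ w
  ⊑-trans p q β pos h = q β pos (p β pos h)

  inv-cancel : ∀ x y → inv x · (x · y) ≡ y
  inv-cancel x y = trans (sym (assoc _ _ _)) (trans (cong (_· y) (invˡ x)) (idˡ y))

  cancel-inv : ∀ x y → x · (inv x · y) ≡ y
  cancel-inv x y = trans (sym (assoc _ _ _)) (trans (cong (_· y) (invʳ x)) (idˡ y))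

  ¬Neg-e : ∀ i → ¬ Neg e i
  ¬Neg-e i h = ℕₚ.n≮0 (subst (len (e · gen i) ℕ.<_) len-e h)

  rootcomp : ∀ h i j → gen j · h ≡ h · gen i → ¬ Neg h i → ∀ g → (Neg (g · h) i → Neg g j) × (Neg g j → Neg (g · h) i)
  rootcomp h i j eq pos g = fwd , bwd
    where
    φ : M
    φ k = ρ h (α i 𝟙) j k
    φ-NN : NN φ
    φ-NN k = pos-vec h i pos 𝟙-NN j k
    v : ρ (g · h) (α i 𝟙) ≈ ρ g (α j φ)
    v = ≈-trans (ρ-· g h (α i 𝟙)) (ρ-cong g (conj-supp h i j eq 𝟙))
    fwd : Neg (g · h) i → Neg g j
    fwd ng with Neg? g j
    ... | yes p = p
    ... | no ¬p = ⊥-elim (sign-pos (g · h) i (NNV-≈ (≈-sym v) (pos-vec g j ¬p φ-NN)) ng)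
    bwd : Neg g j → Neg (g · h) i
    bwd ng = sign-neg (g · h) i (NNV-≈ (⊖-cong (≈-sym v)) (neg-vec g j ng φ-NN))

  refl-conj : ∀ x y i j → refl-of (x , i) ≡ refl-of (y , j) → gen j · (inv y · x) ≡ (inv y · x) · gen i
  refl-conj x y i j eq = cancelˡ y (begin
    y · (gen j · (inv y · x)) ≡⟨ sym (assoc _ _ _) ⟩
    (y · gen j) · (inv y · x) ≡⟨ sym (assoc _ _ _) ⟩
    ((y · gen j) · inv y) · x ≡⟨ cong (_· x) (sym eq) ⟩
    ((x · gen i) · inv x) · x ≡⟨ assoc _ _ _ ⟩
    (x · gen i) · (inv x · x) ≡⟨ trans (cong ((x · gen i) ·_) (invˡ x)) (idʳ _) ⟩
    x · gen i ≡⟨ cong (_· gen i) (sym (cancel-inv y x)) ⟩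
    (y · (inv y · x)) · gen i ≡⟨ assoc _ _ _ ⟩
    y · ((inv y · x) · gen i) ∎)

  -- If the scalar relating the two roots were negative, then `y α_j` would have the sign of
  -- `- x α_i`.
  same-pos : ∀ x y i j → refl-of (x , i) ≡ refl-of (y , j) → ¬ Neg x i → ¬ Neg y j → ¬ Neg (inv y · x) i
  same-pos x y i j eq px py ng = py (proj₁ (rootcomp h' i j eq' (Neg-flip h i ng) y)
      (subst (λ t → Neg t i) (trans (cong (_· gen i) (sym (cancel-inv y x))) (assoc _ _ _)) (Pos-flip x i px)))
    where
    h = inv y · x
    h' = h · gen i
    eq' : gen j · h' ≡ h' · gen i
    eq' = trans (sym (assoc _ _ _)) (cong (_· gen i) (refl-conj x y i j eq))

  same-Neg : ∀ x y i j → refl-of (x , i) ≡ refl-of (y , j) → ¬ Neg x i → ¬ Neg y j → ∀ g → Neg (g · x) i → Neg (g · y) j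
  same-Neg x y i j eq px py g ng = proj₁ (rootcomp (inv y · x) i j (refl-conj x y i j eq) (same-pos x y i j eq px py) (g · y))
    (subst (λ t → Neg t i) (trans (cong (g ·_) (sym (cancel-inv y x))) (sym (assoc _ _ _))) ng)

  same-I : ∀ β γ → refl-of β ≡ refl-of γ → PosR β → PosR γ → ∀ z → I z β → I z γ
  same-I (x , i) (y , j) eq pβ pγ z = same-Neg x y i j eq pβ pγ (inv z)

  opaque
    same-vec : ∀ β γ → refl-of β ≡ refl-of γ → PosR β → PosR γ → Σ (M → M) λ φ → (∀ m → NN m → NN (φ m)) × (∀ m → vec β m ≈ vec γ (φ m))
    same-vec (x , i) (y , j) eq pβ pγ = (λ m k → ρ (inv y · x) (α i m) j k) ,
      (λ m hm k → pos-vec (inv y · x) i (same-pos x y i j eq pβ pγ) hm j k) ,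
      (λ m → ≈-trans (subst (λ t → ρ x (α i m) ≈ ρ t (α i m)) (sym (cancel-inv y x)) ≈-refl)
        (≈-trans (ρ-· y (inv y · x) (α i m)) (ρ-cong y (conj-supp (inv y · x) i j (refl-conj x y i j eq) m))))

  I-vec-neg : ∀ z β → I z β → ∀ {m} → NN m → NNV (⊖ ρ (inv z) (vec β m))
  I-vec-neg z (x , i) h hm = NNV-≈ (⊖-cong (ρ-· (inv z) x (α i _))) (neg-vec (inv z · x) i h hm)

  I-vec-pos : ∀ z β → ¬ I z β → ∀ {m} → NN m → NNV (ρ (inv z) (vec β m))
  I-vec-pos z (x , i) h hm = NNV-≈ (ρ-· (inv z) x (α i _)) (pos-vec (inv z · x) i h hm)

  I-from-neg : ∀ z β → NNV (⊖ ρ (inv z) (vec β 𝟙)) → I z β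
  I-from-neg z (x , i) h = sign-neg (inv z · x) i (NNV-≈ (⊖-cong (≈-sym (ρ-· (inv z) x (α i 𝟙)))) h)

  I-from-pos : ∀ z β → NNV (ρ (inv z) (vec β 𝟙)) → ¬ I z β
  I-from-pos z (x , i) h = sign-pos (inv z · x) i (NNV-≈ (≈-sym (ρ-· (inv z) x (α i 𝟙))) h)

  e⊑ : ∀ v → e ⊑ v
  e⊑ v (x , i) pos h = ⊥-elim (pos (subst (λ t → Neg t i) (trans (cong (_· x) inv-e) (idˡ x)) h))

  cov : Fin N → Fin n → Root
  cov z p = (z · gen p , p)

  cov-pos : ∀ z p → Neg z p → PosR (cov z p)
  cov-pos z p = Neg-flip z p

  cov-in : ∀ z p → I z (cov z p)
  cov-in z p = subst (λ t → Neg t p) (trans (idˡ _) (sym (inv-cancel z (gen p)))) (Pos-flip e p (¬Neg-e p))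

  cov-out : ∀ z p → ¬ I (z · gen p) (cov z p)
  cov-out z p h = ¬Neg-e p (subst (λ t → Neg t p) (invˡ _) h)

  I-s : ∀ s z x → inv (gen s · z) · x ≡ inv z · (gen s · x)
  I-s s z x = trans (cong (_· x) (trans (inv-· (gen s) z) (cong (inv z ·_) (inv-gen s)))) (assoc _ _ _)

  inv-r : ∀ z p x → inv (z · gen p) · x ≡ gen p · (inv z · x)
  inv-r z p x = trans (cong (_· x) (trans (inv-· z (gen p)) (cong (_· inv z) (inv-gen p)))) (assoc _ _ _)

  refl-cov : ∀ z p → refl-of (cov z p) ≡ (z · gen p) · inv z
  refl-cov z p = trans (cong (_· inv (z · gen p)) (gen-cancelʳ p z)) (trans (cong (z ·_) (trans (inv-· z (gen p)) (cong (_· inv z) (inv-gen p)))) (sym (assoc _ _ _)))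

  private
    refl-from : ∀ z p x i → gen p · (inv z · x) ≡ (inv z · x) · gen i → refl-of (x , i) ≡ refl-of (cov z p)
    refl-from z p x i eq = trans (cancelʳ x (begin
      ((x · gen i) · inv x) · x ≡⟨ trans (assoc _ _ _) (trans (cong ((x · gen i) ·_) (invˡ x)) (idʳ _)) ⟩
      x · gen i ≡⟨ cong (_· gen i) (sym (cancel-inv z x)) ⟩
      (z · (inv z · x)) · gen i ≡⟨ trans (assoc _ _ _) (cong (z ·_) (sym eq)) ⟩
      z · (gen p · (inv z · x)) ≡⟨ sym (assoc _ _ _) ⟩
      (z · gen p) · (inv z · x) ≡⟨ sym (assoc _ _ _) ⟩
      ((z · gen p) · inv z) · x ∎)) (sym (refl-cov z p))

  cov-unique : ∀ z p β → I z β → ¬ I (z · gen p) β → refl-of β ≡ refl-of (cov z p)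
  cov-unique z p (x , i) h ¬h = refl-from z p x i (begin
      gen p · g ≡⟨ trans (cong (λ t → gen p · t) g≡) (trans (cong (gen p ·_) ex) (sym (assoc _ _ _))) ⟩
      (gen p · g') · gen i ≡⟨ cong (_· gen i) (sym g≡) ⟩
      g · gen i ∎)
    where
    g = inv z · x
    g' = gen p · g
    g≡ : g ≡ gen p · g'
    g≡ = sym (gen-cancelˡ p g)
    ex : gen p · g' ≡ g' · gen i
    ex = exchange g' i p (λ q → ¬h (subst (λ t → Neg t i) (sym (inv-r z p x)) q)) (subst (λ t → Neg t i) g≡ h)

  cov-unique' : ∀ z p β → ¬ I z β → I (z · gen p) β → refl-of β ≡ refl-of (cov z p)
  cov-unique' z p (x , i) ¬h h = refl-from z p x i (exchange (inv z · x) i p ¬h (subst (λ t → Neg t i) (inv-r z p x) h))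

  cov-⊑ : ∀ z p → Neg z p → z · gen p ⊑ z
  cov-⊑ z p ng β pos h with I? z β
  ... | yes q = q
  ... | no ¬q = ⊥-elim (cov-out z p (same-I β (cov z p) (cov-unique' z p β ¬q h) pos (cov-pos z p ng) (z · gen p) h))

  cov-below : ∀ u z p → Neg z p → u ⊑ z → ¬ I u (cov z p) → u ⊑ z · gen p
  cov-below u z p ng le ¬h β pos h with I? (z · gen p) β
  ... | yes q = q
  ... | no ¬q = ⊥-elim (¬h (same-I β (cov z p) (cov-unique z p β (le β pos h) ¬q) pos (cov-pos z p ng) u h))

  -- Any descent `p` of `inv u · z` works. If `z α_p` were positive it would be an inversion of `u`
  -- and not of `z`; so `p` is a descent of `z`, and its cover root is no inversion of `u`.
  ⊑-cover : ∀ u z → u ⊑ z → u ≢ z → ∃[ p ] Neg z p × u ⊑ z · gen p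
  ⊑-cover u z le u≢z with exists-Neg (inv u · z) (λ q → u≢z (trans (sym (idʳ u)) (trans (cong (u ·_) (sym q)) (cancel-inv u z))))
  ... | p , ng = p , nz , cov-below u z p nz le (λ h → Neg-flip (inv u · z) p ng (subst (λ t → Neg t p) (sym (assoc _ _ _)) h))
    where
    nz : Neg z p
    nz with Neg? z p
    ... | yes q = q
    ... | no ¬q = ⊥-elim (¬Neg-e p (subst (λ t → Neg t p) (invˡ z) (le (z , p) ¬q ng)))

  ⊑-antisym : ∀ u v → u ⊑ v → v ⊑ u → u ≡ v
  ⊑-antisym u v p q with u ≟ v
  ... | yes r = r
  ... | no ¬r with ⊑-cover u v p ¬r
  ... | i , ng , le = ⊥-elim (cov-out v i (le (cov v i) (cov-pos v i ng) (q (cov v i) (cov-pos v i ng) (cov-in v i))))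

  ⊑-len : ∀ u v → u ⊑ v → len u ℕ.≤ len v
  ⊑-len u v = go (len v) v ℕₚ.≤-refl
    where
    go : ∀ b v → len v ℕ.≤ b → u ⊑ v → len u ℕ.≤ len v
    go b v v≤b le with u ≟ v
    ... | yes refl = ℕₚ.≤-refl
    ... | no ¬r with ⊑-cover u v le ¬r
    go zero v v≤b le | no ¬r | i , ng , le' = ⊥-elim (ℕₚ.n≮0 (ℕₚ.≤-trans ng v≤b))
    go (suc b) v v≤b le | no ¬r | i , ng , le' = ℕₚ.≤-trans (go b (v · gen i) (ℕₚ.≤-pred (ℕₚ.≤-trans ng v≤b)) le') (ℕₚ.<⇒≤ ng)

  LD : Fin n → Fin N → Set
  LD s z = Neg (inv z) s

  LD? : ∀ s z → Dec (LD s z)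
  LD? s z = Neg? (inv z) s

  inv-sz : ∀ s z → inv (gen s · z) ≡ inv z · gen s
  inv-sz s z = trans (inv-· (gen s) z) (cong (inv z ·_) (inv-gen s))

  LD-I : ∀ {s z} → LD s z → I z (e , s)
  LD-I {s} {z} = subst (λ t → Neg t s) (sym (idʳ (inv z)))

  I-LD : ∀ {s z} → I z (e , s) → LD s z
  I-LD {s} {z} = subst (λ t → Neg t s) (idʳ (inv z))

  simple-pos : ∀ s → PosR (e , s)
  simple-pos = ¬Neg-e

  LD-⊑ : ∀ {s u v} → u ⊑ v → LD s u → LD s v
  LD-⊑ {s} {u} {v} le h = I-LD {s} {v} (le (e , s) (simple-pos s) (LD-I {s} {u} h))

  LD-strip : ∀ s z → LD s z → ¬ LD s (gen s · z)
  LD-strip s z h = subst (λ t → ¬ Neg t s) (sym (inv-sz s z)) (Neg-flip (inv z) s h)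

  LD-add : ∀ s z → ¬ LD s z → LD s (gen s · z)
  LD-add s z h = subst (λ t → Neg t s) (sym (inv-sz s z)) (Pos-flip (inv z) s h)

  len-add : ∀ s z → ¬ LD s z → len (gen s · z) ≡ suc (len z)
  len-add s z h = trans (sym (len-inv _)) (trans (cong len (inv-sz s z)) (trans (Pos-len (inv z) s h) (cong suc (len-inv z))))

  len-strip : ∀ s z → LD s z → len z ≡ suc (len (gen s · z))
  len-strip s z h = trans (cong len (sym (gen-cancelˡ s z))) (len-add s (gen s · z) (LD-strip s z h))

  ¬LD-len : ∀ s z → len z ℕ.< len (gen s · z) → ¬ LD s z
  ¬LD-len s z lt h = ℕₚ.<-asym lt (ℕₚ.≤-reflexive (sym (len-strip s z h)))

  I-add : ∀ s z β → I (gen s · z) β → I z (gen s ▸ β)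
  I-add s z (x , i) = subst (λ t → Neg t i) (I-s s z x)

  I-add' : ∀ s z β → I z (gen s ▸ β) → I (gen s · z) β
  I-add' s z (x , i) = subst (λ t → Neg t i) (sym (I-s s z x))

  ▸-cancel : ∀ s β → gen s ▸ (gen s ▸ β) ≡ β
  ▸-cancel s (x , i) = cong (_, i) (gen-cancelˡ s x)

  simple-refl : ∀ s β → PosR β → ¬ PosR (gen s ▸ β) → refl-of β ≡ refl-of (e , s)
  simple-refl s (x , i) pos neg with Neg? (gen s · x) i
  ... | no ¬q = ⊥-elim (neg ¬q)
  ... | yes q = cancelʳ x (trans (trans (assoc _ _ _) (trans (cong ((x · gen i) ·_) (invˡ x)) (idʳ _)))
    (trans (sym (exchange x i s pos q)) (sym (cong (_· x) (trans (cong₂ _·_ (idˡ _) inv-e) (idʳ _))))))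

  pos? : ∀ β → Dec (PosR β)
  pos? (x , i) with Neg? x i
  ... | yes p = no (λ q → q p)
  ... | no ¬p = yes ¬p

  -- Left multiplication by `gen s` permutes the positive roots other than α_s, and α_s is an
  -- inversion of `gen s · v` in any case.
  add-⊑ : ∀ s u v → ¬ LD s v → u ⊑ v → gen s · u ⊑ gen s · v
  add-⊑ s u v ¬v le β pos h with pos? (gen s ▸ β)
  ... | yes p = I-add' s v β (le (gen s ▸ β) p (I-add s u β h))
  ... | no ¬p = same-I (e , s) β (sym (simple-refl s β pos ¬p)) (simple-pos s) pos (gen s · v) (LD-I {s} {gen s · v} (LD-add s v ¬v))

  strip-⊑ : ∀ s u v → ¬ LD s u → gen s · u ⊑ gen s · v → u ⊑ v
  strip-⊑ s u v ¬u le β pos h with pos? (gen s ▸ β)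
  ... | yes p = subst (I v) (▸-cancel s β) (I-add s v (gen s ▸ β) (le (gen s ▸ β) p (I-add' s u (gen s ▸ β) (subst (I u) (sym (▸-cancel s β)) h))))
  ... | no ¬p = ⊥-elim (¬u (I-LD {s} {u} (same-I β (e , s) (simple-refl s β pos ¬p) pos (simple-pos s) u h)))

  strip-⊑' : ∀ s u v → LD s u → u ⊑ v → gen s · u ⊑ gen s · v
  strip-⊑' s u v hu le = strip-⊑ s (gen s · u) (gen s · v) (LD-strip s u hu) (subst₂ _⊑_ (sym (gen-cancelˡ s u)) (sym (gen-cancelˡ s v)) le)

  gen-⊑ : ∀ s z → LD s z → gen s ⊑ z
  gen-⊑ s z h = subst₂ _⊑_ (idʳ (gen s)) (gen-cancelˡ s z) (add-⊑ s e (gen s · z) (LD-strip s z h) (e⊑ _))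

  -- Supports, parabolic factorisations and meets.

  SuppV : List (Fin n) → V → Set
  SuppV J v = ∀ j → j ∉ J → ∀ k → v j k ≡ 0ℤ

  SuppR : List (Fin n) → Root → Set
  SuppR J β = ∀ m → SuppV J (vec β m)

  data InW (J : List (Fin n)) : Fin N → Set where
    one : InW J e
    mul : ∀ {q w} → q ∈ J → InW J w → InW J (gen q · w)

  InW-snoc : ∀ {J w q} → InW J w → q ∈ J → InW J (w · gen q)
  InW-snoc {J} {q = q} one h = subst (InW J) (trans (idʳ _) (sym (idˡ _))) (mul h one)
  InW-snoc {J} (mul h' p) h = subst (InW J) (sym (assoc _ _ _)) (mul h' (InW-snoc p h))

  InW-inv : ∀ {J w} → InW J w → InW J (inv w)
  InW-inv {J} one = subst (InW J) (sym inv-e) one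
  InW-inv {J} (mul {q} {w} h p) = subst (InW J) (sym (inv-sz q w)) (InW-snoc (InW-inv p) h)

  InW-vec : ∀ {J a} → InW J a → ∀ v j → j ∉ J → ∀ k → ρ a v j k ≡ v j k
  InW-vec one v j _ k = ρ-e v j k
  InW-vec (mul {q} {w} h p) v j j∉ k = trans (ρ-first q w v j k) (trans (r-other q (ρ w v) (λ { refl → j∉ h }) k) (InW-vec p v j j∉ k))

  -- Coordinates outside `J` are untouched by `inv a`, yet the root changes its sign; hence they are
  -- zero.
  InvSupp : ∀ {J a} → InW J a → ∀ β → PosR β → I a β → SuppR J β
  InvSupp {J} {a} wa (x , i) pos h m j j∉ k = linear-ext x i j (λ m hm k → nn-antisym (pos-vec x i pos hm j k)
    (subst (0ℤ ≤_) (cong -_ (InW-vec (InW-inv wa) (ρ x (α i m)) j j∉ k)) (I-vec-neg a (x , i) h hm j k))) m k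

  zap : Fin n → V → V
  zap q γ = upd γ q (λ _ → 0ℤ)

  zap-same : ∀ q γ k → zap q γ q k ≡ 0ℤ
  zap-same q γ k = cong (λ t → t k) (upd-same γ q (λ _ → 0ℤ))

  zap-other : ∀ {q} γ {j} → q ≢ j → ∀ k → zap q γ j k ≡ γ j k
  zap-other γ p k = cong (λ t → t k) (upd-other γ (λ _ → 0ℤ) p)

  zap-split : ∀ q γ → γ ≈ α q (γ q) ⊕ zap q γ
  zap-split q γ = updCase (λ j → ∀ k → γ j k ≡ (α q (γ q) ⊕ zap q γ) j k)
    (λ k → sym (trans (cong₂ _+_ (α-same q (γ q) k) (zap-same q γ k)) (ℤₚ.+-identityʳ _)))
    (λ j p k → sym (trans (cong₂ _+_ (α-other q (γ q) p k) (zap-other γ p k)) (ℤₚ.+-identityˡ _)))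

  zap-supp : ∀ q J γ → SuppV (q ∷ J) γ → SuppV J (zap q γ)
  zap-supp q J γ sp = updCase (λ j → j ∉ J → ∀ k → zap q γ j k ≡ 0ℤ) (λ _ → zap-same q γ)
    (λ j p j∉ k → trans (zap-other γ p k) (sp j (λ { (here refl) → p refl ; (there m) → j∉ m }) k))

  ρ-0 : ∀ h → ρ h 0V ≈ 0V
  ρ-0 h i k = half (ρ h 0V i k) (sym (ρ-⊕ h 0V 0V i k))
    where
    half : ∀ u → u + u ≡ u → u ≡ 0ℤ
    half u p = trans (l u) (trans (cong (λ t → t - u) p) (ℤₚ.+-inverseʳ u))
      where
      l : ∀ u → u ≡ (u + u) - u
      l = solve-∀

  lin : ∀ (Q : V → Set) → (∀ {x y} → x ≈ y → Q x → Q y) → Q 0V → (∀ x y → Q x → Q y → Q (x ⊕ y)) →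
    ∀ J h → (∀ q → q ∈ J → ∀ m → NN m → Q (ρ h (α q m))) → ∀ γ → NNV γ → SuppV J γ → Q (ρ h γ)
  lin Q resp q0 q+ [] h hq γ nn sp = resp (≈-trans (≈-sym (ρ-0 h)) (ρ-cong h (λ j k → sym (sp j (λ ()) k)))) q0
  lin Q resp q0 q+ (q ∷ J) h hq γ nn sp = resp (≈-sym (≈-trans (ρ-cong h (zap-split q γ)) (ρ-⊕ h (α q (γ q)) γ')))
      (q+ _ _ (hq q (here refl) (γ q) (nn q)) (lin Q resp q0 q+ J h (λ q' m → hq q' (there m)) γ' nn' (zap-supp q J γ sp)))
    where
    γ' : V
    γ' = zap q γ
    nn' : NNV γ'
    nn' = updCase (λ j → ∀ k → 0ℤ ≤ γ' j k) (λ k → ℤₚ.≤-reflexive (sym (zap-same q γ k))) (λ j p k → subst (0ℤ ≤_) (sym (zap-other γ p k)) (nn j k))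

  lin-pos : ∀ J h → (∀ q → q ∈ J → ¬ Neg h q) → ∀ γ → NNV γ → SuppV J γ → NNV (ρ h γ)
  lin-pos J h hq = lin NNV NNV-≈ (λ i k → ℤₚ.≤-refl) (λ x y p q i k → +-NN (p i k) (q i k)) J h (λ q q∈ m hm → pos-vec h q (hq q q∈) hm)

  lin-neg : ∀ J h → (∀ q → q ∈ J → Neg h q) → ∀ γ → NNV γ → SuppV J γ → NNV (⊖ ρ h γ)
  lin-neg J h hq = lin (λ v → NNV (⊖ v)) (λ p → NNV-≈ (⊖-cong p)) (λ i k → ℤₚ.≤-refl)
    (λ x y p q i k → subst (0ℤ ≤_) (sym (ℤₚ.neg-distrib-+ (x i k) (y i k))) (+-NN (p i k) (q i k))) J h (λ q q∈ m hm → neg-vec h q (hq q q∈) hm)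

  Min : List (Fin n) → Fin N → Set
  Min J x = ∀ q → q ∈ J → ¬ LD q x

  record Par (J : List (Fin n)) (z : Fin N) : Set where
    field
      left right : Fin N
      factor : z ≡ left · right
      inJ    : InW J left
      min    : Min J right

  par′ : ∀ J z → Par J z
  par′ J z = go (len z) z ℕₚ.≤-refl
    where
    go : ∀ b z → len z ℕ.≤ b → Par J z
    go b z z≤b with Any.any? (λ q → LD? q z) J
    ... | no ¬p = record { left = e ; right = z ; factor = sym (idˡ z) ; inJ = one ; min = λ q q∈ h → ¬p (lose q∈ h) }
      where open import Data.List.Membership.Propositional using (lose)
    ... | yes p with find p
      where open import Data.List.Membership.Propositional using (find)
    go zero z z≤b | yes p | q , q∈ , h = ⊥-elim (ℕₚ.n≮0 (ℕₚ.≤-trans (ℕₚ.≤-reflexive (sym (len-strip q z h))) z≤b))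
    go (suc b) z z≤b | yes p | q , q∈ , h = record { left = gen q · P.left ; right = P.right
        ; factor = trans (sym (gen-cancelˡ q z)) (trans (cong (gen q ·_) P.factor) (sym (assoc _ _ _))) ; inJ = mul q∈ P.inJ ; min = P.min }
      where
      module P = Par (go b (gen q · z) (ℕₚ.≤-pred (ℕₚ.≤-trans (ℕₚ.≤-reflexive (sym (len-strip q z h))) z≤b)))

  opaque
    par : ∀ J z → Par J z
    par = par′

  inv-·x : ∀ a u x → inv (a · u) · x ≡ inv u · (inv a · x)
  inv-·x a u x = trans (cong (_· x) (inv-· a u)) (assoc _ _ _)

  SuppV-ρ : ∀ {J a} → InW J a → ∀ v → SuppV J v → SuppV J (ρ a v)
  SuppV-ρ wa v sp j j∉ k = trans (InW-vec wa v j j∉ k) (sp j j∉ k)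

  -- `inv a` keeps the root in the span of `J`, and there `inv u` preserves signs because `u` has no
  -- left descent in `J`.
  comp-I : ∀ J a u → InW J a → Min J u → ∀ β → PosR β → SuppV J (vec β 𝟙) → (I (a · u) β → I a β) × (I a β → I (a · u) β)
  comp-I J a u wa mn β pos sp = fwd , bwd
    where
    γ = ρ (inv a) (vec β 𝟙)
    sγ : SuppV J γ
    sγ = SuppV-ρ (InW-inv wa) (vec β 𝟙) sp
    eq : ρ (inv (a · u)) (vec β 𝟙) ≈ ρ (inv u) γ
    eq = subst (λ t → ρ t (vec β 𝟙) ≈ ρ (inv u) γ) (sym (inv-· a u)) (ρ-· (inv u) (inv a) (vec β 𝟙))
    fwd : I (a · u) β → I a β
    fwd h with I? a β
    ... | yes p = p
    ... | no ¬p = ⊥-elim (I-from-pos (a · u) β (NNV-≈ (≈-sym eq) (lin-pos J (inv u) mn γ (I-vec-pos a β ¬p 𝟙-NN) sγ)) h)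
    bwd : I a β → I (a · u) β
    bwd h = I-from-neg (a · u) β (NNV-≈ (≈-trans (ρ-⊖ (inv u) γ) (⊖-cong (≈-sym eq)))
      (lin-pos J (inv u) mn (⊖ γ) (I-vec-neg a β h 𝟙-NN) (λ j j∉ k → cong -_ (sγ j j∉ k))))

  left-⊑ : ∀ J a u → InW J a → Min J u → a ⊑ a · u
  left-⊑ J a u wa mn β pos h = proj₂ (comp-I J a u wa mn β pos (InvSupp wa β pos h 𝟙)) h

  supp-simple : ∀ J q → q ∈ J → ∀ m → SuppV J (vec (e , q) m)
  supp-simple J q q∈ m j j∉ k = trans (ρ-e (α q m) j k) (α-other q m (λ { refl → j∉ q∈ }) k)

  record Glb (z x : Fin N) : Set where
    field
      meet  : Fin N
      leˡ   : meet ⊑ z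
      leʳ   : meet ⊑ x
      great : ∀ u → u ⊑ z → u ⊑ x → u ⊑ meet

  -- A common left descent `s` is stripped and the recursion continues. A lower bound `u` may have
  -- another left descent `q`, and then it lies below the candidate `mq` built from `q`. Let `a` be
  -- the part of `z` in the dihedral subgroup of `s` and `q`. It lies below `x` too, since both
  -- letters are left descents of `x`, so `a` is below `mq`. Therefore `mq` has `s` as a left
  -- descent and lies below the candidate built from `s`.
  glb′ : ∀ z x → Glb z x
  glb′ z x = go (len z) z x ℕₚ.≤-refl
    where
    go : ∀ b z x → len z ℕ.≤ b → Glb z x
    go b z x z≤b with any? (λ s → LD? s z ×-dec LD? s x)
    ... | no ¬p = record { meet = e ; leˡ = e⊑ z ; leʳ = e⊑ x ; great = gr }
      where
      gr : ∀ u → u ⊑ z → u ⊑ x → u ⊑ e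
      gr u uz ux with inv u ≟ e
      ... | yes q = subst (_⊑ e) (trans (sym inv-e) (trans (cong inv (sym q)) (inv-inv u))) ⊑-refl
      ... | no ¬q with exists-Neg (inv u) ¬q
      ... | s , h = ⊥-elim (¬p (s , LD-⊑ {s} {u} {z} uz h , LD-⊑ {s} {u} {x} ux h))
    go zero z x z≤b | yes (s , hz , hx) = ⊥-elim (ℕₚ.n≮0 (ℕₚ.≤-trans (ℕₚ.≤-reflexive (sym (len-strip s z hz))) z≤b))
    go (suc b) z x z≤b | yes (s , hz , hx) = record { meet = Mt.m s hz hx ; leˡ = Mt.m⊑z s hz hx ; leʳ = Mt.m⊑x s hz hx ; great = gr }
      where
      module Mt (q : Fin n) (qz : LD q z) (qx : LD q x) where
        sub : Glb (gen q · z) (gen q · x)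
        sub = go b (gen q · z) (gen q · x) (ℕₚ.≤-pred (ℕₚ.≤-trans (ℕₚ.≤-reflexive (sym (len-strip q z qz))) z≤b))
        module S = Glb sub
        m : Fin N
        m = gen q · S.meet
        m⊑z : m ⊑ z
        m⊑z = subst (m ⊑_) (gen-cancelˡ q z) (add-⊑ q S.meet (gen q · z) (LD-strip q z qz) S.leˡ)
        m⊑x : m ⊑ x
        m⊑x = subst (m ⊑_) (gen-cancelˡ q x) (add-⊑ q S.meet (gen q · x) (LD-strip q x qx) S.leʳ)
        ¬LDm : ¬ LD q S.meet
        ¬LDm h = LD-strip q z qz (LD-⊑ {q} {S.meet} {gen q · z} S.leˡ h)
        great-q : ∀ u → LD q u → u ⊑ z → u ⊑ x → u ⊑ m
        great-q u hu uz ux = subst (_⊑ m) (gen-cancelˡ q u) (add-⊑ q (gen q · u) S.meet ¬LDm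
          (S.great (gen q · u) (strip-⊑' q u z hu uz) (strip-⊑' q u x hu ux)))
      gr : ∀ u → u ⊑ z → u ⊑ x → u ⊑ Mt.m s hz hx
      gr u uz ux with inv u ≟ e
      ... | yes q = subst (_⊑ Mt.m s hz hx) (trans (sym inv-e) (trans (cong inv (sym q)) (inv-inv u))) (e⊑ _)
      ... | no ¬q with exists-Neg (inv u) ¬q
      ... | q , hu = ⊑-trans {u} {mq} {Mt.m s hz hx} (Mt.great-q q qz qx u hu uz ux)
          (Mt.great-q s hz hx mq (LD-⊑ {s} {a} {mq} (Mt.great-q q qz qx a (LDa q (there (here refl)) qz) a⊑z a⊑x) (LDa s (here refl) hz)) (Mt.m⊑z q qz qx) (Mt.m⊑x q qz qx))
        where
        qz : LD q z
        qz = LD-⊑ {q} {u} {z} uz hu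
        qx : LD q x
        qx = LD-⊑ {q} {u} {x} ux hu
        mq : Fin N
        mq = Mt.m q qz qx
        J : List (Fin n)
        J = s ∷ q ∷ []
        module P = Par (par J z)
        a : Fin N
        a = P.left
        a⊑z : a ⊑ z
        a⊑z = subst (a ⊑_) (sym P.factor) (left-⊑ J a P.right P.inJ P.min)
        LDa : ∀ t → t ∈ J → LD t z → LD t a
        LDa t t∈ h = I-LD {t} {a} (proj₁ (comp-I J a P.right P.inJ P.min (e , t) (simple-pos t) (supp-simple J t t∈ 𝟙)) (LD-I {t} {a · P.right} (subst (LD t) P.factor h)))
        a⊑x : a ⊑ x
        a⊑x (y , i) pos h = I-from-neg x (y , i) (lin-neg J (inv x) (λ { t (here refl) → hx ; t (there (here refl)) → qx }) (vec (y , i) 𝟙)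
          (pos-vec y i pos 𝟙-NN) (InvSupp P.inJ (y , i) pos h 𝟙))

  opaque
    glb : ∀ z x → Glb z x
    glb = glb′

  private
    argmax : ∀ {k} (f : Fin (suc k) → ℕ) → ∃[ i ] (∀ j → f j ℕ.≤ f i)
    argmax {zero} f = F.zero , λ { F.zero → ℕₚ.≤-refl }
    argmax {suc k} f with argmax (λ i → f (F.suc i))
    ... | i , h with ℕₚ.≤-total (f F.zero) (f (F.suc i))
    ... | inj₁ p = F.suc i , λ { F.zero → p ; (F.suc j) → h j }
    ... | inj₂ p = F.zero , λ { F.zero → ℕₚ.≤-refl ; (F.suc j) → ℕₚ.≤-trans (h j) p }

    argmaxN : ∀ {k} → Fin k → (f : Fin k → ℕ) → ∃[ i ] (∀ j → f j ℕ.≤ f i)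
    argmaxN {suc k} _ f = argmax f

  longest : ∃[ w ] (∀ p → Neg w p)
  longest with argmaxN e len
  ... | w , h = w , λ p → ng p (Neg? w p)
    where
    ng : ∀ p → Dec (Neg w p) → Neg w p
    ng p (yes q) = q
    ng p (no ¬q) = ⊥-elim (ℕₚ.<-irrefl refl (ℕₚ.≤-trans (ℕₚ.≤-reflexive (sym (Pos-len w p ¬q))) (h (w · gen p))))

  top : Fin N
  top = inv (proj₁ longest)

  top-I : ∀ β → PosR β → I top β
  top-I (x , i) pos = I-from-neg top (x , i) (lin-neg (allFin n) (inv top)
    (λ q _ → subst (λ t → Neg t q) (sym (inv-inv _)) (proj₂ longest q)) (vec (x , i) 𝟙) (pos-vec x i pos 𝟙-NN) (λ j j∉ k → ⊥-elim (j∉ (∈-allFin j))))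

  -- The element with the J-inversions of m and all inversions outside J.
  module Fill (J : List (Fin n)) (m : Fin N) (wm : InW J m) where
    private module T = Par (par J top)
    fill : Fin N
    fill = m · T.right

    fill-in : ∀ β → PosR β → SuppV J (vec β 𝟙) → (I fill β → I m β) × (I m β → I fill β)
    fill-in = comp-I J m T.right wm T.min

    private
      nz-pos : ∀ a → InW J a → ∀ β → PosR β → ∀ j k → j ∉ J → vec β 𝟙 j k ≢ 0ℤ → PosR (a ▸ β)
      nz-pos a wa (x , i) pos j k j∉ nz ng = nz (nn-antisym (pos-vec x i pos 𝟙-NN j k)
        (subst (0ℤ ≤_) (cong -_ (trans (ρ-· a x (α i 𝟙) j k) (InW-vec wa (ρ x (α i 𝟙)) j j∉ k))) (neg-vec (a · x) i ng 𝟙-NN j k)))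

    -- A positive root with a coordinate outside `J` stays positive under the parabolic subgroup, so
    -- after applying `inv m` and `T.left` it is still an inversion of `top`.
    fill-out : ∀ β → PosR β → ∀ j k → j ∉ J → vec β 𝟙 j k ≢ 0ℤ → I fill β
    fill-out β@(x , i) pos j k j∉ nz = subst (λ t → Neg t i) eq (top-I (T.left ▸ (inv m ▸ β)) p2)
      where
      p1 : PosR (inv m ▸ β)
      p1 = nz-pos (inv m) (InW-inv wm) β pos j k j∉ nz
      p2 : PosR (T.left ▸ (inv m ▸ β))
      p2 = nz-pos T.left T.inJ (inv m ▸ β) p1 j k j∉ (λ q → nz (trans (sym (trans (ρ-· (inv m) x (α i 𝟙) j k) (InW-vec (InW-inv wm) (ρ x (α i 𝟙)) j j∉ k))) q))
      eq : inv top · (T.left · (inv m · x)) ≡ inv fill · x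
      eq = trans (cong (λ t → inv t · (T.left · (inv m · x))) T.factor) (trans (inv-·x T.left T.right _)
        (trans (cong (inv T.right ·_) (inv-cancel T.left _)) (sym (inv-·x m T.right x))))

  -- Agreement with the order defined by reflections and length.

  isLen : ∀ w → IsLength C w (len w)
  isLen w = len-word w , λ ws p → subst (λ t → len t ℕ.≤ length ws) p (len-min ws)

  isLen-unique : ∀ w k → IsLength C w k → k ≡ len w
  isLen-unique w k ((ws , l , p) , h) with len-word w
  ... | vs , l' , p' = ℕₚ.≤-antisym (ℕₚ.≤-trans (h vs p') (ℕₚ.≤-reflexive l')) (subst₂ (λ t u → len t ℕ.≤ u) p l (len-min ws))

  shorter→ : ∀ {u v} → ShorterThan C u v → len u ℕ.< len v
  shorter→ {u} {v} (a , b , la , lb , lt) = subst₂ ℕ._<_ (isLen-unique u a la) (isLen-unique v b lb) lt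

  shorter← : ∀ {u v} → len u ℕ.< len v → ShorterThan C u v
  shorter← {u} {v} lt = len u , len v , isLen u , isLen v , lt

  private
    refl-x : ∀ x i → refl-of (x , i) · x ≡ x · gen i
    refl-x x i = trans (assoc _ _ _) (trans (cong ((x · gen i) ·_) (invˡ x)) (idʳ _))

    refl-sq : ∀ x i w → refl-of (x , i) · (refl-of (x , i) · w) ≡ w
    refl-sq x i w = trans (sym (assoc _ _ _)) (trans (cong (_· w) (trans (sym (assoc _ _ _)) (trans (cong (_· inv x) (trans (sym (assoc _ _ _)) (trans (cong (_· gen i) (refl-x x i)) (gen-cancelʳ i x)))) (invʳ x)))) (idˡ w))

    -- Strong exchange: the root is followed through the word up to the letter that makes it
    -- negative. At that point it is the simple root of this letter, and multiplying by the
    -- reflection deletes the letter.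
    delete : ∀ ws x i → ¬ Neg x i → Neg (inv (prodW ws) · x) i → ∃[ vs ] length vs ℕ.< length ws × prodW vs ≡ refl-of (x , i) · prodW ws
    delete [] x i pos ng = ⊥-elim (pos (subst (λ t → Neg t i) (trans (cong (_· x) inv-e) (idˡ x)) ng))
    delete (a ∷ ws) x i pos ng with Neg? (gen a · x) i
    ... | yes q = ws , ℕₚ.≤-refl , sym (trans (sym (assoc _ _ _)) (trans (cong (_· prodW ws) (trans (cong (_· gen a) ra) (gen-involution a))) (idˡ _)))
      where
      ra : refl-of (x , i) ≡ gen a
      ra = cancelʳ x (trans (refl-x x i) (sym (exchange x i a pos q)))
    ... | no ¬q with delete ws (gen a · x) i ¬q (subst (λ t → Neg t i) (I-s a (prodW ws) x) ng)
    ... | vs , lt , p = a ∷ vs , s≤s lt , trans (cong (gen a ·_) p) (trans (sym (assoc _ _ _)) (trans (cong (_· prodW ws) eq) (assoc _ _ _)))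
      where
      eq : gen a · refl-of (gen a · x , i) ≡ refl-of (x , i) · gen a
      eq = cancelʳ (gen a · x) (begin
        (gen a · refl-of (gen a · x , i)) · (gen a · x) ≡⟨ trans (assoc _ _ _) (cong (gen a ·_) (refl-x (gen a · x) i)) ⟩
        gen a · ((gen a · x) · gen i) ≡⟨ trans (cong (gen a ·_) (assoc _ _ _)) (gen-cancelˡ a _) ⟩
        x · gen i ≡⟨ sym (refl-x x i) ⟩
        refl-of (x , i) · x ≡⟨ cong (refl-of (x , i) ·_) (sym (gen-cancelˡ a x)) ⟩
        refl-of (x , i) · (gen a · (gen a · x)) ≡⟨ sym (assoc _ _ _) ⟩
        (refl-of (x , i) · gen a) · (gen a · x) ∎)

  I⇒shorter : ∀ w β → PosR β → I w β → len (refl-of β · w) ℕ.< len w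
  I⇒shorter w (x , i) pos h with len-word w
  ... | ws , l , refl with delete ws x i pos h
  ... | vs , lt , p = ℕₚ.≤-trans (s≤s (subst (λ t → len t ℕ.≤ length vs) p (len-min vs))) (ℕₚ.≤-trans lt (ℕₚ.≤-reflexive l))

  shorter⇒I : ∀ w β → PosR β → len (refl-of β · w) ℕ.< len w → I w β
  shorter⇒I w β@(x , i) pos lt with I? w β
  ... | yes p = p
  ... | no ¬p = ⊥-elim (ℕₚ.<-asym lt (subst (λ t → len t ℕ.< len (t' · w)) (refl-sq x i w) (I⇒shorter (t' · w) β pos
      (subst (λ t → Neg t i) eq (Pos-flip (inv w · x) i ¬p)))))
    where
    t' = refl-of β
    eq : (inv w · x) · gen i ≡ inv (t' · w) · x
    eq = cancelˡ (t' · w) (trans (trans (assoc _ _ _) (cong (t' ·_) (trans (cong (w ·_) (assoc _ _ _)) (cancel-inv w _))))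
      (trans (trans (sym (assoc _ _ _)) (trans (cong (_· gen i) (refl-x x i)) (gen-cancelʳ i x))) (sym (cancel-inv (t' · w) x))))

  posRep : ∀ t → IsReflection C t → ∃[ β ] PosR β × t ≡ refl-of β
  posRep t (x , i , p) with Neg? x i
  ... | no ¬q = (x , i) , ¬q , p
  ... | yes q = cov x i , cov-pos x i q , trans p (sym (refl-cov x i))

  ⊑⇒≤W : ∀ {u v} → u ⊑ v → _≤W_ C u v
  ⊑⇒≤W {u} {v} le t (rt , sh) with posRep t rt
  ... | β , pos , refl = rt , shorter← (I⇒shorter v β pos (le β pos (shorter⇒I u β pos (shorter→ sh))))

  ≤W⇒⊑ : ∀ {u v} → _≤W_ C u v → u ⊑ v
  ≤W⇒⊑ {u} {v} le β@(x , i) pos h = shorter⇒I v β pos (shorter→ (proj₂ (le (refl-of β) ((x , i , refl) , shorter← (I⇒shorter u β pos h)))))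

-- The Euler form and the exceptional sequence of cover roots.

module EulerForm (C : CoxeterSystem) where

  open Representation C
  open Positivity C
  open WeakOrder C
  open import Data.List.Membership.DecPropositional (_≟_ {n}) using (_∈?_)

  -- w is c-sortable, c being the Coxeter element of the parabolic subgroup generated by
  -- the listed letters: reading c c c ⋯, a letter that has been skipped never returns.
  data Sortable : List (Fin n) → Fin N → Set where
    done : Sortable [] e
    take : ∀ {s cs w} → ¬ LD s w → Sortable (cs ∷ʳ s) w → Sortable (s ∷ cs) (gen s · w)
    skip : ∀ {s cs w} → Sortable cs w → Sortable (s ∷ cs) w

  Uniq : List (Fin n) → Set
  Uniq []       = ⊤
  Uniq (s ∷ cs) = s ∉ cs × Uniq cs

  Unique⇒Uniq : ∀ {xs} → Unique xs → Uniq xs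
  Unique⇒Uniq []      = tt
  Unique⇒Uniq (h ∷ u) = (λ m → All.lookup h m refl) , Unique⇒Uniq u

  ∈-snoc : ∀ {q s : Fin n} cs → q ∈ cs ∷ʳ s → q ∈ cs ⊎ q ≡ s
  ∈-snoc cs h with ∈-++⁻ cs h
  ... | inj₁ p = inj₁ p
  ... | inj₂ (here p) = inj₂ p

  snoc-∈ : ∀ {q s : Fin n} cs → q ∈ cs → q ∈ cs ∷ʳ s
  snoc-∈ cs = ∈-++⁺ˡ

  snoc-last : ∀ {s : Fin n} cs → s ∈ cs ∷ʳ s
  snoc-last cs = ∈-++⁺ʳ cs (here refl)

  rot-∈ : ∀ {q s : Fin n} cs → q ∈ cs ∷ʳ s → q ∈ s ∷ cs
  rot-∈ cs h with ∈-snoc cs h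
  ... | inj₁ p = there p
  ... | inj₂ refl = here refl

  unrot-∈ : ∀ {q s : Fin n} cs → q ∈ s ∷ cs → q ∈ cs ∷ʳ s
  unrot-∈ cs (here refl) = snoc-last cs
  unrot-∈ cs (there p) = snoc-∈ cs p

  Uniq-snoc : ∀ {s} cs → Uniq cs → s ∉ cs → Uniq (cs ∷ʳ s)
  Uniq-snoc [] u h = (λ ()) , tt
  Uniq-snoc {s} (q ∷ cs) (q∉ , u) h = (λ p → case (∈-snoc cs p)) , Uniq-snoc cs u (h ∘ there)
    where
    case : q ∈ cs ⊎ q ≡ s → ⊥
    case (inj₁ p) = q∉ p
    case (inj₂ refl) = h (here refl)

  Uniq-rot : ∀ {s} cs → Uniq (s ∷ cs) → Uniq (cs ∷ʳ s)
  Uniq-rot cs (h , u) = Uniq-snoc cs u h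

  InW-mono : ∀ {J K w} → (∀ {q} → q ∈ J → q ∈ K) → InW J w → InW K w
  InW-mono f one = one
  InW-mono f (mul h p) = mul (f h) (InW-mono f p)

  S-InW : ∀ {cs w} → Sortable cs w → InW cs w
  S-InW done = one
  S-InW (take {s} {cs} _ d) = mul (here refl) (InW-mono (rot-∈ cs) (S-InW d))
  S-InW (skip d) = InW-mono there (S-InW d)

  SuppV-mono : ∀ {J K v} → (∀ {q} → q ∈ J → q ∈ K) → SuppV J v → SuppV K v
  SuppV-mono f sp j j∉ = sp j (j∉ ∘ f)

  SuppV-α : ∀ {J} p m → p ∈ J → SuppV J (α p m)
  SuppV-α p m h j j∉ k = α-other p m (λ { refl → j∉ h }) k

  SuppV-root : ∀ {J w} → InW J w → ∀ p m → p ∈ J → SuppV J (ρ w (α p m))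
  SuppV-root ww p m h = SuppV-ρ ww (α p m) (SuppV-α p m h)

  Neg-InW : ∀ {J w} → InW J w → ∀ p → Neg w p → p ∈ J
  Neg-InW {J} {w} ww p ng with p ∈? J
  ... | yes q = q
  ... | no ¬q = ⊥-elim (contra (subst (0ℤ ≤_) (cong -_ (trans (InW-vec ww (α p 𝟙) p ¬q 0) (α-same p 𝟙 0))) (neg-vec w p ng 𝟙-NN p 0)))
    where
    contra : ¬ (0ℤ ≤ - 1ℤ)
    contra ()

  -- The neighbour sum restricted to a list; taken over the letters after `s`, it makes the form `E`
  -- see each edge of the diagram in one direction only.
  lnb : Fin n → List (Fin n) → V → M
  lnb s [] x k = 0ℤ
  lnb s (q ∷ cs) x k = A (ee s q) (x q) k + lnb s cs x k

  lnb-agree : ∀ s cs {x y} → (∀ q → q ∈ cs → ∀ k → x q k ≡ y q k) → ∀ k → lnb s cs x k ≡ lnb s cs y k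
  lnb-agree s [] h k = refl
  lnb-agree s (q ∷ cs) h k = cong₂ _+_ (A-cong (ee s q) (h q (here refl)) k) (lnb-agree s cs (λ q' m → h q' (there m)) k)

  lnb-0 : ∀ s cs {x} → (∀ q → q ∈ cs → ∀ k → x q k ≡ 0ℤ) → ∀ k → lnb s cs x k ≡ 0ℤ
  lnb-0 s [] h k = refl
  lnb-0 s (q ∷ cs) h k = cong₂ _+_ (trans (A-cong (ee s q) (h q (here refl)) k) (A-0 (ee s q) k)) (lnb-0 s cs (λ q' m → h q' (there m)) k)

  lnb-neg : ∀ s cs x k → lnb s cs (⊖ x) k ≡ - lnb s cs x k
  lnb-neg s [] x k = refl
  lnb-neg s (q ∷ cs) x k = trans (cong₂ _+_ (A-neg (ee s q) (x q) k) (lnb-neg s cs x k)) (sym (ℤₚ.neg-distrib-+ (A (ee s q) (x q) k) (lnb s cs x k)))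

  lnb-snoc : ∀ s cs q x k → lnb s (cs ∷ʳ q) x k ≡ lnb s cs x k + A (ee s q) (x q) k
  lnb-snoc s [] q x k = trans (ℤₚ.+-identityʳ (A (ee s q) (x q) k)) (sym (ℤₚ.+-identityˡ (A (ee s q) (x q) k)))
  lnb-snoc s (p ∷ cs) q x k = trans (cong (λ t → A (ee s p) (x p) k + t) (lnb-snoc s cs q x k)) (sym (ℤₚ.+-assoc (A (ee s p) (x p) k) (lnb s cs x k) (A (ee s q) (x q) k)))

  Nb-lnb : ∀ s ds x → Uniq ds → SuppV ds x → ∀ k → Nb s x k ≡ lnb s ds x k
  Nb-lnb s [] x u sp k = trans (Nb-cong s (λ j k → sp j (λ ()) k) k) (∑-0 (λ j → A (ee s j) (λ _ → 0ℤ) k) (λ j → A-0 (ee s j) k))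
  Nb-lnb s (q ∷ ds) x (q∉ , u) sp k = trans (Nb-cong s (zap-split q x) k) (trans (Nb-+ s (α q (x q)) (zap q x) k)
    (cong₂ _+_ (Nb-α s q (x q) k) (trans (Nb-lnb s ds (zap q x) u (zap-supp q ds x sp) k)
      (lnb-agree s ds (λ p p∈ k → zap-other {q} x (λ { refl → q∉ p∈ }) k) k))))

  Nb-tail : ∀ s cs x → Uniq (s ∷ cs) → SuppV (s ∷ cs) x → ∀ k → Nb s x k ≡ lnb s cs x k
  Nb-tail s cs x u sp k = trans (Nb-lnb s (s ∷ cs) x u sp k) (trans (cong (λ t → t + lnb s cs x k) (A-diag s (x s) k)) (ℤₚ.+-identityˡ _))

  -- The Euler form of the Coxeter element given by the list
  module EF (c : ℕ) where
    open Form c public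

    E : List (Fin n) → V → V → ℤ
    E [] x y = 0ℤ
    E (s ∷ cs) x y = (⟨ x s , y s ⟩ + - ⟨ x s , lnb s cs y ⟩) + E cs x y

    E-agree : ∀ cs {x x' y y'} → (∀ q → q ∈ cs → ∀ k → x q k ≡ x' q k) → (∀ q → q ∈ cs → ∀ k → y q k ≡ y' q k) → E cs x y ≡ E cs x' y'
    E-agree [] h h' = refl
    E-agree (s ∷ cs) h h' = cong₂ _+_ (cong₂ (λ u v → u + - v) (pair-cong K (h s (here refl)) (h' s (here refl)))
      (pair-cong K (h s (here refl)) (lnb-agree s cs (λ q m → h' q (there m))))) (E-agree cs (λ q m → h q (there m)) (λ q m → h' q (there m)))

    E-cong : ∀ cs {x x' y y'} → x ≈ x' → y ≈ y' → E cs x y ≡ E cs x' y'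
    E-cong cs p q = E-agree cs (λ i _ → p i) (λ i _ → q i)

    E-0ˡ : ∀ cs {x} y → (∀ q → q ∈ cs → ∀ k → x q k ≡ 0ℤ) → E cs x y ≡ 0ℤ
    E-0ˡ [] y h = refl
    E-0ˡ (s ∷ cs) y h = cong₂ _+_ (cong₂ (λ u v → u + - v) (pair-0ˡ K (y s) (h s (here refl))) (pair-0ˡ K (lnb s cs y) (h s (here refl)))) (E-0ˡ cs y (λ q m → h q (there m)))

    E-0ʳ : ∀ cs x {y} → (∀ q → q ∈ cs → ∀ k → y q k ≡ 0ℤ) → E cs x y ≡ 0ℤ
    E-0ʳ [] x h = refl
    E-0ʳ (s ∷ cs) x h = cong₂ _+_ (cong₂ (λ u v → u + - v) (pair-0ʳ K (x s) (h s (here refl))) (pair-0ʳ K (x s) (lnb-0 s cs (λ q m → h q (there m))))) (E-0ʳ cs x (λ q m → h q (there m)))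

    E-snoc : ∀ cs s x y → E (cs ∷ʳ s) x y ≡ E cs x y + (⟨ x s , y s ⟩ + - ⟨ lnb s cs x , y s ⟩)
    E-snoc [] s x y = trans (ℤₚ.+-identityʳ _) (trans (cong (λ t → ⟨ x s , y s ⟩ + - t) (trans (pair-0ʳ K (x s) (λ _ → refl)) (sym (pair-0ˡ K (y s) (λ _ → refl))))) (sym (ℤₚ.+-identityˡ _)))
    E-snoc (q ∷ cs) s x y = begin
      (⟨ x q , y q ⟩ + - ⟨ x q , lnb q (cs ∷ʳ s) y ⟩) + E (cs ∷ʳ s) x y
        ≡⟨ cong₂ (λ u v → (⟨ x q , y q ⟩ + - u) + v) (trans (pair-cong K {x q} (λ _ → refl) (lnb-snoc q cs s y)) (trans (pair-+ʳ K (x q) (lnb q cs y) (A (ee q s) (y s)))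
            (cong (λ t → ⟨ x q , lnb q cs y ⟩ + t) (sym (A-adj s q (x q) (y s)))))) (E-snoc cs s x y) ⟩
      (⟨ x q , y q ⟩ + - (⟨ x q , lnb q cs y ⟩ + ⟨ A (ee s q) (x q) , y s ⟩)) + (E cs x y + (⟨ x s , y s ⟩ + - ⟨ lnb s cs x , y s ⟩))
        ≡⟨ l ⟨ x q , y q ⟩ ⟨ x q , lnb q cs y ⟩ ⟨ A (ee s q) (x q) , y s ⟩ (E cs x y) ⟨ x s , y s ⟩ ⟨ lnb s cs x , y s ⟩ ⟩
      ((⟨ x q , y q ⟩ + - ⟨ x q , lnb q cs y ⟩) + E cs x y) + (⟨ x s , y s ⟩ + - (⟨ A (ee s q) (x q) , y s ⟩ + ⟨ lnb s cs x , y s ⟩))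
        ≡⟨ cong (λ t → ((⟨ x q , y q ⟩ + - ⟨ x q , lnb q cs y ⟩) + E cs x y) + (⟨ x s , y s ⟩ + - t)) (sym (pair-+ˡ K (A (ee s q) (x q)) (lnb s cs x) (y s))) ⟩
      ((⟨ x q , y q ⟩ + - ⟨ x q , lnb q cs y ⟩) + E cs x y) + (⟨ x s , y s ⟩ + - ⟨ lnb s (q ∷ cs) x , y s ⟩) ∎
      where
      l : ∀ a b c d e f → (a + - (b + c)) + (d + (e + - f)) ≡ ((a + - b) + d) + (e + - (c + f))
      l = solve-∀

    -- The first coordinate of a reflected vector is the sum over its neighbours minus the old
    -- value, so the terms for `s` as a first letter turn into those for `s` as a last letter. This
    -- is the step that matches `take`.
    E-rot : ∀ s cs x y → Uniq (s ∷ cs) → SuppV (s ∷ cs) x → SuppV (s ∷ cs) y → E (s ∷ cs) (r s x) (r s y) ≡ E (cs ∷ʳ s) x y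
    E-rot s cs x y u@(s∉ , _) sx sy = begin
      (⟨ r s x s , r s y s ⟩ + - ⟨ r s x s , lnb s cs (r s y) ⟩) + E cs (r s x) (r s y)
        ≡⟨ cong₂ (λ a b → (a + - b) + E cs (r s x) (r s y))
            (trans (pair-cong K {r s x s} (λ _ → refl) (λ k → trans (r-same s y k) (cong (λ t → t - y s k) (Nb-tail s cs y u sy k))))
              (trans (pair-+ʳ K (r s x s) (lnb s cs y) (λ k → - y s k)) (cong (λ t → ⟨ r s x s , lnb s cs y ⟩ + t) (pair-negʳ K (r s x s) (y s)))))
            (pair-cong K {r s x s} (λ _ → refl) (lnb-agree s cs (off y))) ⟩
      ((⟨ r s x s , lnb s cs y ⟩ + - ⟨ r s x s , y s ⟩) + - ⟨ r s x s , lnb s cs y ⟩) + E cs (r s x) (r s y)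
        ≡⟨ cong₂ (λ a b → ((⟨ r s x s , lnb s cs y ⟩ + - a) + - ⟨ r s x s , lnb s cs y ⟩) + b)
            (trans (pair-cong K {y = y s} (λ k → trans (r-same s x k) (cong (λ t → t - x s k) (Nb-tail s cs x u sx k))) (λ _ → refl))
              (trans (pair-+ˡ K (lnb s cs x) (λ k → - x s k) (y s)) (cong (λ t → ⟨ lnb s cs x , y s ⟩ + t) (pair-negˡ K (x s) (y s)))))
            (E-agree cs (off x) (off y)) ⟩
      ((⟨ r s x s , lnb s cs y ⟩ + - (⟨ lnb s cs x , y s ⟩ + - ⟨ x s , y s ⟩)) + - ⟨ r s x s , lnb s cs y ⟩) + E cs x y
        ≡⟨ l ⟨ r s x s , lnb s cs y ⟩ ⟨ lnb s cs x , y s ⟩ ⟨ x s , y s ⟩ (E cs x y) ⟩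
      E cs x y + (⟨ x s , y s ⟩ + - ⟨ lnb s cs x , y s ⟩) ≡⟨ sym (E-snoc cs s x y) ⟩
      E (cs ∷ʳ s) x y ∎
      where
      off : ∀ z q → q ∈ cs → ∀ k → r s z q k ≡ z q k
      off z q q∈ k = r-other s z (λ { refl → s∉ q∈ }) k
      l : ∀ a b c d → ((a + - (b + - c)) + - a) + d ≡ d + (c + - b)
      l = solve-∀

    private
      α-off : ∀ {s} {cs : List (Fin n)} → s ∉ cs → ∀ m q → q ∈ cs → ∀ k → α s m q k ≡ 0ℤ
      α-off s∉ m q q∈ k = α-other _ m (λ { refl → s∉ q∈ }) k

    -- A first letter is a later neighbour of nothing, so only its own coordinate is seen. This
    -- evaluation and the next two convert statements about `E` into statements about single
    -- coordinates.
    E-simpleʳ : ∀ s cs x m → s ∉ cs → E (s ∷ cs) x (α s m) ≡ ⟨ x s , m ⟩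
    E-simpleʳ s cs x m s∉ = trans (cong₂ _+_ (cong₂ (λ u v → u + - v) (pair-cong K {x s} (λ _ → refl) (α-same s m))
        (pair-0ʳ K (x s) (lnb-0 s cs (α-off s∉ m)))) (E-0ʳ cs x (α-off s∉ m))) (trans (ℤₚ.+-identityʳ _) (ℤₚ.+-identityʳ _))

    E-lastˡ : ∀ s cs m x → s ∉ cs → E (cs ∷ʳ s) (α s m) x ≡ ⟨ m , x s ⟩
    E-lastˡ s cs m x s∉ = trans (E-snoc cs s (α s m) x) (trans (cong₂ _+_ (E-0ˡ cs x (α-off s∉ m))
      (cong₂ (λ u v → u + - v) (pair-cong K {y = x s} (α-same s m) (λ _ → refl)) (pair-0ˡ K (x s) (lnb-0 s cs (α-off s∉ m))))) (trans (ℤₚ.+-identityˡ _) (ℤₚ.+-identityʳ _)))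

    E-firstˡ : ∀ s cs m y → Uniq (s ∷ cs) → SuppV (s ∷ cs) y → E (s ∷ cs) (α s m) y ≡ - ⟨ m , r s y s ⟩
    E-firstˡ s cs m y u@(s∉ , _) sy = trans (cong₂ _+_ (cong₂ (λ a b → a + - b) (pair-cong K {y = y s} (α-same s m) (λ _ → refl)) (pair-cong K {y = lnb s cs y} (α-same s m) (λ _ → refl))) (E-0ˡ cs y (α-off s∉ m)))
      (trans (l ⟨ m , y s ⟩ ⟨ m , lnb s cs y ⟩) (cong -_ (sym (trans (pair-cong K {m} (λ _ → refl) (λ k → trans (r-same s y k) (cong (λ t → t - y s k) (Nb-tail s cs y u sy k))))
        (trans (pair-+ʳ K m (lnb s cs y) (λ k → - y s k)) (cong (λ t → ⟨ m , lnb s cs y ⟩ + t) (pair-negʳ K m (y s))))))))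
      where
      l : ∀ a b → (a + - b) + 0ℤ ≡ - (b + - a)
      l = solve-∀

    E-skip : ∀ s cs x y → (∀ k → x s k ≡ 0ℤ) → E (s ∷ cs) x y ≡ E cs x y
    E-skip s cs x y h = trans (cong (λ t → t + E cs x y) (cong₂ (λ u v → u + - v) (pair-0ˡ K (y s) h) (pair-0ˡ K (lnb s cs y) h))) (ℤₚ.+-identityˡ _)

    E-+ˡ : ∀ cs x y z → E cs (x ⊕ y) z ≡ E cs x z + E cs y z
    E-+ˡ [] x y z = refl
    E-+ˡ (s ∷ cs) x y z = trans (cong₂ _+_ (cong₂ (λ u v → u + - v) (pair-+ˡ K (x s) (y s) (z s)) (pair-+ˡ K (x s) (y s) (lnb s cs z))) (E-+ˡ cs x y z))
      (l ⟨ x s , z s ⟩ ⟨ y s , z s ⟩ ⟨ x s , lnb s cs z ⟩ ⟨ y s , lnb s cs z ⟩ (E cs x z) (E cs y z))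
      where
      l : ∀ a b c d e f → ((a + b) + - (c + d)) + (e + f) ≡ ((a + - c) + e) + ((b + - d) + f)
      l = solve-∀

    E-negʳ : ∀ cs x y → E cs x (⊖ y) ≡ - E cs x y
    E-negʳ [] x y = refl
    E-negʳ (s ∷ cs) x y = trans (cong₂ _+_ (cong₂ (λ u v → u + - v) (pair-negʳ K (x s) (y s))
        (trans (pair-cong K {x s} (λ _ → refl) (lnb-neg s cs y)) (pair-negʳ K (x s) (lnb s cs y)))) (E-negʳ cs x y))
      (l ⟨ x s , y s ⟩ ⟨ x s , lnb s cs y ⟩ (E cs x y))
      where
      l : ∀ a b c → (- a + - - b) + - c ≡ - ((a + - b) + c)
      l = solve-∀

    E-negˡ : ∀ cs x y → E cs (⊖ x) y ≡ - E cs x y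
    E-negˡ [] x y = refl
    E-negˡ (s ∷ cs) x y = trans (cong₂ _+_ (cong₂ (λ u v → u + - v) (pair-negˡ K (x s) (y s)) (pair-negˡ K (x s) (lnb s cs y))) (E-negˡ cs x y))
      (l ⟨ x s , y s ⟩ ⟨ x s , lnb s cs y ⟩ (E cs x y))
      where
      l : ∀ a b c → (- a + - - b) + - c ≡ - ((a + - b) + c)
      l = solve-∀

  E : ℕ → List (Fin n) → V → V → ℤ
  E c = EF.E c

  pairing : ℕ → M → M → ℤ
  pairing c = EF.⟨_,_⟩ c

  conj-inv : ∀ g i j → gen j · g ≡ g · gen i → gen i · inv g ≡ inv g · gen j
  conj-inv g i j eq = cancelˡ g (begin
    g · (gen i · inv g) ≡⟨ sym (assoc _ _ _) ⟩
    (g · gen i) · inv g ≡⟨ cong (_· inv g) (sym eq) ⟩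
    (gen j · g) · inv g ≡⟨ trans (assoc _ _ _) (trans (cong (gen j ·_) (invʳ g)) (idʳ _)) ⟩
    gen j ≡⟨ sym (cancel-inv g (gen j)) ⟩
    g · (inv g · gen j) ∎)

  -- The scalar map of `g` is onto: the preimage `ψ` of `δ k` is the scalar of `inv g`. Pairing with
  -- `δ k` beyond the cut then reads off `v k`.
  nondeg : ∀ g i j → gen j · g ≡ g · gen i → ∀ v → (∀ c m → pairing c (λ k → ρ g (α i m) j k) v ≡ 0ℤ) → ∀ k → v k ≡ 0ℤ
  nondeg g i j eq v h k = trans (sym (pair-δ (cut k) k v (cut-big k))) (trans (sym (pair-cong (cut k) {y = v} φψ (λ _ → refl))) (h k ψ))
    where
    ψ : M
    ψ l = ρ (inv g) (α j (δ k)) i l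
    φψ : ∀ l → ρ g (α i ψ) j l ≡ δ k l
    φψ l = begin
      ρ g (α i ψ) j l ≡⟨ sym (ρ-cong g (conj-supp (inv g) j i (conj-inv g i j eq) (δ k)) j l) ⟩
      ρ g (ρ (inv g) (α j (δ k))) j l ≡⟨ sym (ρ-· g (inv g) (α j (δ k)) j l) ⟩
      ρ (g · inv g) (α j (δ k)) j l ≡⟨ cong (λ t → ρ t (α j (δ k)) j l) (invʳ g) ⟩
      ρ e (α j (δ k)) j l ≡⟨ ρ-e (α j (δ k)) j l ⟩
      α j (δ k) j l ≡⟨ α-same j (δ k) l ⟩
      δ k l ∎

  -- Expanding along the letters `t` of `w`, the displacement of α_p is the sum of the images of α_t
  -- under the preceding prefixes, with nonnegative coefficients `A (ee t p) m`. Additivity of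
  -- lengths makes all these images positive.
  displacement-NN : ∀ {cs w} → Sortable cs w → ∀ u p → p ∉ cs → len (u · w) ≡ len u ℕ.+ len w → ∀ {m} → NN m → NNV (ρ u (ρ w (α p m) ⊕ ⊖ α p m))
  displacement-NN done u p p∉ l {m} hm = NNV-≈ (≈-sym (≈-trans (ρ-cong u (λ i k → trans (cong (λ t → t + - α p m i k) (ρ-e (α p m) i k)) (ℤₚ.+-inverseʳ (α p m i k)))) (ρ-0 u))) (λ i k → ℤₚ.≤-refl)
  displacement-NN (skip d) u p p∉ l hm = displacement-NN d u p (p∉ ∘ there) l hm
  displacement-NN (take {t} {cs} {w} ¬ld d) u p p∉ l {m} hm = NNV-≈ (≈-sym (≈-trans (ρ-cong u eq) (ρ-⊕ u (α t (A (ee t p) m)) (r t D))))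
      (λ i k → +-NN (pos-vec u t ¬ng (A-NN (ee t p) hm) i k) (subst (0ℤ ≤_) (ρ-last u t D i k) (displacement-NN d (u · gen t) p p∉' l' hm i k)))
    where
    D = ρ w (α p m) ⊕ ⊖ α p m
    p∉' : p ∉ cs ∷ʳ t
    p∉' h = p∉ (rot-∈ cs h)
    lt : len (gen t · w) ≡ suc (len w)
    lt = len-add t w ¬ld
    big : suc (len u) ℕ.≤ len (u · gen t)
    big = ℕₚ.+-cancelʳ-≤ (len w) (suc (len u)) (len (u · gen t)) (ℕₚ.≤-trans (ℕₚ.≤-reflexive (trans (sym (ℕₚ.+-suc (len u) (len w))) (trans (cong (len u ℕ.+_) (sym lt)) (trans (sym l) (cong len (sym (assoc u (gen t) w)))))))
      (len-·≤ (u · gen t) w))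
    ¬ng : ¬ Neg u t
    ¬ng h = ℕₚ.<-asym h big
    l' : len ((u · gen t) · w) ≡ len (u · gen t) ℕ.+ len w
    l' = trans (cong len (assoc u (gen t) w)) (trans l (trans (cong (len u ℕ.+_) lt) (trans (ℕₚ.+-suc (len u) (len w)) (cong (ℕ._+ len w) (sym (Pos-len u t ¬ng))))))
    eq : ρ (gen t · w) (α p m) ⊕ ⊖ α p m ≈ α t (A (ee t p) m) ⊕ r t D
    eq i k = begin
      ρ (gen t · w) (α p m) i k + - α p m i k ≡⟨ cong (λ z → z + - α p m i k) (ρ-first t w (α p m) i k) ⟩
      r t (ρ w (α p m)) i k + - α p m i k ≡⟨ cong (λ z → z + - α p m i k) (r-cong t (λ j l → l1 (ρ w (α p m) j l) (α p m j l)) i k) ⟩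
      r t (D ⊕ α p m) i k + - α p m i k ≡⟨ cong (λ z → z + - α p m i k) (trans (r-+ t D (α p m) i k) (cong (λ z → r t D i k + z) (r-α-other t p m (λ { refl → p∉ (here refl) }) i k))) ⟩
      (r t D i k + (α p m i k + α t (A (ee t p) m) i k)) + - α p m i k ≡⟨ l2 (r t D i k) (α p m i k) (α t (A (ee t p) m) i k) ⟩
      α t (A (ee t p) m) i k + r t D i k ∎
      where
      l1 : ∀ a b → a ≡ (a + - b) + b
      l1 = solve-∀
      l2 : ∀ a b c → (a + (b + c)) + - b ≡ c + a
      l2 = solve-∀

  -- When p is skipped for the first time, the remaining group element fixes α p.
  Fix : ∀ {cs w} → Sortable cs w → Fin n → Set
  Fix done p = ⊤
  Fix (take _ d) p = Fix d p
  Fix (skip {s} {cs} {w} d) p = (p ≡ s × (∀ m → ρ w (α s m) ≈ α s m)) ⊎ (p ≢ s × Fix d p)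

  fix-ext : ∀ w p → (∀ m → NN m → ρ w (α p m) ≈ α p m) → ∀ m → ρ w (α p m) ≈ α p m
  fix-ext w p h m = ≈-trans (ρ-cong w sp) (≈-trans (ρ-⊕ w _ _) (≈-trans (⊕-cong (h (absM m) (absM-NN m)) (≈-trans (ρ-⊖ w _) (⊖-cong (h (defM m) (defM-NN m))))) (≈-sym sp)))
    where
    sp : α p m ≈ α p (absM m) ⊕ ⊖ α p (defM m)
    sp = ≈-trans (α-cong p (splitM m)) (≈-trans (α-+ p (absM m) (λ k → - defM m k)) (⊕-cong {α p (absM m)} ≈-refl (α-neg p (defM m))))

  -- Write v = u · w with v α_p a multiple of α_s. At the first skip of p the vector
  -- u (w α_p - α_p) is nonnegative, and its s-coefficient pairs to zero with every multiple
  -- arising in this way, so it vanishes; the other coefficients are those of - u α_p.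
  simple⇒Fix : ∀ {cs w} (d : Sortable cs w) u s p → Uniq cs → p ∈ cs → gen s · (u · w) ≡ (u · w) · gen p → ¬ Neg (u · w) p →
    (∀ c m x → SuppV cs x → E c cs (ρ w (α p m)) x ≡ pairing c (λ k → ρ (u · w) (α p m) s k) (λ k → ρ u x s k)) →
    len (u · w) ≡ len u ℕ.+ len w → Fix d p
  simple⇒Fix (take {t} {cs} {w} ¬ld d) u s p uq p∈ hφ pos hE l = simple⇒Fix d (u · gen t) s p (Uniq-rot cs uq) (unrot-∈ cs p∈)
      (subst (λ z → gen s · z ≡ z · gen p) (sym (assoc _ _ _)) hφ) (subst (λ z → ¬ Neg z p) (sym (assoc _ _ _)) pos) hE' l'
    where
    hE' : ∀ c m x → SuppV (cs ∷ʳ t) x → E c (cs ∷ʳ t) (ρ w (α p m)) x ≡ pairing c (λ k → ρ ((u · gen t) · w) (α p m) s k) (λ k → ρ (u · gen t) x s k)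
    hE' c m x sx = begin
      E c (cs ∷ʳ t) (ρ w (α p m)) x ≡⟨ sym (EF.E-rot c t cs (ρ w (α p m)) x uq (SuppV-mono {v = ρ w (α p m)} (rot-∈ cs) (SuppV-root (S-InW d) p m (unrot-∈ cs p∈))) sx') ⟩
      E c (t ∷ cs) (r t (ρ w (α p m))) (r t x) ≡⟨ EF.E-cong c (t ∷ cs) (≈-sym (ρ-first t w (α p m))) (≈-refl {r t x}) ⟩
      E c (t ∷ cs) (ρ (gen t · w) (α p m)) (r t x) ≡⟨ hE c m (r t x) (λ j j∉ k → trans (r-other t x (λ { refl → j∉ (here refl) }) k) (sx' j j∉ k)) ⟩
      pairing c (λ k → ρ (u · (gen t · w)) (α p m) s k) (λ k → ρ u (r t x) s k) ≡⟨ pair-cong (cut c) (λ k → cong (λ z → ρ z (α p m) s k) (sym (assoc _ _ _))) (λ k → sym (ρ-last u t x s k)) ⟩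
      pairing c (λ k → ρ ((u · gen t) · w) (α p m) s k) (λ k → ρ (u · gen t) x s k) ∎
      where
      sx' : SuppV (t ∷ cs) x
      sx' = SuppV-mono {v = x} (rot-∈ cs) sx
    lt : len (gen t · w) ≡ suc (len w)
    lt = len-add t w ¬ld
    l' : len ((u · gen t) · w) ≡ len (u · gen t) ℕ.+ len w
    l' = ℕₚ.≤-antisym (len-·≤ (u · gen t) w) (ℕₚ.≤-trans (ℕₚ.+-monoˡ-≤ (len w) (len-sʳ t u))
      (ℕₚ.≤-reflexive (trans (sym (ℕₚ.+-suc (len u) (len w))) (trans (cong (len u ℕ.+_) (sym lt)) (trans (sym l) (cong len (sym (assoc _ _ _))))))))
  simple⇒Fix (skip {t} {cs} {w} d) u s p uq p∈ hφ pos hE l with p ≟ t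
  ... | no p≢t = inj₂ (p≢t , simple⇒Fix d u s p (proj₂ uq) (tl p∈) hφ pos
        (λ c m x sx → trans (sym (EF.E-skip c t cs (ρ w (α p m)) x (λ k → trans (InW-vec (S-InW d) (α p m) t (proj₁ uq) k) (α-other p m p≢t k)))) (hE c m x (SuppV-mono {v = x} there sx))) l)
    where
    tl : p ∈ t ∷ cs → p ∈ cs
    tl (here q) = ⊥-elim (p≢t q)
    tl (there q) = q
  ... | yes refl = inj₁ (refl , fix-ext w p fixes)
    where
    φ : M → M
    φ m k = ρ (u · w) (α p m) s k
    supp : ∀ m → ρ (u · w) (α p m) ≈ α s (φ m)
    supp = conj-supp (u · w) p s hφ
    p∉ : p ∉ cs
    p∉ = proj₁ uq
    ortho : ∀ c m m' → pairing c (φ m) (λ k → φ m' k + - ρ u (α p m') s k) ≡ 0ℤ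
    ortho c m m' = trans (pair-+ʳ (cut c) (φ m) (φ m') (λ k → - ρ u (α p m') s k)) (trans (cong₂ _+_ (EF.isometry c (u · w) p s φ supp m m')
      (trans (pair-negʳ (cut c) (φ m) (λ k → ρ u (α p m') s k)) (cong -_ (trans (sym (hE c m (α p m') (SuppV-α p m' (here refl))))
        (trans (EF.E-simpleʳ c p cs (ρ w (α p m)) m' p∉) (pair-cong (cut c) {y = m'} (λ k → trans (InW-vec (S-InW d) (α p m) p p∉ k) (α-same p m k)) (λ _ → refl))))))) (ℤₚ.+-inverseʳ (pairing c m m')))
    sEq : ∀ m' k → φ m' k + - ρ u (α p m') s k ≡ 0ℤ
    sEq m' = nondeg (u · w) p s hφ (λ k → φ m' k + - ρ u (α p m') s k) (λ c m → ortho c m m')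
    uD : ∀ m → ρ u (ρ w (α p m) ⊕ ⊖ α p m) ≈ α s (φ m) ⊕ ⊖ ρ u (α p m)
    uD m = ≈-trans (ρ-⊕ u _ _) (⊕-cong (≈-trans (≈-sym (ρ-· u w (α p m))) (supp m)) (ρ-⊖ u (α p m)))
    ¬ng : ¬ Neg u p
    ¬ng ng = root-nz (u · w) p (≈-trans (supp 𝟙) (≈-trans (α-cong s z) (α-0 s)))
      where
      z : ∀ k → φ 𝟙 k ≡ 0ℤ
      z k = nn-antisym (pos-vec (u · w) p pos 𝟙-NN s k) (subst (λ t → 0ℤ ≤ - t) (eqz (sEq 𝟙 k)) (neg-vec u p ng 𝟙-NN s k))
        where
        eqz : ∀ {a b} → a + - b ≡ 0ℤ → b ≡ a
        eqz {a} {b} q = sym (ℤₚ.i-j≡0⇒i≡j a b q)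
    fixes : ∀ m → NN m → ρ w (α p m) ≈ α p m
    fixes m hm i k = ℤₚ.i-j≡0⇒i≡j (ρ w (α p m) i k) (α p m i k) (ρ-inj0 u (ρ w (α p m) ⊕ ⊖ α p m) zero' i k)
      where
      zero' : ρ u (ρ w (α p m) ⊕ ⊖ α p m) ≈ 0V
      zero' = ≈-trans (uD m) (updCase (λ j → ∀ k → α s (φ m) j k + - ρ u (α p m) j k ≡ 0ℤ)
        (λ k → trans (cong (λ t → t + - ρ u (α p m) s k) (α-same s (φ m) k)) (sEq m k))
        (λ j s≢j k → let v = ρ u (α p m) j k
                         eqv : ρ u (ρ w (α p m) ⊕ ⊖ α p m) j k ≡ - v
                         eqv = trans (uD m j k) (trans (cong (λ t → t + - v) (α-other s (φ m) s≢j k)) (ℤₚ.+-identityˡ _))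
                     in trans (cong (λ t → t + - v) (α-other s (φ m) s≢j k)) (trans (ℤₚ.+-identityˡ _)
                          (cong -_ (nn-antisym (pos-vec u p ¬ng hm j k) (subst (0ℤ ≤_) eqv (displacement-NN d u p p∉ l hm j k)))))))

  -- Letters are removed until `p` stops being a descent. At that moment the remaining element sends
  -- α_p to a multiple of the letter `t` just removed; `t` is now last, so `E` with this root on the
  -- left is a `t`-coordinate, which is the hypothesis `hE`.
  descent⇒Fix : ∀ {cs w} (d : Sortable cs w) p → Uniq cs → Neg w p → Fix d p
  descent⇒Fix done p uq ng = tt
  descent⇒Fix (skip {t} d) p uq ng = inj₂ ((λ { refl → proj₁ uq (Neg-InW (S-InW d) p ng) }) , descent⇒Fix d p (proj₂ uq) ng)
  descent⇒Fix (take {t} {cs} {w} ¬ld d) p uq ng with Neg? w p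
  ... | yes q = descent⇒Fix d p (Uniq-rot cs uq) q
  ... | no ¬q = simple⇒Fix d e t p (Uniq-rot cs uq) (unrot-∈ cs (Neg-InW (S-InW (take ¬ld d)) p ng))
        (subst (λ z → gen t · z ≡ z · gen p) (sym (idˡ w)) ex) (subst (λ z → ¬ Neg z p) (sym (idˡ w)) ¬q) hE
        (trans (cong len (idˡ w)) (cong (ℕ._+ len w) (sym len-e)))
    where
    ex : gen t · w ≡ w · gen p
    ex = exchange w p t ¬q ng
    hE : ∀ c m x → SuppV (cs ∷ʳ t) x → E c (cs ∷ʳ t) (ρ w (α p m)) x ≡ pairing c (λ k → ρ (e · w) (α p m) t k) (λ k → ρ e x t k)
    hE c m x sx = trans (EF.E-cong c (cs ∷ʳ t) (conj-supp w p t ex m) (≈-refl {x})) (trans (EF.E-lastˡ c t cs (λ k → ρ w (α p m) t k) x (proj₁ uq))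
      (pair-cong (cut c) (λ k → cong (λ z → ρ z (α p m) t k) (sym (idˡ w))) (λ k → sym (ρ-e x t k))))

  E-take : ∀ {t cs w} → Sortable (cs ∷ʳ t) w → Uniq (t ∷ cs) → ∀ c p q m m' → p ∈ t ∷ cs → q ∈ t ∷ cs →
    E c (t ∷ cs) (ρ (gen t · w) (α p m)) (ρ (gen t · w) (α q m')) ≡ E c (cs ∷ʳ t) (ρ w (α p m)) (ρ w (α q m'))
  E-take {t} {cs} {w} d uq c p q m m' p∈ q∈ = trans (EF.E-cong c (t ∷ cs) (ρ-first t w (α p m)) (ρ-first t w (α q m'))) (EF.E-rot c t cs (ρ w (α p m)) (ρ w (α q m')) uq
    (SuppV-mono {v = ρ w (α p m)} (rot-∈ cs) (SuppV-root (S-InW d) p m (unrot-∈ cs p∈))) (SuppV-mono {v = ρ w (α q m')} (rot-∈ cs) (SuppV-root (S-InW d) q m' (unrot-∈ cs q∈))))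

  -- If p is skipped first, then w α_p = α_p is simple and E(·, α_p) reads off the
  -- p-coefficient, which vanishes on the root of q.
  fixed-exceptional : ∀ {cs w} (d : Sortable cs w) p q → Uniq cs → p ∈ cs → q ∈ cs → p ≢ q → Fix d p → Fix d q →
    (∀ c m m' → E c cs (ρ w (α p m)) (ρ w (α q m')) ≡ 0ℤ) ⊎ (∀ c m m' → E c cs (ρ w (α q m)) (ρ w (α p m')) ≡ 0ℤ)
  fixed-exceptional (take {t} {cs} {w} ¬ld d) p q uq p∈ q∈ p≢q fp fq with fixed-exceptional d p q (Uniq-rot cs uq) (unrot-∈ cs p∈) (unrot-∈ cs q∈) p≢q fp fq
  ... | inj₁ h = inj₁ (λ c m m' → trans (E-take d uq c p q m m' p∈ q∈) (h c m m'))
  ... | inj₂ h = inj₂ (λ c m m' → trans (E-take d uq c q p m m' q∈ p∈) (h c m m'))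
  fixed-exceptional {w = w} (skip {t} {cs} d) p q uq p∈ q∈ p≢q (inj₁ (refl , fx)) fq = inj₂ λ c m m' → trans (EF.E-cong c (t ∷ cs) (≈-refl {ρ w (α q m)}) (fx m')) (trans (EF.E-simpleʳ c t cs (ρ w (α q m)) m' (proj₁ uq))
    (pair-0ˡ (cut c) m' (λ k → trans (InW-vec (S-InW d) (α q m) t (proj₁ uq) k) (α-other q m (p≢q ∘ sym) k))))
  fixed-exceptional {w = w} (skip {t} {cs} d) p q uq p∈ q∈ p≢q (inj₂ _) (inj₁ (refl , fx)) = inj₁ λ c m m' → trans (EF.E-cong c (t ∷ cs) (≈-refl {ρ w (α p m)}) (fx m')) (trans (EF.E-simpleʳ c t cs (ρ w (α p m)) m' (proj₁ uq))
    (pair-0ˡ (cut c) m' (λ k → trans (InW-vec (S-InW d) (α p m) t (proj₁ uq) k) (α-other p m p≢q k))))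
  fixed-exceptional {w = w} (skip {t} {cs} d) p q uq p∈ q∈ p≢q (inj₂ (p≢t , fp)) (inj₂ (q≢t , fq)) with fixed-exceptional d p q (proj₂ uq) (tl p≢t p∈) (tl q≢t q∈) p≢q fp fq
    where
    tl : ∀ {p} → p ≢ t → p ∈ t ∷ cs → p ∈ cs
    tl h (here q) = ⊥-elim (h q)
    tl h (there q) = q
  ... | inj₁ h = inj₁ (λ c m m' → trans (EF.E-skip c t cs (ρ w (α p m)) (ρ w (α q m')) (λ k → trans (InW-vec (S-InW d) (α p m) t (proj₁ uq) k) (α-other p m p≢t k))) (h c m m'))
  ... | inj₂ h = inj₂ (λ c m m' → trans (EF.E-skip c t cs (ρ w (α q m)) (ρ w (α p m')) (λ k → trans (InW-vec (S-InW d) (α q m) t (proj₁ uq) k) (α-other q m q≢t k))) (h c m m'))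

  covers-exceptional : ∀ {cs w} → Sortable cs w → Uniq cs → ∀ p q → p ≢ q → Neg w p → Neg w q →
    (∀ c m m' → E c cs (ρ w (α p m)) (ρ w (α q m')) ≡ 0ℤ) ⊎ (∀ c m m' → E c cs (ρ w (α q m)) (ρ w (α p m')) ≡ 0ℤ)
  covers-exceptional d uq p q p≢q np nq = fixed-exceptional d p q uq (Neg-InW (S-InW d) p np) (Neg-InW (S-InW d) q nq) p≢q (descent⇒Fix d p uq np) (descent⇒Fix d q uq nq)

  -- If E(β_p, β_q) vanishes, it reads off the coordinate directly. Otherwise E(β_q, β_p) vanishes,
  -- which kills the `s`-coordinate of the reflected root `gen s · z` α_p. This root equals z α_p
  -- plus a nonnegative multiple of z α_q, and both have nonpositive coordinates, so both
  -- coordinates vanish.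
  cover-supp : ∀ {s cs z} → Sortable (s ∷ cs) z → Uniq (s ∷ cs) → ∀ q → Neg z q → gen s · z ≡ z · gen q → ∀ p → p ≢ q → Neg z p → ∀ m k → ρ z (α p m) s k ≡ 0ℤ
  cover-supp {s} {cs} {z} d uq q nq eq p p≢q np = go (covers-exceptional d uq p q p≢q np nq)
    where
    θ : M → M
    θ m k = ρ z (α q m) s k
    supp : ∀ m → ρ z (α q m) ≈ α s (θ m)
    supp = conj-supp z q s eq
    go : _ → ∀ m k → ρ z (α p m) s k ≡ 0ℤ
    go (inj₁ h) m = nondeg z q s eq (λ k → ρ z (α p m) s k) (λ c m' → trans (pair-comm (cut c) (θ m') (λ k → ρ z (α p m) s k))
      (trans (sym (EF.E-simpleʳ c s cs (ρ z (α p m)) (θ m') (proj₁ uq))) (trans (EF.E-cong c (s ∷ cs) (≈-refl {ρ z (α p m)}) (≈-sym (supp m'))) (h c m m'))))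
    go (inj₂ h) = linear-ext z p s λ m hm k → nn-antisym (lower m hm k) (neg-vec z p np hm s k)
      where
      flip : ∀ m k → r s (ρ z (α p m)) s k ≡ 0ℤ
      flip m = nondeg z q s eq (λ k → r s (ρ z (α p m)) s k) (λ c m' → neg0 (trans (sym (EF.E-firstˡ c s cs (θ m') (ρ z (α p m)) uq (SuppV-root (S-InW d) p m (Neg-InW (S-InW d) p np))))
        (trans (EF.E-cong c (s ∷ cs) (≈-sym (supp m')) (≈-refl {ρ z (α p m)})) (h c m' m))))
        where
        neg0 : ∀ {u} → - u ≡ 0ℤ → u ≡ 0ℤ
        neg0 {u} q = trans (sym (ℤₚ.neg-involutive u)) (cong -_ q)
      sum0 : ∀ m k → ρ z (α p m) s k + θ (A (ee q p) m) k ≡ 0ℤ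
      sum0 m k = trans (sym (begin
        r s (ρ z (α p m)) s k ≡⟨ sym (ρ-first s z (α p m) s k) ⟩
        ρ (gen s · z) (α p m) s k ≡⟨ cong (λ t → ρ t (α p m) s k) eq ⟩
        ρ (z · gen q) (α p m) s k ≡⟨ ρ-last z q (α p m) s k ⟩
        ρ z (r q (α p m)) s k ≡⟨ ρ-cong z (r-α-other q p m p≢q) s k ⟩
        ρ z (α p m ⊕ α q (A (ee q p) m)) s k ≡⟨ ρ-⊕ z (α p m) (α q (A (ee q p) m)) s k ⟩
        ρ z (α p m) s k + θ (A (ee q p) m) k ∎)) (flip m k)
      lower : ∀ m → NN m → ∀ k → 0ℤ ≤ ρ z (α p m) s k
      lower m hm k = subst (0ℤ ≤_) (sym (l (ρ z (α p m) s k) (θ (A (ee q p) m) k) (sum0 m k))) (neg-vec z q nq (A-NN (ee q p) hm) s k)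
        where
        l : ∀ a b → a + b ≡ 0ℤ → a ≡ - b
        l a b h = trans (l' a b) (trans (cong (λ t → t + - b) h) (ℤₚ.+-identityˡ _))
          where
          l' : ∀ a b → a ≡ (a + b) + - b
          l' = solve-∀

-- Lower covers in the Cambrian lattice and restriction to parabolic subgroups.

module CambrianCovers (C : CoxeterSystem) where

  open Representation C
  open Positivity C
  open WeakOrder C
  open EulerForm C

  data Rem (l : Fin n) : List (Fin n) → List (Fin n) → Set where
    rh : ∀ {cs} → Rem l (l ∷ cs) cs
    rt : ∀ {q cs ds} → Rem l cs ds → Rem l (q ∷ cs) (q ∷ ds)

  Rem-snoc : ∀ {l cs ds} q → Rem l cs ds → Rem l (cs ∷ʳ q) (ds ∷ʳ q)
  Rem-snoc q rh = rh
  Rem-snoc q (rt h) = rt (Rem-snoc q h)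

  Rem-last : ∀ s cs → Rem s (cs ∷ʳ s) cs
  Rem-last s [] = rh
  Rem-last s (q ∷ cs) = rt (Rem-last s cs)

  cov-vec : ∀ z p m → vec (cov z p) m ≈ ⊖ ρ z (α p m)
  cov-vec z p m = ≈-trans (ρ-last z p (α p m)) (≈-trans (ρ-cong z (r-α-same p m)) (ρ-⊖ z (α p m)))

  cov-simple : ∀ s z q → gen s · z ≡ z · gen q → refl-of (cov z q) ≡ refl-of (e , s)
  cov-simple s z q eq = trans (refl-cov z q) (trans (cong (_· inv z) (sym eq)) (trans (trans (assoc _ _ _) (trans (cong (gen s ·_) (invʳ z)) (idʳ _)))
    (sym (trans (cong₂ _·_ (idˡ _) inv-e) (idʳ _)))))

  vec-pos : ∀ β → PosR β → ∀ {m} → NN m → NNV (vec β m)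
  vec-pos (x , i) pos = pos-vec x i pos

  vec-nz : ∀ β → ¬ (vec β 𝟙 ≈ 0V)
  vec-nz (x , i) = root-nz x i

  supp-not-simple : ∀ {s cs} → s ∉ cs → ∀ β → PosR β → refl-of β ≡ refl-of (e , s) → ¬ SuppV cs (vec β 𝟙)
  supp-not-simple {s} {cs} s∉ β pos eq sp with same-vec β (e , s) eq pos (simple-pos s)
  ... | φ , _ , hv = vec-nz β (≈-trans v (≈-trans (α-cong s z) (α-0 s)))
    where
    v : vec β 𝟙 ≈ α s (φ 𝟙)
    v = ≈-trans (hv 𝟙) (ρ-e (α s (φ 𝟙)))
    z : ∀ k → φ 𝟙 k ≡ 0ℤ
    z k = trans (sym (α-same s (φ 𝟙) k)) (trans (sym (v s k)) (sp s s∉ k))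

  ¬LD-InW : ∀ {s cs z} → s ∉ cs → InW cs z → ¬ LD s z
  ¬LD-InW {s} {cs} {z} s∉ wz h = supp-not-simple s∉ (e , s) (simple-pos s) refl (InvSupp wz (e , s) (simple-pos s) (LD-I {s} {z} h) 𝟙)

  supp-tail : ∀ {s cs v} → SuppV (s ∷ cs) v → (∀ k → v s k ≡ 0ℤ) → SuppV cs v
  supp-tail {s} {cs} {v} sp h j j∉ k with s ≟ j
  ... | yes refl = h k
  ... | no s≢j = sp j (λ { (here q) → s≢j (sym q) ; (there m) → j∉ m }) k

  ⊑-NegW : ∀ {s z p} → Neg z p → ¬ LD s z → ¬ LD s (z · gen p)
  ⊑-NegW {s} {z} {p} ng h h' = h (LD-⊑ {s} {z · gen p} {z} (cov-⊑ z p ng) h')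

  cov-s : ∀ s w p → gen s ▸ cov (gen s · w) p ≡ cov w p
  cov-s s w p = cong (_, p) (trans (cong (gen s ·_) (assoc _ _ _)) (gen-cancelˡ s _))

  -- Together with `InvSupp` the fields say that the inversions of `k` are exactly those of `z`
  -- supported on `ds`; the content is that this parabolic part is again sortable.
  record Restr (ds : List (Fin n)) (z : Fin N) : Set where
    field
      k    : Fin N
      srt  : Sortable ds k
      le   : k ⊑ z
      full : ∀ β → PosR β → I z β → SuppV ds (vec β 𝟙) → I k β

  -- y is the cover of z in the Cambrian lattice that lies below z · gen p. In the
  -- dictionary with torsion classes, H and U say that y consists of the modules in z
  -- without nonzero maps to the brick labelling z · gen p ⋖ z.
  record Lower (cs : List (Fin n)) (z : Fin N) (p : Fin n) : Set where
    field
      y      : Fin N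
      srt    : Sortable cs y
      below  : y ⊑ z · gen p
      others : ∀ q → q ≢ p → Neg z q → I y (cov z q)
      -- The element `x` need not be sortable. This freedom is used with the auxiliary element
      -- `fill`.
      mub    : ∀ x → y ⊑ x → I x (cov z p) → z ⊑ x
      H      : ∀ β → PosR β → I y β → ∀ c m m' → NN m → NN m' → E c cs (vec β m) (vec (cov z p) m') ≤ 0ℤ
      U      : ∀ β → PosR β → I z β → (∀ c m m' → NN m → NN m' → E c cs (vec β m) (vec (cov z p) m') ≤ 0ℤ) → I y β

  -- By `E-rot` the conditions `H` and `U` carry over to all roots except α_s. For α_s the form is
  -- minus the `s`-coordinate of the reflected cover root, which is a cover root of `w` and hence
  -- positive.
  module Take (s : Fin n) (cs : List (Fin n)) (w : Fin N) (¬ld : ¬ LD s w) (uq : Uniq (s ∷ cs)) (ww : InW (cs ∷ʳ s) w)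
    (p : Fin n) (np : Neg w p) (L : Lower (cs ∷ʳ s) w p) where
    private
      module L = Lower L
      z = gen s · w
      y' = L.y
      y'⊑w : y' ⊑ w
      y'⊑w = ⊑-trans {y'} {w · gen p} {w} L.below (cov-⊑ w p np)
      ¬ldy : ¬ LD s y'
      ¬ldy h = ¬ld (LD-⊑ {s} {y'} {w} y'⊑w h)
      ldy : LD s (gen s · y')
      ldy = LD-add s y' ¬ldy
      ¬ldwp : ¬ LD s (w · gen p)
      ¬ldwp = ⊑-NegW {s} {w} {p} np ¬ld
      p∈ : p ∈ cs ∷ʳ s
      p∈ = Neg-InW ww p np

      I-up : ∀ x q → I x (cov w q) → I (gen s · x) (cov z q)
      I-up x q h = I-add' s x (cov z q) (subst (I x) (sym (cov-s s w q)) h)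

      simple-in : ∀ β → PosR β → ¬ PosR (gen s ▸ β) → I (gen s · y') β
      simple-in β pos np' = same-I (e , s) β (sym (simple-refl s β pos np')) (simple-pos s) pos (gen s · y') (LD-I {s} {gen s · y'} ldy)

      E-shift : ∀ β → SuppR (cs ∷ʳ s) (gen s ▸ β) → ∀ c m m' → E c (s ∷ cs) (vec β m) (vec (cov z p) m') ≡ E c (cs ∷ʳ s) (vec (gen s ▸ β) m) (vec (cov w p) m')
      E-shift β sp c m m' = trans (EF.E-cong c (s ∷ cs) v1 v2) (EF.E-rot c s cs (vec (gen s ▸ β) m) (vec (cov w p) m') uq
          (SuppV-mono {v = vec (gen s ▸ β) m} (rot-∈ cs) (sp m))
          (SuppV-mono {v = vec (cov w p) m'} (rot-∈ cs) λ j j∉ k → trans (cov-vec w p m' j k) (cong -_ (SuppV-root ww p m' p∈ j j∉ k))))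
        where
        v1 : vec β m ≈ r s (vec (gen s ▸ β) m)
        v1 = ≈-trans (subst (λ t → vec β m ≈ vec t m) (sym (▸-cancel s β)) ≈-refl) (≈-trans (vec-▸ (gen s) (gen s ▸ β) m) (ρ-gen s _))
        v2 : vec (cov z p) m' ≈ r s (vec (cov w p) m')
        v2 = ≈-trans (subst (λ t → vec (cov z p) m' ≈ vec t m') (trans (sym (▸-cancel s (cov z p))) (cong (gen s ▸_) (cov-s s w p))) ≈-refl)
          (≈-trans (vec-▸ (gen s) (cov w p) m') (ρ-gen s _))

    lower : Lower (s ∷ cs) (gen s · w) p
    lower = record
      { y = gen s · y' ; srt = take ¬ldy L.srt
      ; below = subst (gen s · y' ⊑_) (sym (assoc _ _ _)) (add-⊑ s y' (w · gen p) ¬ldwp L.below)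
      ; others = oth ; mub = mb ; H = hh ; U = uu }
      where
      oth : ∀ q → q ≢ p → Neg z q → I (gen s · y') (cov z q)
      oth q q≢p nq with Neg? w q
      ... | yes nw = I-up y' q (L.others q q≢p nw)
      ... | no ¬nw = same-I (e , s) (cov z q) (sym (cov-simple s z q eq)) (simple-pos s) (cov-pos z q nq) (gen s · y') (LD-I {s} {gen s · y'} ldy)
        where
        eq : gen s · z ≡ z · gen q
        eq = trans (gen-cancelˡ s w) (sym (trans (cong (_· gen q) (exchange w q s ¬nw nq)) (gen-cancelʳ q w)))
      mb : ∀ x → gen s · y' ⊑ x → I x (cov z p) → z ⊑ x
      mb x le h = subst (z ⊑_) (gen-cancelˡ s x) (add-⊑ s w (gen s · x) (LD-strip s x ldx) (L.mub (gen s · x) le' h'))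
        where
        ldx : LD s x
        ldx = LD-⊑ {s} {gen s · y'} {x} le ldy
        le' : y' ⊑ gen s · x
        le' = strip-⊑ s y' (gen s · x) ¬ldy (subst (gen s · y' ⊑_) (sym (gen-cancelˡ s x)) le)
        h' : I (gen s · x) (cov w p)
        h' = subst (I (gen s · x)) (cov-s s w p) (I-add s (gen s · x) (cov z p) (subst (λ t → I t (cov z p)) (sym (gen-cancelˡ s x)) h))
      hh : ∀ β → PosR β → I (gen s · y') β → ∀ c m m' → NN m → NN m' → E c (s ∷ cs) (vec β m) (vec (cov z p) m') ≤ 0ℤ
      hh β pos h c m m' hm hm' with pos? (gen s ▸ β)
      ... | yes q = subst (_≤ 0ℤ) (sym (E-shift β (InvSupp (S-InW L.srt) (gen s ▸ β) q hi) c m m')) (L.H (gen s ▸ β) q hi c m m' hm hm')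
        where
        hi : I y' (gen s ▸ β)
        hi = I-add s y' β h
      ... | no ¬q with same-vec β (e , s) (simple-refl s β pos ¬q) pos (simple-pos s)
      ... | φ , φ-NN , hv = subst (_≤ 0ℤ) (sym (trans (EF.E-cong c (s ∷ cs) (≈-trans (hv m) (ρ-e (α s (φ m)))) (≈-refl {vec (cov z p) m'}))
          (EF.E-firstˡ c s cs (φ m) (vec (cov z p) m') uq sz)))
          (ℤₚ.neg-mono-≤ (pair-NN (cut c) (φ-NN m hm) λ k → subst (0ℤ ≤_) (vz k) (vec-pos (cov w p) (cov-pos w p np) hm' s k)))
        where
        wz : InW (s ∷ cs) z
        wz = mul (here refl) (InW-mono (rot-∈ cs) ww)
        sz : SuppV (s ∷ cs) (vec (cov z p) m')
        sz j j∉ k = trans (cov-vec z p m' j k) (cong -_ (SuppV-root wz p m' (rot-∈ cs p∈) j j∉ k))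
        vz : ∀ k → vec (cov w p) m' s k ≡ r s (vec (cov z p) m') s k
        vz k = trans (cong (λ t → vec t m' s k) (sym (cov-s s w p))) (trans (vec-▸ (gen s) (cov z p) m' s k) (ρ-gen s _ s k))
      uu : ∀ β → PosR β → I z β → (∀ c m m' → NN m → NN m' → E c (s ∷ cs) (vec β m) (vec (cov z p) m') ≤ 0ℤ) → I (gen s · y') β
      uu β pos h hE with pos? (gen s ▸ β)
      ... | no ¬q = simple-in β pos ¬q
      ... | yes q = I-add' s y' β (L.U (gen s ▸ β) q hi λ c m m' hm hm' → subst (_≤ 0ℤ) (E-shift β (InvSupp ww (gen s ▸ β) q hi) c m m') (hE c m m' hm hm'))
        where
        hi : I w (gen s ▸ β)
        hi = I-add s w β h

  skip-lower : ∀ {s cs w p} → s ∉ cs → InW cs w → Lower cs w p → Lower (s ∷ cs) w p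
  skip-lower {s} {cs} {w} {p} s∉ ww L = record
    { y = L.y ; srt = skip L.srt ; below = L.below ; others = L.others ; mub = L.mub
    ; H = λ β pos h c m m' hm hm' → subst (_≤ 0ℤ) (sym (EF.E-skip c s cs (vec β m) (vec (cov w p) m') (InvSupp (S-InW L.srt) β pos h m s s∉))) (L.H β pos h c m m' hm hm')
    ; U = λ β pos h hE → L.U β pos h λ c m m' hm hm' → subst (_≤ 0ℤ) (EF.E-skip c s cs (vec β m) (vec (cov w p) m') (InvSupp ww β pos h m s s∉)) (hE c m m' hm hm') }
    where module L = Lower L

  -- Here α_s itself is a cover root, and the lower cover is the parabolic part of `z` without `s`.
  -- It keeps the other cover roots because by `cover-supp` they do not involve `s`, and `E` against
  -- α_s is the `s`-coordinate, so `H` and `U` say that precisely the inversions free of `s`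
  -- survive.
  module Base (s : Fin n) (cs : List (Fin n)) (z : Fin N) (uq : Uniq (s ∷ cs)) (d : Sortable (s ∷ cs) z) (q : Fin n) (nq : Neg z q)
    (eq : gen s · z ≡ z · gen q) (R : Restr cs z) where
    private
      module R = Restr R
      s∉ = proj₁ uq
      rc : refl-of (cov z q) ≡ refl-of (e , s)
      rc = cov-simple s z q eq
      pc : PosR (cov z q)
      pc = cov-pos z q nq
      ldz : LD s z
      ldz = I-LD {s} {z} (same-I (cov z q) (e , s) rc pc (simple-pos s) z (cov-in z q))
      ¬ldk : ¬ LD s R.k
      ¬ldk = ¬LD-InW s∉ (S-InW R.srt)

      oth : ∀ p → p ≢ q → Neg z p → I R.k (cov z p)
      oth p p≢q np = R.full (cov z p) (cov-pos z p np) (cov-in z p) (supp-tail {v = vec (cov z p) 𝟙}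
        (λ j j∉ k → trans (cov-vec z p 𝟙 j k) (cong -_ (SuppV-root (S-InW d) p 𝟙 (Neg-InW (S-InW d) p np) j j∉ k)))
        (λ k → trans (cov-vec z p 𝟙 s k) (cong -_ (cover-supp d uq q nq eq p p≢q np 𝟙 k))))

      mb : ∀ x → R.k ⊑ x → I x (cov z q) → z ⊑ x
      mb x le h with glb z x
      ... | G = subst (_⊑ x) (decide (G.meet ≟ z)) G.leʳ
        where
        module G = Glb G
        ldx : LD s x
        ldx = I-LD {s} {x} (same-I (cov z q) (e , s) rc pc (simple-pos s) x h)
        sm : LD s G.meet
        sm = LD-⊑ {s} {gen s} {G.meet} (G.great (gen s) (gen-⊑ s z ldz) (gen-⊑ s x ldx)) (subst (λ t → Neg t s) (trans (idˡ _) (sym (inv-gen s))) (Pos-flip e s (¬Neg-e s)))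
        km : R.k ⊑ G.meet
        km = G.great R.k R.le le
        decide : Dec (G.meet ≡ z) → G.meet ≡ z
        decide (yes p) = p
        -- A meet strictly below `z` would lose some cover root, but it contains α_s through `x` and
        -- all the other cover roots through `R.k`.
        decide (no ¬p) with ⊑-cover G.meet z G.leˡ ¬p
        ... | p , np , lep with p ≟ q
        ... | yes refl = ⊥-elim (cov-out z q (lep (cov z q) pc (same-I (e , s) (cov z q) (sym rc) (simple-pos s) pc G.meet (LD-I {s} {G.meet} sm))))
        ... | no p≢q = ⊥-elim (cov-out z p (lep (cov z p) (cov-pos z p np) (km (cov z p) (cov-pos z p np) (oth p p≢q np))))

    lower : Lower (s ∷ cs) z q
    lower = record
      { y = R.k ; srt = skip R.srt
      ; below = cov-below R.k z q nq R.le (λ h → ¬ldk (I-LD {s} {R.k} (same-I (cov z q) (e , s) rc pc (simple-pos s) R.k h)))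
      ; others = oth ; mub = mb ; H = hh ; U = uu }
      where
      hh : ∀ β → PosR β → I R.k β → ∀ c m m' → NN m → NN m' → E c (s ∷ cs) (vec β m) (vec (cov z q) m') ≤ 0ℤ
      hh β pos h c m m' hm hm' with same-vec (cov z q) (e , s) rc pc (simple-pos s)
      ... | φ , _ , hv = ℤₚ.≤-reflexive (trans (EF.E-cong c (s ∷ cs) (≈-refl {vec β m}) (≈-trans (hv m') (ρ-e (α s (φ m'))))) (trans (EF.E-simpleʳ c s cs (vec β m) (φ m') s∉)
        (pair-0ˡ (cut c) (φ m') (InvSupp (S-InW R.srt) β pos h m s s∉))))
      uu : ∀ β → PosR β → I z β → (∀ c m m' → NN m → NN m' → E c (s ∷ cs) (vec β m) (vec (cov z q) m') ≤ 0ℤ) → I R.k β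
      uu β pos h hE with same-vec (e , s) (cov z q) (sym rc) (simple-pos s) pc
      ... | ψ , ψ-NN , hv = R.full β pos h (supp-tail {v = vec β 𝟙} (InvSupp (S-InW d) β pos h 𝟙) λ k →
          nn-antisym (vec-pos β pos 𝟙-NN s k) (ℤₚ.neg-mono-≤ (subst (_≤ 0ℤ) (ev k) (hE k 𝟙 (ψ (δ k)) 𝟙-NN (ψ-NN (δ k) (δ-NN k))))))
        where
        ev : ∀ k → E k (s ∷ cs) (vec β 𝟙) (vec (cov z q) (ψ (δ k))) ≡ vec β 𝟙 s k
        ev k = trans (EF.E-cong k (s ∷ cs) (≈-refl {vec β 𝟙}) (≈-trans (≈-sym (hv (δ k))) (ρ-e (α s (δ k))))) (trans (EF.E-simpleʳ k s cs (vec β 𝟙) (δ k) s∉)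
          (trans (pair-comm (cut k) (vec β 𝟙 s) (δ k)) (pair-δ (cut k) k (vec β 𝟙 s) (cut-big k))))

  -- If the root of the cover involves s, the s-free inversions of z survive in y.
  s-free : ∀ {s cs z p} → s ∉ cs → (L : Lower (s ∷ cs) z p) → Neg z p → ∀ β → PosR β → I z β → SuppV cs (vec β 𝟙) → ¬ I (Lower.y L) β →
    ∀ k → vec (cov z p) 𝟙 s k ≡ 0ℤ
  s-free {s} {cs} {z} {p} s∉ L np β pos h sp ¬h k with vec (cov z p) 𝟙 s k ℤ.≟ 0ℤ
  ... | yes q = q
  -- `fill` has the inversions of `y` inside `cs` and every root outside. If the cover root involves
  -- `s`, then `fill` contains it and lies above `y`, so `mub` puts `z` below `fill`, and the given
  -- inversion of `z` already belongs to `y`.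
  ... | no ¬q = ⊥-elim (¬h (subst (λ t → I t β) (sym P.factor) (proj₂ (comp-I cs P.left P.right P.inJ P.min β pos sp)
      (proj₁ (fill-in β pos sp) (L.mub fill y⊑ (fill-out (cov z p) (cov-pos z p np) s k s∉ ¬q) β pos h)))))
    where
    module L = Lower L
    module P = Par (par cs L.y)
    open Fill cs P.left P.inJ
    y⊑ : L.y ⊑ fill
    y⊑ γ pγ hγ with I? fill γ
    ... | yes r = r
    ... | no ¬r = proj₂ (fill-in γ pγ spγ) (proj₁ (comp-I cs P.left P.right P.inJ P.min γ pγ spγ) (subst (λ t → I t γ) P.factor hγ))
      where
      spγ : SuppV cs (vec γ 𝟙)
      spγ j j∉ l with vec γ 𝟙 j l ℤ.≟ 0ℤ
      ... | yes r = r
      ... | no ¬0 = ⊥-elim (¬r (fill-out γ pγ j l j∉ ¬0))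

  -- The left factor does not change coordinates outside `cs`, so the cover root of `right` and that
  -- of `z` agree there. The former has a nonzero coordinate outside, since `right` has no inversion
  -- supported on `cs`.
  module Outer (cs : List (Fin n)) (z : Fin N) (p : Fin n) (np : Neg (Par.right (par cs z)) p) where
    private
      P = par cs z
      open Par P
      γ : Root
      γ = cov right p
      ¬sp : ¬ SuppV cs (vec γ 𝟙)
      ¬sp sp = cov-pos right p np (subst (λ t → Neg t p) (trans (cong (_· (right · gen p)) inv-e) (idˡ _))
        (proj₁ (comp-I cs e right one min γ (cov-pos right p np) sp) (subst (λ t → I t γ) (sym (idˡ right)) (cov-in right p))))
      coord : ∀ j → j ∉ cs → ∀ k → vec (cov z p) 𝟙 j k ≡ vec γ 𝟙 j k
      coord j j∉ k = trans (cong (λ t → ρ (t · gen p) (α p 𝟙) j k) factor) (trans (cong (λ t → ρ t (α p 𝟙) j k) (assoc _ _ _))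
        (trans (ρ-· left (right · gen p) (α p 𝟙) j k) (InW-vec inJ (vec γ 𝟙) j j∉ k)))

    not-supp : ¬ SuppV cs (vec (cov z p) 𝟙)
    not-supp sp = ¬sp (λ j j∉ k → trans (sym (coord j j∉ k)) (sp j j∉ k))

    descent : Neg z p
    descent with Neg? z p
    ... | yes q = q
    ... | no ¬q = ⊥-elim (¬sp λ j j∉ k → nn-antisym (pos-vec (right · gen p) p (cov-pos right p np) 𝟙-NN j k)
        (subst (0ℤ ≤_) (trans (sym (ℤₚ.neg-involutive _)) (cong -_ (trans (sym (cov-vec z p 𝟙 j k)) (coord j j∉ k)))) (pos-vec z p ¬q 𝟙-NN j k)))

  outer-descent : ∀ {s cs z} → s ∉ cs → InW (s ∷ cs) z → LD s z → ∃[ p ] Neg z p × ¬ (∀ k → vec (cov z p) 𝟙 s k ≡ 0ℤ)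
  outer-descent {s} {cs} {z} s∉ wz ld = p , nz , λ h → Outer.not-supp cs z p np
      (supp-tail {v = vec (cov z p) 𝟙} (λ j j∉ k → trans (cov-vec z p 𝟙 j k) (cong -_ (SuppV-root wz p 𝟙 (Neg-InW wz p nz) j j∉ k))) h)
    where
    open Par (par cs z)
    ex : ∃[ p ] Neg right p
    ex = exists-Neg right (λ q → ¬LD-InW s∉ inJ (subst (LD s) (trans factor (trans (cong (left ·_) q) (idʳ _))) ld))
    p : Fin n
    p = proj₁ ex
    np : Neg right p
    np = proj₂ ex
    nz : Neg z p
    nz = Outer.descent cs z p np

  measure-take : ∀ {b} s (cs : List (Fin n)) w → ¬ LD s w → len (gen s · w) ℕ.+ suc (length cs) ℕ.≤ suc b → len w ℕ.+ length (cs ∷ʳ s) ℕ.≤ b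
  measure-take {b} s cs w ¬ld h = ℕₚ.≤-pred (ℕₚ.≤-trans (ℕₚ.≤-reflexive (sym (trans (cong (ℕ._+ suc (length cs)) (len-add s w ¬ld))
    (cong (λ t → suc (len w ℕ.+ t)) (sym (trans (Lₚ.length-++ cs) (ℕₚ.+-comm (length cs) 1))))))) h)

  measure-skip : ∀ {b} (cs : List (Fin n)) w → len w ℕ.+ suc (length cs) ℕ.≤ suc b → len w ℕ.+ length cs ℕ.≤ b
  measure-skip cs w h = ℕₚ.≤-pred (ℕₚ.≤-trans (ℕₚ.≤-reflexive (sym (ℕₚ.+-suc (len w) (length cs)))) h)

  MaxBelow : List (Fin n) → Fin N → Fin N → Set
  MaxBelow cs x y = ∀ v → Sortable cs v → v ⊑ x → v ⊑ y

  -- `skip` shortens the list and `take` shortens the element while preserving the number of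
  -- letters, so the sum drops in both cases. At a given bound restriction is proved first, because
  -- the step for lower covers uses it at the same bound.
  RestrTo LowerTo : ℕ → Set
  RestrTo b = ∀ {cs z} → len z ℕ.+ length cs ℕ.≤ b → Sortable cs z → Uniq cs → ∀ l {ds} → Rem l cs ds → Restr ds z
  LowerTo b = ∀ {cs z} → len z ℕ.+ length cs ℕ.≤ b → Sortable cs z → Uniq cs → ∀ p → Neg z p → Σ (Lower cs z p) λ L → MaxBelow cs (z · gen p) (Lower.y L)

  -- To remove `s`, a descent `p` is chosen whose cover root involves `s`. Passing to the lower
  -- cover at `p` loses no inversion free of `s`, by `s-free`, and gives a shorter element. If `p`
  -- is not a descent of `w`, then the cover root is α_s, `z · gen p` is `w`, and `s` is removed
  -- from `w` instead.
  module RestrOuter (b : ℕ) (ihr : RestrTo b) (ihy : LowerTo b) (s : Fin n) (cs : List (Fin n)) (w : Fin N)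
    (h : len (gen s · w) ℕ.+ suc (length cs) ℕ.≤ suc b) (¬ld : ¬ LD s w) (d : Sortable (cs ∷ʳ s) w) (uq : Uniq (s ∷ cs))
    (p : Fin n) (np : Neg (gen s · w) p) (ns : ¬ (∀ k → vec (cov (gen s · w) p) 𝟙 s k ≡ 0ℤ)) where

    case : Dec (Neg w p) → Restr cs (gen s · w)
    case (yes nw) = record { k = R.k ; srt = R.srt ; le = ⊑-trans {R.k} {L.y} {z} R.le y⊑z ; full = λ β pos hz sp → R.full β pos (keep β pos hz sp) sp }
      where
      z = gen s · w
      L = Take.lower s cs w ¬ld uq (S-InW d) p nw (proj₁ (ihy (measure-take s cs w ¬ld h) d (Uniq-rot cs uq) p nw))
      module L = Lower L
      y⊑z : L.y ⊑ z
      y⊑z = ⊑-trans {L.y} {z · gen p} {z} L.below (cov-⊑ z p np)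
      hy : len L.y ℕ.+ suc (length cs) ℕ.≤ b
      hy = ℕₚ.≤-pred (ℕₚ.≤-trans (ℕₚ.+-monoˡ-≤ (suc (length cs)) (ℕₚ.≤-trans (s≤s (⊑-len L.y (z · gen p) L.below)) np)) h)
      module R = Restr (ihr hy L.srt uq s rh)
      keep : ∀ β → PosR β → I z β → SuppV cs (vec β 𝟙) → I L.y β
      keep β pos hz sp with I? L.y β
      ... | yes q = q
      ... | no ¬q = ⊥-elim (ns (s-free (proj₁ uq) L np β pos hz sp ¬q))
    case (no ¬nw) = record { k = R.k ; srt = R.srt ; le = ⊑-trans {R.k} {w} {z} R.le w⊑z ; full = λ β pos hz sp → R.full β pos (keep β pos hz sp) sp }
      where
      z = gen s · w
      module R = Restr (ihr (measure-take s cs w ¬ld h) d (Uniq-rot cs uq) s (Rem-last s cs))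
      zp≡w : z · gen p ≡ w
      zp≡w = trans (cong (_· gen p) (exchange w p s ¬nw np)) (gen-cancelʳ p w)
      w⊑z : w ⊑ z
      w⊑z = subst (_⊑ z) zp≡w (cov-⊑ z p np)
      keep : ∀ β → PosR β → I z β → SuppV cs (vec β 𝟙) → I w β
      keep β pos hz sp with I? w β
      ... | yes q = q
      ... | no ¬q = ⊥-elim (supp-not-simple (proj₁ uq) β pos (trans (cov-unique z p β hz (subst (λ t → ¬ I t β) (sym zp≡w) ¬q))
              (cov-simple s z p (trans (gen-cancelˡ s w) (sym zp≡w)))) sp)

  restrStep : ∀ b → RestrTo b → LowerTo b → RestrTo (suc b)
  restrStep b ihr ihy {z = z} h (skip d) uq l rh = record { k = z ; srt = d ; le = ⊑-refl ; full = λ β _ hz _ → hz }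
  restrStep b ihr ihy {z = z} h (skip {s} {cs} d) uq l (rt {ds = ds} rm) = record { k = R.k ; srt = skip R.srt ; le = R.le
      ; full = λ β pos hz sp → R.full β pos hz (supp-tail {v = vec β 𝟙} sp (InvSupp (S-InW d) β pos hz 𝟙 s (proj₁ uq))) }
    where module R = Restr (ihr (measure-skip cs z h) d (proj₂ uq) l rm)
  restrStep b ihr ihy h (take {s} {cs} {w} ¬ld d) uq l (rt {ds = ds} rm) = record { k = gen s · R.k ; srt = take ¬ldk R.srt ; le = add-⊑ s R.k w ¬ld R.le ; full = fl }
    where
    module R = Restr (ihr (measure-take s cs w ¬ld h) d (Uniq-rot cs uq) l (Rem-snoc s rm))
    ¬ldk : ¬ LD s R.k
    ¬ldk q = ¬ld (LD-⊑ {s} {R.k} {w} R.le q)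
    fl : ∀ β → PosR β → I (gen s · w) β → SuppV (s ∷ ds) (vec β 𝟙) → I (gen s · R.k) β
    fl β pos hz sp with pos? (gen s ▸ β)
    ... | no ¬q = same-I (e , s) β (sym (simple-refl s β pos ¬q)) (simple-pos s) pos (gen s · R.k) (LD-I {s} {gen s · R.k} (LD-add s R.k ¬ldk))
    ... | yes q = I-add' s R.k β (R.full (gen s ▸ β) q (I-add s w β hz) λ j j∉ k → trans (vec-▸ (gen s) β 𝟙 j k) (trans (ρ-gen s (vec β 𝟙) j k)
            (trans (r-other s (vec β 𝟙) (λ { refl → j∉ (snoc-last ds) }) k) (sp j (λ m → j∉ (unrot-∈ ds m)) k))))
  restrStep b ihr ihy h (take {s} {cs} {w} ¬ld d) uq l rh = RestrOuter.case b ihr ihy s cs w h ¬ld d uq (proj₁ od) (proj₁ (proj₂ od)) (proj₂ (proj₂ od)) (Neg? w (proj₁ od))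
    where
    od : ∃[ p ] Neg (gen s · w) p × ¬ (∀ k → vec (cov (gen s · w) p) 𝟙 s k ≡ 0ℤ)
    od = outer-descent (proj₁ uq) (S-InW (take ¬ld d)) (LD-add s w ¬ld)

  module YStep (b : ℕ) (ihr : RestrTo (suc b)) (ihy : LowerTo b) (s : Fin n) (cs : List (Fin n)) (w : Fin N)
    (h : len (gen s · w) ℕ.+ suc (length cs) ℕ.≤ suc b) (¬ld : ¬ LD s w) (d : Sortable (cs ∷ʳ s) w) (uq : Uniq (s ∷ cs))
    (p : Fin n) (np : Neg (gen s · w) p) where
    private
      z : Fin N
      z = gen s · w
      dz : Sortable (s ∷ cs) z
      dz = take ¬ld d
      R : Restr cs z
      R = ihr h dz uq s rh

    simple-cover : ¬ Neg w p → Σ (Lower (s ∷ cs) z p) λ L → MaxBelow (s ∷ cs) (z · gen p) (Lower.y L)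
    simple-cover ¬nw = Base.lower s cs z uq dz p np eq R , mx
      where
      zp≡w : z · gen p ≡ w
      zp≡w = trans (cong (_· gen p) (exchange w p s ¬nw np)) (gen-cancelʳ p w)
      eq : gen s · z ≡ z · gen p
      eq = trans (gen-cancelˡ s w) (sym zp≡w)
      mx : MaxBelow (s ∷ cs) (z · gen p) (Restr.k R)
      mx v (take {w = v'} ¬ldv dv) le = ⊥-elim (¬ld (LD-⊑ {s} {gen s · v'} {w} (subst (gen s · v' ⊑_) zp≡w le) (LD-add s v' ¬ldv)))
      mx v (skip dv) le β pos hv = Restr.full R β pos (cov-⊑ z p np β pos (le β pos hv)) (InvSupp (S-InW dv) β pos hv 𝟙)

    module Cover (nw : Neg w p) (L' : Lower (cs ∷ʳ s) w p) (mx' : MaxBelow (cs ∷ʳ s) (w · gen p) (Lower.y L')) where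
      L : Lower (s ∷ cs) z p
      L = Take.lower s cs w ¬ld uq (S-InW d) p nw L'
      private
        module L = Lower L
        module L' = Lower L'
        ¬ldy : ¬ LD s L'.y
        ¬ldy q = ¬ld (LD-⊑ {s} {L'.y} {w} (⊑-trans {L'.y} {w · gen p} {w} L'.below (cov-⊑ w p nw)) q)

      -- Suppose the lower cover misses an inversion `β` of `v`. By `s-free` the cover root `t` is
      -- supported on `cs`, so it is also a cover root of the parabolic part `R.k`, at some `p'`.
      -- Induction puts `v` below the lower cover of `R.k` at `p'`, whose property `H` gives E(β, t)
      -- ≤ 0; then `U` contradicts the choice of `β`.
      module Missing (v : Fin N) (dv : Sortable cs v) (le : v ⊑ z · gen p) (β : Root) (pos : PosR β) (hv : I v β) (¬q : ¬ I L.y β) where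
        private
          hz : I z β
          hz = cov-⊑ z p np β pos (le β pos hv)
          spv : SuppV cs (vec β 𝟙)
          spv = InvSupp (S-InW dv) β pos hv 𝟙
          p∈ : p ∈ s ∷ cs
          p∈ = Neg-InW (S-InW dz) p np
          t = cov z p
          spt : SuppV cs (vec t 𝟙)
          spt = supp-tail {v = vec t 𝟙} (λ j j∉ k → trans (cov-vec z p 𝟙 j k) (cong -_ (SuppV-root (S-InW dz) p 𝟙 p∈ j j∉ k)))
            (s-free (proj₁ uq) L np β pos hz spv ¬q)
          module R = Restr R
          module P = Par (par cs (z · gen p))
          bk : P.left ⊑ R.k
          bk γ pγ hγ = R.full γ pγ (cov-⊑ z p np γ pγ (subst (λ u → I u γ) (sym P.factor) (left-⊑ cs P.left P.right P.inJ P.min γ pγ hγ))) (InvSupp P.inJ γ pγ hγ 𝟙)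
          to-b : ∀ γ → PosR γ → I (z · gen p) γ → SuppV cs (vec γ 𝟙) → I P.left γ
          to-b γ pγ hγ sp = proj₁ (comp-I cs P.left P.right P.inJ P.min γ pγ sp) (subst (λ u → I u γ) P.factor hγ)
          tk : I R.k t
          tk = R.full t (cov-pos z p np) (cov-in z p) spt
          b≢k : P.left ≢ R.k
          b≢k q = cov-out z p (subst (λ u → I u t) (sym P.factor) (left-⊑ cs P.left P.right P.inJ P.min t (cov-pos z p np) (subst (λ u → I u t) (sym q) tk)))

          ex : ∃[ p' ] Neg R.k p' × P.left ⊑ R.k · gen p'
          ex = ⊑-cover P.left R.k bk b≢k
          p' : Fin n
          p' = proj₁ ex
          np' : Neg R.k p'
          np' = proj₁ (proj₂ ex)
          lep : P.left ⊑ R.k · gen p'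
          lep = proj₂ (proj₂ ex)
          t' = cov R.k p'
          pt' : PosR t'
          pt' = cov-pos R.k p' np'
          rr : refl-of t' ≡ refl-of t
          rr = cov-unique z p t' (R.le t' pt' (cov-in R.k p')) (λ q → cov-out R.k p' (lep t' pt' (to-b t' pt' q (InvSupp (S-InW R.srt) t' pt' (cov-in R.k p') 𝟙))))
          hk : len R.k ℕ.+ length cs ℕ.≤ b
          hk = ℕₚ.≤-trans (ℕₚ.+-monoˡ-≤ (length cs) (⊑-len R.k z R.le)) (measure-skip cs z h)
          Lk = ihy hk R.srt (proj₂ uq) p' np'
          vk : v ⊑ Lower.y (proj₁ Lk)
          vk = proj₂ Lk v dv (λ γ pγ hγ → lep γ pγ (to-b γ pγ (le γ pγ hγ) (InvSupp (S-InW dv) γ pγ hγ 𝟙)))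

          same : Σ (M → M) λ φ → (∀ m → NN m → NN (φ m)) × (∀ m → vec t m ≈ vec t' (φ m))
          same = same-vec t t' (sym rr) (cov-pos z p np) pt'
          φ : M → M
          φ = proj₁ same
          hE : ∀ c m m' → NN m → NN m' → E c (s ∷ cs) (vec β m) (vec t m') ≤ 0ℤ
          hE c m m' hm hm' = subst (_≤ 0ℤ) (sym (trans (EF.E-cong c (s ∷ cs) (≈-refl {vec β m}) (proj₂ (proj₂ same) m'))
              (EF.E-skip c s cs (vec β m) (vec t' (φ m')) (InvSupp (S-InW dv) β pos hv m s (proj₁ uq)))))
              (Lower.H (proj₁ Lk) β pos (vk β pos hv) c m (φ m') hm (proj₁ (proj₂ same) m' hm'))
        contra : ⊥
        contra = ¬q (L.U β pos hz hE)

      mx : MaxBelow (s ∷ cs) (z · gen p) L.y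
      mx v (take {w = v'} ¬ldv dv) le = add-⊑ s v' L'.y ¬ldy (mx' v' dv (strip-⊑ s v' (w · gen p) ¬ldv (subst (gen s · v' ⊑_) (assoc _ _ _) le)))
      mx v (skip dv) le β pos hv = decide (I? L.y β)
        where
        decide : Dec (I L.y β) → I L.y β
        decide (yes q) = q
        decide (no ¬q) = ⊥-elim (Missing.contra v dv le β pos hv ¬q)

    case : Dec (Neg w p) → Σ (Lower (s ∷ cs) z p) λ L → MaxBelow (s ∷ cs) (z · gen p) (Lower.y L)
    case (no ¬nw) = simple-cover ¬nw
    case (yes nw) = Cover.L nw (proj₁ ih) (proj₂ ih) , Cover.mx nw (proj₁ ih) (proj₂ ih)
      where
      ih : Σ (Lower (cs ∷ʳ s) w p) λ L → MaxBelow (cs ∷ʳ s) (w · gen p) (Lower.y L)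
      ih = ihy (measure-take s cs w ¬ld h) d (Uniq-rot cs uq) p nw

  ymaxStep : ∀ b → RestrTo (suc b) → LowerTo b → LowerTo (suc b)
  ymaxStep b ihr ihy h done uq p np with Neg-InW {[]} one p np
  ... | ()
  ymaxStep b ihr ihy {z = z} h (skip {s} {cs} d) uq p np = skip-lower (proj₁ uq) (S-InW d) (proj₁ ih) , mx'
    where
    ih : Σ (Lower cs z p) λ L → MaxBelow cs (z · gen p) (Lower.y L)
    ih = ihy (measure-skip cs z h) d (proj₂ uq) p np
    mx' : MaxBelow (s ∷ cs) (z · gen p) (Lower.y (proj₁ ih))
    mx' v (skip dv) le = proj₂ ih v dv le
    mx' v (take {w = v'} ¬ldv dv) le = ⊥-elim (¬LD-InW (proj₁ uq) (S-InW d) (LD-⊑ {s} {gen s · v'} {z} (⊑-trans {gen s · v'} {z · gen p} {z} le (cov-⊑ z p np)) (LD-add s v' ¬ldv)))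
  ymaxStep b ihr ihy h (take {s} {cs} {w} ¬ld d) uq p np = YStep.case b ihr ihy s cs w h ¬ld d uq p np (Neg? w p)

  both : ∀ b → RestrTo b × LowerTo b
  both zero = (λ { h done uq l () ; {z = z} h (skip {cs = cs} d) uq l rm → ⊥-elim (big (len z) h) ; h (take {s} {w = w} _ d) uq l rm → ⊥-elim (big (len (gen s · w)) h) }) ,
    (λ { h done uq p np → ⊥-elim (none (Neg-InW {[]} one p np)) ; {z = z} h (skip d) uq p np → ⊥-elim (big (len z) h) ; h (take {s} {w = w} _ d) uq p np → ⊥-elim (big (len (gen s · w)) h) })
    where
    big : ∀ a {c} → ¬ (a ℕ.+ suc c ℕ.≤ 0)
    big a {c} h = ℕₚ.n≮0 (ℕₚ.≤-trans (ℕₚ.m≤n+m (suc c) a) h)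
    none : ∀ {p : Fin n} → ¬ (p ∈ [])
    none ()
  both (suc b) = rs , ymaxStep b rs (proj₂ (both b))
    where
    rs : RestrTo (suc b)
    rs = restrStep b (proj₁ (both b)) (proj₂ (both b))

  restrict : ∀ {cs z} → Sortable cs z → Uniq cs → ∀ l {ds} → Rem l cs ds → Restr ds z
  restrict {cs} {z} = proj₁ (both (len z ℕ.+ length cs)) ℕₚ.≤-refl

  lower : ∀ {cs z} → Sortable cs z → Uniq cs → ∀ p → Neg z p → Σ (Lower cs z p) λ L → MaxBelow cs (z · gen p) (Lower.y L)
  lower {cs} {z} = proj₂ (both (len z ℕ.+ length cs)) ℕₚ.≤-refl

-- Commuting descents and the deletion of cover reflections.

module Descents (C : CoxeterSystem) where

  open Representation C
  open Positivity C
  open WeakOrder C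
  open EulerForm C
  open CambrianCovers C
  open import Data.List.Membership.DecPropositional (_≟_ {n}) using (_∈?_)

  Commuting : Fin N → Set
  Commuting w = ∀ p q → Neg w p → Neg w q → gen p · gen q ≡ gen q · gen p

  r-comm : ∀ p q m → p ≢ q → gen p · gen q ≡ gen q · gen p → r q (α p m) ≈ α p m
  r-comm p q m p≢q cm = ≈-trans (r-α-other q p m p≢q) λ j k → trans (cong (λ t → α p m j k + t)
    (trans (α-cong q (λ k → trans (cong (λ t → A t m k) (comm⇒ee0 q p (sym cm))) (A-triv m k)) j k) (α-0 q j k))) (ℤₚ.+-identityʳ _)

  Neg-comm : ∀ w p q → p ≢ q → gen p · gen q ≡ gen q · gen p → Neg w p → Neg (w · gen q) p
  Neg-comm w p q p≢q cm ng = sign-neg (w · gen q) p (NNV-≈ (⊖-cong (≈-sym (≈-trans (ρ-last w q (α p 𝟙)) (ρ-cong w (r-comm p q 𝟙 p≢q cm))))) (neg-vec w p ng 𝟙-NN))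

  refl-cov-comm : ∀ w p q → gen p · gen q ≡ gen q · gen p → refl-of (cov (w · gen q) p) ≡ refl-of (cov w p)
  refl-cov-comm w p q cm = trans (refl-cov (w · gen q) p) (trans (begin
    ((w · gen q) · gen p) · inv (w · gen q) ≡⟨ cong₂ _·_ (trans (assoc _ _ _) (trans (cong (w ·_) (sym cm)) (sym (assoc _ _ _)))) (trans (inv-· w (gen q)) (cong (_· inv w) (inv-gen q))) ⟩
    ((w · gen p) · gen q) · (gen q · inv w) ≡⟨ trans (assoc _ _ _) (cong ((w · gen p) ·_) (gen-cancelˡ q _)) ⟩
    (w · gen p) · inv w ∎) (sym (refl-cov w p)))

  refl-▸ : ∀ s β γ → refl-of β ≡ refl-of γ → refl-of (gen s ▸ β) ≡ refl-of (gen s ▸ γ)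
  refl-▸ s β γ eq = trans (conj β) (trans (cong (λ t → (gen s · t) · gen s) eq) (sym (conj γ)))
    where
    conj : ∀ β → refl-of (gen s ▸ β) ≡ (gen s · refl-of β) · gen s
    conj (x , i) = trans (cong₂ _·_ (assoc _ _ _) (inv-sz s x)) (trans (sym (assoc _ _ _)) (cong (_· gen s) (assoc _ _ _)))

  cover-eq : ∀ s z q → Neg z q → refl-of (e , s) ≡ refl-of (cov z q) → gen s · z ≡ z · gen q
  cover-eq s z q nq eq = trans (cong (_· z) (trans (sym (trans (cong₂ _·_ (idˡ (gen s)) inv-e) (idʳ _))) (trans eq (refl-cov z q))))
    (trans (assoc _ _ _) (trans (cong ((z · gen q) ·_) (invˡ z)) (idʳ _)))

  Neg-add : ∀ s w p → ¬ LD s w → Neg w p → Neg (gen s · w) p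
  Neg-add s w p ¬ld np with Neg? (gen s · w) p
  ... | yes q = q
  ... | no ¬q = ⊥-elim (ℕₚ.<-irrefl refl (ℕₚ.≤-trans (ℕₚ.≤-trans (s≤s (ℕₚ.n≤1+n (len w))) (ℕₚ.≤-reflexive (sym (trans (Pos-len (gen s · w) p ¬q) (cong suc (len-add s w ¬ld))))))
        (ℕₚ.≤-reflexive (cong len (trans (sym (exchange (gen s · w) p s ¬q (subst (λ t → Neg t p) (sym (gen-cancelˡ s w)) np))) (gen-cancelˡ s w))))))

  -- If all descents commute and s is a cover reflection, then w lies in the product of ⟨s⟩
  -- with the parabolic subgroup of the letters commuting with s.
  module CommutingCover (s : Fin n) (cs : List (Fin n)) (w' : Fin N) (¬ld : ¬ LD s w') (d : Sortable (cs ∷ʳ s) w') (uq : Uniq (s ∷ cs))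
    (cm : Commuting (gen s · w')) (q : Fin n) (nq : Neg (gen s · w') q) (eq : gen s · (gen s · w') ≡ (gen s · w') · gen q) where
    private
      w = gen s · w'
      dw : Sortable (s ∷ cs) w
      dw = take ¬ld d
      comm? : ∀ j → Dec (gen s · gen j ≡ gen j · gen s)
      comm? j = gen s · gen j ≟ gen j · gen s
      Z : List (Fin n)
      Z = filter comm? (s ∷ cs)
      s∈Z : s ∈ Z
      s∈Z = ∈-filter⁺ comm? (here refl) refl

      supp-cov : ∀ p → Neg w p → SuppV Z (vec (cov w p) 𝟙)
      supp-cov p np with p ≟ q
      ... | yes refl = λ j j∉ k → trans (trans (proj₂ (proj₂ sv) 𝟙 j k) (ρ-e (α s (proj₁ sv 𝟙)) j k)) (α-other s _ (λ { refl → j∉ s∈Z }) k)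
        where
        sv : Σ (M → M) λ φ → (∀ m → NN m → NN (φ m)) × (∀ m → vec (cov w q) m ≈ vec (e , s) (φ m))
        sv = same-vec (cov w q) (e , s) (cov-simple s w q eq) (cov-pos w q np) (simple-pos s)
      ... | no p≢q = λ j j∉ k → go j j∉ k (j ∈? s ∷ cs)
        where
        u : V
        u = vec (cov w p) 𝟙
        uNN : NNV u
        uNN = vec-pos (cov w p) (cov-pos w p np) 𝟙-NN
        us : ∀ k → u s k ≡ 0ℤ
        us k = trans (cov-vec w p 𝟙 s k) (cong -_ (cover-supp dw uq q nq eq p p≢q np 𝟙 k))
        v : V
        v = ρ w (α p 𝟙)
        -- `gen s · w` equals `w · gen q`, and `q` commutes with `p`, so `s` fixes this root.
        rv : r s v ≈ v
        rv = ≈-trans (≈-sym (ρ-first s w (α p 𝟙))) (≈-trans (subst (λ t → ρ (gen s · w) (α p 𝟙) ≈ ρ t (α p 𝟙)) eq ≈-refl) (≈-trans (ρ-last w q (α p 𝟙)) (ρ-cong w (r-comm p q 𝟙 p≢q (cm p q np nq)))))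
        vs : ∀ k → v s k ≡ 0ℤ
        vs k = cover-supp dw uq q nq eq p p≢q np 𝟙 k
        Nv : ∀ k → Nb s v k ≡ 0ℤ
        Nv k = trans (l (Nb s v k) (v s k)) (trans (cong₂ _+_ (trans (sym (r-same s v k)) (trans (rv s k) (vs k))) (vs k)) refl)
          where
          l : ∀ a b → a ≡ (a - b) + b
          l = solve-∀
        Nu : ∀ k → Nb s u k ≡ 0ℤ
        Nu k = trans (Nb-cong s (cov-vec w p 𝟙) k) (trans (Nb-neg s v k) (cong -_ (Nv k)))
        -- The neighbour sum at `s` vanishes and all its terms are nonnegative, so each of them is
        -- zero. For a letter not commuting with `s`, `A-inj-NN` then removes the coefficient
        -- itself.
        terms : ∀ j k → A (ee s j) (u j) k ≡ 0ℤ
        terms j k = ∑-NN0 (λ j → A (ee s j) (u j) k) (λ j → A-NN (ee s j) (uNN j) k) (Nu k) j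
        go : ∀ j → j ∉ Z → ∀ k → Dec (j ∈ s ∷ cs) → u j k ≡ 0ℤ
        go j j∉ k (no ¬q) = trans (cov-vec w p 𝟙 j k) (cong -_ (SuppV-root (S-InW dw) p 𝟙 (Neg-InW (S-InW dw) p np) j ¬q k))
        go j j∉ k (yes j∈) = noncomm (ee s j) refl
          where
          noncomm : ∀ E → ee s j ≡ E → u j k ≡ 0ℤ
          noncomm zero h = ⊥-elim (j∉ (∈-filter⁺ comm? j∈ (ee0⇒comm s j h)))
          noncomm (suc E) h = A-inj-NN E (u j) (uNN j) (λ k → trans (cong (λ t → A t (u j) k) (sym h)) (terms j k)) k

      -- A nontrivial right factor would provide a descent of `w` whose cover root is not supported
      -- on `Z`.
      inZ : InW Z w
      inZ = subst (InW Z) (sym (trans P.factor (trans (cong (P.left ·_) (triv (P.right ≟ e))) (idʳ _)))) P.inJ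
        where
        module P = Par (par Z w)
        triv : Dec (P.right ≡ e) → P.right ≡ e
        triv (yes p) = p
        triv (no ¬p) = ⊥-elim (Outer.not-supp Z w p np (supp-cov p (Outer.descent Z w p np)))
          where
          p : Fin n
          p = proj₁ (exists-Neg P.right ¬p)
          np : Neg P.right p
          np = proj₂ (exists-Neg P.right ¬p)

    -- On vectors supported on `Z` the reflection `r s` just changes the sign of the `s`-coordinate.
    -- A positive root with a nonzero one would become negative and hence be α_s, which is no
    -- inversion of `w'`.
    free : ∀ β → PosR β → I w' β → ∀ k → vec β 𝟙 s k ≡ 0ℤ
    free β pos h k with vec β 𝟙 s k ℤ.≟ 0ℤ
    ... | yes p = p
    ... | no ¬p = ⊥-elim (¬ld (I-LD {s} {w'} (same-I β (e , s) (simple-refl s β pos notpos) pos (simple-pos s) w' h)))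
      where
      v : V
      v = vec β 𝟙
      hw : I w β
      hw = subst (_⊑ w) (trans (sym eq) (gen-cancelˡ s w')) (cov-⊑ w q nq) β pos h
      sp : SuppV Z v
      sp = InvSupp inZ β pos hw 𝟙
      N0 : ∀ k → Nb s v k ≡ 0ℤ
      N0 k = ∑-0 (λ j → A (ee s j) (v j) k) term
        where
        term : ∀ j → A (ee s j) (v j) k ≡ 0ℤ
        term j with j ∈? Z
        ... | yes j∈ = trans (cong (λ t → A t (v j) k) (comm⇒ee0 s j (proj₂ (∈-filter⁻ comm? {xs = s ∷ cs} j∈)))) (A-triv (v j) k)
        ... | no j∉ = trans (A-cong (ee s j) (sp j j∉) k) (A-0 (ee s j) k)
      notpos : ¬ PosR (gen s ▸ β)
      notpos ps = ¬p (nn-antisym (vec-pos β pos 𝟙-NN s k) (subst (0ℤ ≤_) (trans (vec-▸ (gen s) β 𝟙 s k) (trans (ρ-gen s v s k) (trans (r-same s v k) (trans (cong (λ t → t - v s k) (N0 k)) (ℤₚ.+-identityˡ _)))))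
        (vec-pos (gen s ▸ β) ps 𝟙-NN s k)))

  Box : Fin N → Fin N → Set
  Box w z = z ⊑ w × (∀ β → PosR β → I w β → ¬ I z β → ∃[ p ] Neg w p × refl-of β ≡ refl-of (cov w p))

  -- If `s` is a left descent of `z`, it is stripped from both elements. If not, α_s has been
  -- deleted and is therefore a cover root. Then `z` lies in the box of `w'` and is sortable with
  -- `s` moved to the end; by `CommutingCover.free` none of its inversions involves `s`, so it
  -- equals its own restriction to `cs`.
  box-sortable : ∀ {cs w} → Sortable cs w → Uniq cs → Commuting w → ∀ z → Box w z → Sortable cs z
  box-sortable done uq cm z (le , _) = subst (Sortable []) (⊑-antisym e z (e⊑ z) le) done
  box-sortable (skip d) uq cm z bx = skip (box-sortable d (proj₂ uq) cm z bx)
  box-sortable (take {s} {cs} {w'} ¬ld d) uq cm z (le , bx) = go (LD? s z)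
    where
    w = gen s · w'
    cm' : Commuting w'
    cm' p q np nq = cm p q (Neg-add s w' p ¬ld np) (Neg-add s w' q ¬ld nq)
    go : Dec (LD s z) → Sortable (s ∷ cs) z
    go (yes ld) = subst (Sortable (s ∷ cs)) (gen-cancelˡ s z) (take (LD-strip s z ld) (box-sortable d (Uniq-rot cs uq) cm' (gen s · z)
        (subst (gen s · z ⊑_) (gen-cancelˡ s w') (strip-⊑' s z w ld le) , bx')))
      where
      bx' : ∀ β → PosR β → I w' β → ¬ I (gen s · z) β → ∃[ p ] Neg w' p × refl-of β ≡ refl-of (cov w' p)
      bx' β pos hw hz with pos? (gen s ▸ β)
      ... | no ¬q = ⊥-elim (¬ld (I-LD {s} {w'} (same-I β (e , s) (simple-refl s β pos ¬q) pos (simple-pos s) w' hw)))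
      ... | yes q = found (bx (gen s ▸ β) q (I-add' s w' (gen s ▸ β) (subst (I w') (sym (▸-cancel s β)) hw)) (λ h → hz (I-add' s z β h)))
        where
        found : (∃[ p ] Neg w p × refl-of (gen s ▸ β) ≡ refl-of (cov w p)) → ∃[ p ] Neg w' p × refl-of β ≡ refl-of (cov w' p)
        found (p , np , eq) with Neg? w' p
        ... | yes np' = p , np' , trans (cong refl-of (sym (▸-cancel s β))) (trans (refl-▸ s (gen s ▸ β) (cov w p) eq) (cong refl-of (cov-s s w' p)))
        ... | no ¬np' = ⊥-elim (hz (I-add' s z β (same-I (e , s) (gen s ▸ β) (sym (trans eq (cov-simple s w p ex))) (simple-pos s) q z (LD-I {s} {z} ld))))
          where
          ex : gen s · w ≡ w · gen p
          ex = trans (gen-cancelˡ s w') (sym (trans (cong (_· gen p) (exchange w' p s ¬np' np)) (gen-cancelʳ p w')))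
    go (no ¬lz) = covered (bx (e , s) (simple-pos s) (LD-I {s} {w} (LD-add s w' ¬ld)) (λ h → ¬lz (I-LD {s} {z} h)))
      where
      covered : (∃[ q ] Neg w q × refl-of (e , s) ≡ refl-of (cov w q)) → Sortable (s ∷ cs) z
      covered (q , nq , eq) = skip (subst (Sortable cs) (⊑-antisym R.k z R.le z⊑k) R.srt)
        where
        ex : gen s · w ≡ w · gen q
        ex = cover-eq s w q nq eq
        wq≡w' : w · gen q ≡ w'
        wq≡w' = trans (sym ex) (gen-cancelˡ s w')
        z⊑w' : z ⊑ w'
        z⊑w' = subst (z ⊑_) wq≡w' (cov-below z w q nq le (λ h → ¬lz (I-LD {s} {z} (same-I (cov w q) (e , s) (sym eq) (cov-pos w q nq) (simple-pos s) z h))))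
        bx' : ∀ β → PosR β → I w' β → ¬ I z β → ∃[ p ] Neg w' p × refl-of β ≡ refl-of (cov w' p)
        bx' β pos hw hz = found (bx β pos (subst (_⊑ w) wq≡w' (cov-⊑ w q nq) β pos hw) hz)
          where
          found : (∃[ p ] Neg w p × refl-of β ≡ refl-of (cov w p)) → ∃[ p ] Neg w' p × refl-of β ≡ refl-of (cov w' p)
          found (p , np , eqp) with p ≟ q
          ... | yes refl = ⊥-elim (cov-out w q (subst (λ t → I t (cov w q)) (sym wq≡w') (same-I β (cov w q) eqp pos (cov-pos w q nq) w' hw)))
          ... | no p≢q = p , subst (λ t → Neg t p) wq≡w' (Neg-comm w p q p≢q (cm p q np nq) np) ,
                trans eqp (trans (sym (refl-cov-comm w p q (cm p q np nq))) (cong (λ t → refl-of (cov t p)) wq≡w'))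
        dz : Sortable (cs ∷ʳ s) z
        dz = box-sortable d (Uniq-rot cs uq) cm' z (z⊑w' , bx')
        module R = Restr (restrict dz (Uniq-rot cs uq) s (Rem-last s cs))
        z⊑k : z ⊑ R.k
        z⊑k β pos h = R.full β pos h (supp-tail {v = vec β 𝟙} (SuppV-mono {v = vec β 𝟙} (rot-∈ cs) (InvSupp (S-InW dz) β pos h 𝟙))
          (CommutingCover.free s cs w' ¬ld d uq cm q nq ex β pos (z⊑w' β pos h)))

  del : Fin N → List (Fin n) → Fin N
  del w []       = w
  del w (p ∷ ps) = del w ps · gen p

  module Del (w : Fin N) (cm : Commuting w) where
    Desc : List (Fin n) → Set
    Desc ps = ∀ q → q ∈ ps → Neg w q

    del-vec : ∀ ps → Desc ps → ∀ p → Neg w p → p ∉ ps → ∀ m → ρ (del w ps) (α p m) ≈ ρ w (α p m)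
    del-vec [] _ p np p∉ m = ≈-refl
    del-vec (q ∷ ps) ds p np p∉ m = ≈-trans (ρ-last (del w ps) q (α p m)) (≈-trans (ρ-cong (del w ps) (r-comm p q m (λ { refl → p∉ (here refl) }) (cm p q np (ds q (here refl)))))
      (del-vec ps (λ q m → ds q (there m)) p np (p∉ ∘ there) m))

    del-Neg : ∀ ps → Desc ps → ∀ p → Neg w p → p ∉ ps → Neg (del w ps) p
    del-Neg ps ds p np p∉ = sign-neg (del w ps) p (NNV-≈ (⊖-cong (≈-sym (del-vec ps ds p np p∉ 𝟙))) (neg-vec w p np 𝟙-NN))

    del-refl : ∀ ps → Desc ps → ∀ p → Neg w p → refl-of (cov (del w ps) p) ≡ refl-of (cov w p)
    del-refl [] _ p np = refl
    del-refl (q ∷ ps) ds p np = trans (refl-cov-comm (del w ps) p q (cm p q np (ds q (here refl)))) (del-refl ps (λ q m → ds q (there m)) p np)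

    del-⊑ : ∀ ps → Uniq ps → Desc ps → del w ps ⊑ w
    del-⊑ [] _ _ = ⊑-refl
    del-⊑ (p ∷ ps) (p∉ , u) ds = ⊑-trans {del w ps · gen p} {del w ps} {w} (cov-⊑ (del w ps) p (del-Neg ps (λ q m → ds q (there m)) p (ds p (here refl)) p∉)) (del-⊑ ps u (λ q m → ds q (there m)))

    del-out : ∀ ps → Uniq ps → Desc ps → ∀ p → p ∈ ps → ¬ I (del w ps) (cov w p)
    del-out (p ∷ ps) (p∉ , u) ds .p (here refl) h = cov-out (del w ps) p (same-I (cov w p) (cov (del w ps) p) (sym (del-refl ps ds' p np)) (cov-pos w p np)
        (cov-pos (del w ps) p (del-Neg ps ds' p np p∉)) (del w ps · gen p) h)
      where
      ds' : Desc ps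
      ds' q m = ds q (there m)
      np = ds p (here refl)
    del-out (q ∷ ps) (q∉ , u) ds p (there p∈) h = del-out ps u ds' p p∈ (cov-⊑ (del w ps) q (del-Neg ps ds' q (ds q (here refl)) q∉) (cov w p) (cov-pos w p (ds p (there p∈))) h)
      where
      ds' : Desc ps
      ds' q m = ds q (there m)

    del-in : ∀ ps → Uniq ps → Desc ps → ∀ β → PosR β → I w β → ¬ I (del w ps) β → ∃[ p ] p ∈ ps × refl-of β ≡ refl-of (cov w p)
    del-in [] _ _ β pos h ¬h = ⊥-elim (¬h h)
    del-in (p ∷ ps) (p∉ , u) ds β pos h ¬h with I? (del w ps) β
    ... | yes q = p , here refl , trans (cov-unique (del w ps) p β q ¬h) (del-refl ps (λ q m → ds q (there m)) p (ds p (here refl)))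
    ... | no ¬q with del-in ps u (λ q m → ds q (there m)) β pos h ¬q
    ... | p' , p'∈ , eq = p' , there p'∈ , eq

  refl-cov-inj : ∀ w p q → refl-of (cov w p) ≡ refl-of (cov w q) → p ≡ q
  refl-cov-inj w p q eq = gen-injective p q (cancelˡ w (cancelʳ (inv w) (trans (sym (refl-cov w p)) (trans eq (refl-cov w q)))))

  -- Each pair of neighbouring letters is seen by exactly one of the two orders. The first letter is
  -- split off with `zap`, and its part of `B` is evaluated through the coroot pairing.
  E-symmetrized : ∀ c cs x y → Uniq cs → SuppV cs x → SuppV cs y → E c cs x y + E c cs y x ≡ EF.B c x y
  E-symmetrized c [] x y u sx sy = sym (∑-0 (λ i → EF.⟨_,_⟩ c (x i) (cv i y)) (λ i → pair-0ˡ (cut c) (cv i y) (sx i (λ ()))))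
  E-symmetrized c (s ∷ cs) x y uq@(s∉ , u) sx sy = begin
    ((⟨ x s , y s ⟩ + - ⟨ x s , lnb s cs y ⟩) + E c cs x y) + ((⟨ y s , x s ⟩ + - ⟨ y s , lnb s cs x ⟩) + E c cs y x)
      ≡⟨ cong₂ (λ a b → ((⟨ x s , y s ⟩ + - ⟨ x s , lnb s cs y ⟩) + E c cs x y) + ((a + - b) + E c cs y x)) (pair-comm K (y s) (x s)) (pair-comm K (y s) (lnb s cs x)) ⟩
    ((⟨ x s , y s ⟩ + - ⟨ x s , lnb s cs y ⟩) + E c cs x y) + ((⟨ x s , y s ⟩ + - ⟨ lnb s cs x , y s ⟩) + E c cs y x)
      ≡⟨ l ⟨ x s , y s ⟩ ⟨ x s , lnb s cs y ⟩ (E c cs x y) ⟨ lnb s cs x , y s ⟩ (E c cs y x) ⟩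
    ((⟨ x s , y s ⟩ + ⟨ x s , y s ⟩) + - ⟨ x s , lnb s cs y ⟩) + (- ⟨ lnb s cs x , y s ⟩ + (E c cs x y + E c cs y x))
      ≡⟨ cong (λ t → ((⟨ x s , y s ⟩ + ⟨ x s , y s ⟩) + - ⟨ x s , lnb s cs y ⟩) + (- ⟨ lnb s cs x , y s ⟩ + t))
          (trans (cong₂ _+_ (E-agree cs (off x) (off y)) (E-agree cs (off y) (off x))) (E-symmetrized c cs (zap s x) (zap s y) u (zap-supp s cs x sx) (zap-supp s cs y sy))) ⟩
    ((⟨ x s , y s ⟩ + ⟨ x s , y s ⟩) + - ⟨ x s , lnb s cs y ⟩) + (- ⟨ lnb s cs x , y s ⟩ + B (zap s x) (zap s y))
      ≡⟨ sym (cong₂ _+_ cvy cvx) ⟩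
    ⟨ x s , cv s y ⟩ + (⟨ cv s (zap s x) , y s ⟩ + B (zap s x) (zap s y))
      ≡⟨ cong₂ _+_ (sym (B-αˡ s (x s) y)) (cong (λ t → t + B (zap s x) (zap s y)) (trans (pair-comm K (cv s (zap s x)) (y s)) (trans (sym (B-αˡ s (y s) (zap s x))) (B-sym (α s (y s)) (zap s x))))) ⟩
    B (α s (x s)) y + (B (zap s x) (α s (y s)) + B (zap s x) (zap s y))
      ≡⟨ cong (λ t → B (α s (x s)) y + t) (trans (B+ʳ (zap s x) (α s (y s)) (zap s y)) (B-cong {x = zap s x} ≈-refl (≈-sym (zap-split s y)))) ⟩
    B (α s (x s)) y + B (zap s x) y ≡⟨ sym (B-+ˡ (α s (x s)) (zap s x) y) ⟩
    B (α s (x s) ⊕ zap s x) y ≡⟨ B-cong {y = y} (≈-sym (zap-split s x)) ≈-refl ⟩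
    B x y ∎
    where
    open EF c using (⟨_,_⟩; B; B-sym; B-+ˡ; B-αˡ; B-cong; E-agree; K)
    off : ∀ z q → q ∈ cs → ∀ k → z q k ≡ zap s z q k
    off z q q∈ k = sym (zap-other {s} z (λ { refl → s∉ q∈ }) k)
    B+ʳ : ∀ x y z → B x y + B x z ≡ B x (y ⊕ z)
    B+ʳ x y z = sym (trans (B-sym x (y ⊕ z)) (trans (B-+ˡ y z x) (cong₂ _+_ (B-sym y x) (B-sym z x))))
    l : ∀ a b c d e → ((a + - b) + c) + ((a + - d) + e) ≡ ((a + a) + - b) + (- d + (c + e))
    l = solve-∀
    cvy : ⟨ x s , cv s y ⟩ ≡ (⟨ x s , y s ⟩ + ⟨ x s , y s ⟩) + - ⟨ x s , lnb s cs y ⟩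
    cvy = trans (pair-cong K {x s} (λ _ → refl) (λ k → trans (cong (λ t → + 2 * y s k - t) (Nb-tail s cs y uq sy k)) (l2 (y s k) (lnb s cs y k))))
      (trans (pair-+ʳ K (x s) (λ k → y s k + y s k) (λ k → - lnb s cs y k)) (cong₂ _+_ (pair-+ʳ K (x s) (y s) (y s)) (pair-negʳ K (x s) (lnb s cs y))))
      where
      l2 : ∀ a b → + 2 * a - b ≡ (a + a) + - b
      l2 = solve-∀
    cvx : ⟨ cv s (zap s x) , y s ⟩ + B (zap s x) (zap s y) ≡ - ⟨ lnb s cs x , y s ⟩ + B (zap s x) (zap s y)
    cvx = cong (λ t → t + B (zap s x) (zap s y)) (trans (pair-cong K {y = y s} (λ k → trans (cong₂ (λ a b → + 2 * a - b) (zap-same s x k)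
        (trans (Nb-lnb s cs (zap s x) u (zap-supp s cs x sx) k) (sym (lnb-agree s cs (off x) k)))) (ℤₚ.+-identityˡ _)) (λ _ → refl)) (pair-negˡ K (lnb s cs x) (y s)))

  -- Rotation preserves the value until `p` is skipped, and there the root has become α_p itself.
  E-self : ∀ {cs w} (d : Sortable cs w) p → Uniq cs → p ∈ cs → Fix d p → ∀ c m m' → E c cs (ρ w (α p m)) (ρ w (α p m')) ≡ pairing c m m'
  E-self (take {t} {cs} {w} ¬ld d) p uq p∈ fp c m m' = trans (EF.E-cong c (t ∷ cs) (ρ-first t w (α p m)) (ρ-first t w (α p m')))
    (trans (EF.E-rot c t cs (ρ w (α p m)) (ρ w (α p m')) uq (sp m) (sp m')) (E-self d p (Uniq-rot cs uq) (unrot-∈ cs p∈) fp c m m'))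
    where
    sp : ∀ m → SuppV (t ∷ cs) (ρ w (α p m))
    sp m = SuppV-mono {v = ρ w (α p m)} (rot-∈ cs) (SuppV-root (S-InW d) p m (unrot-∈ cs p∈))
  E-self {w = w} (skip {t} {cs} d) p uq p∈ (inj₁ (refl , fx)) c m m' = trans (EF.E-cong c (t ∷ cs) (fx m) (fx m')) (trans (EF.E-simpleʳ c t cs (α t m) m' (proj₁ uq)) (pair-cong (cut c) {y = m'} (α-same t m) (λ _ → refl)))
  E-self {w = w} (skip {t} {cs} d) p uq p∈ (inj₂ (p≢t , fp)) c m m' = trans (EF.E-skip c t cs (ρ w (α p m)) (ρ w (α p m')) (λ k → trans (InW-vec (S-InW d) (α p m) t (proj₁ uq) k) (α-other p m p≢t k)))
    (E-self d p (proj₂ uq) (tl p∈) fp c m m')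
    where
    tl : p ∈ t ∷ cs → p ∈ cs
    tl (here q) = ⊥-elim (p≢t q)
    tl (there q) = q

  sortable-e : ∀ cs → Sortable cs e
  sortable-e [] = done
  sortable-e (s ∷ cs) = skip (sortable-e cs)

  -- Pairs of descents that do not commute.

  module Pair (w : Fin N) (p q : Fin n) (np : Neg w p) (nq : Neg w q) (nc : gen p · gen q ≢ gen q · gen p) where
    p≢q : p ≢ q
    p≢q refl = nc refl

    nq' : Neg (w · gen p) q
    nq' = sign-neg (w · gen p) q (NNV-≈ (⊖-cong (≈-sym (≈-trans (ρ-last w p (α q 𝟙)) (≈-trans (ρ-cong w (r-α-other p q 𝟙 (p≢q ∘ sym))) (ρ-⊕ w (α q 𝟙) (α p (A (ee p q) 𝟙)))))))
      λ i k → subst (0ℤ ≤_) (sym (ℤₚ.neg-distrib-+ (ρ w (α q 𝟙) i k) (ρ w (α p (A (ee p q) 𝟙)) i k))) (+-NN (neg-vec w q nq 𝟙-NN i k) (neg-vec w p np (A-NN (ee p q) 𝟙-NN) i k)))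

    low : Fin N
    low = (w · gen p) · gen q

    mid : Root
    mid = cov (w · gen p) q

    mid-vec : ∀ m → vec mid m ≈ vec (cov w q) m ⊕ vec (cov w p) (A (ee p q) m)
    mid-vec m = ≈-trans (cov-vec (w · gen p) q m) (≈-trans (⊖-cong (≈-trans (ρ-last w p (α q m)) (≈-trans (ρ-cong w (r-α-other p q m (p≢q ∘ sym))) (ρ-⊕ w (α q m) (α p (A (ee p q) m))))))
      λ i k → trans (ℤₚ.neg-distrib-+ (ρ w (α q m) i k) (ρ w (α p (A (ee p q) m)) i k)) (sym (cong₂ _+_ (cov-vec w q m i k) (cov-vec w p (A (ee p q) m) i k))))

    refl-mid : refl-of mid ≢ refl-of (cov w q)
    refl-mid eq = nc (cancelʳ (gen p) (trans (cancelˡ w (cancelʳ (inv w) (begin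
      (w · ((gen p · gen q) · gen p)) · inv w ≡⟨ cong (_· inv w) (trans (cong (w ·_) (assoc _ _ _)) (sym (assoc _ _ _))) ⟩
      ((w · gen p) · (gen q · gen p)) · inv w ≡⟨ trans (cong (_· inv w) (sym (assoc _ _ _))) (assoc _ _ _) ⟩
      ((w · gen p) · gen q) · (gen p · inv w) ≡⟨ cong (((w · gen p) · gen q) ·_) (sym (trans (inv-· w (gen p)) (cong (_· inv w) (inv-gen p)))) ⟩
      ((w · gen p) · gen q) · inv (w · gen p) ≡⟨ sym (refl-cov (w · gen p) q) ⟩
      refl-of mid ≡⟨ eq ⟩
      refl-of (cov w q) ≡⟨ refl-cov w q ⟩
      (w · gen q) · inv w ∎))) (sym (gen-cancelʳ p (gen q)))))

    -- Going from `w` to `low` deletes only the cover root of `p` and `mid`; the latter differs from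
    -- the cover root of `q` because `p` and `q` do not commute.
    low-has : I low (cov w q)
    low-has with I? low (cov w q)
    ... | yes h = h
    ... | no ¬h with I? (w · gen p) (cov w q)
    ... | no ¬h' = ⊥-elim (p≢q (sym (refl-cov-inj w q p (cov-unique w p (cov w q) (cov-in w q) ¬h'))))
    ... | yes h' = ⊥-elim (refl-mid (sym (cov-unique (w · gen p) q (cov w q) h' ¬h)))

    -- `mid` is a nonnegative combination of the two cover roots, neither of which is an inversion
    -- of `g`, so it is no inversion of `g` either.
    low-glb : ∀ g → g ⊑ w · gen p → g ⊑ w · gen q → g ⊑ low
    low-glb g gp gq = cov-below g (w · gen p) q nq' gp (I-from-pos g mid (NNV-≈ (≈-sym (≈-trans (ρ-cong (inv g) (mid-vec 𝟙)) (ρ-⊕ (inv g) (vec (cov w q) 𝟙) (vec (cov w p) (A (ee p q) 𝟙)))))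
      λ i k → +-NN (I-vec-pos g (cov w q) (λ h → cov-out w q (gq (cov w q) (cov-pos w q nq) h)) 𝟙-NN i k)
        (I-vec-pos g (cov w p) (λ h → cov-out w p (gp (cov w p) (cov-pos w p np) h)) (A-NN (ee p q) 𝟙-NN) i k)))

    low-⊑ : low ⊑ w · gen p
    low-⊑ = cov-⊑ (w · gen p) q nq'

    mid-in-q : I (w · gen q) mid
    mid-in-q with I? (w · gen q) mid
    ... | yes h = h
    ... | no ¬h = ⊥-elim (refl-mid (cov-unique w q mid (cov-⊑ w p np mid (cov-pos (w · gen p) q nq') (cov-in (w · gen p) q)) ¬h))

    ee-suc : ∃[ E ] ee p q ≡ suc E
    ee-suc = go (ee p q) refl
      where
      go : ∀ E → ee p q ≡ E → ∃[ E ] ee p q ≡ suc E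
      go zero h = ⊥-elim (nc (ee0⇒comm p q h))
      go (suc E) h = E , h

    module Oriented (cs : List (Fin n)) (d : Sortable cs w) (uq : Uniq cs) (or : ∀ c m m' → E c cs (ρ w (α p m)) (ρ w (α q m')) ≡ 0ℤ) where
      private
        p∈ = Neg-InW (S-InW d) p np
        q∈ = Neg-InW (S-InW d) q nq
        neg² : ∀ c x y → E c cs (⊖ x) (⊖ y) ≡ E c cs x y
        neg² c x y = trans (EF.E-negˡ c cs x (⊖ y)) (trans (cong -_ (EF.E-negʳ c cs x y)) (ℤₚ.neg-involutive _))
        E-cov : ∀ i j c m m' → E c cs (vec (cov w i) m) (vec (cov w j) m') ≡ E c cs (ρ w (α i m)) (ρ w (α j m'))
        E-cov i j c m m' = trans (EF.E-cong c cs (cov-vec w i m) (cov-vec w j m')) (neg² c (ρ w (α i m)) (ρ w (α j m')))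

      rev : ∀ c m m' → E c cs (ρ w (α q m)) (ρ w (α p m')) ≡ - pairing c (A (ee p q) m) m'
      rev c m m' = trans (sym (trans (cong (λ t → E c cs (ρ w (α q m)) (ρ w (α p m')) + t) (or c m' m)) (ℤₚ.+-identityʳ _)))
        (trans (E-symmetrized c cs (ρ w (α q m)) (ρ w (α p m')) uq (SuppV-root (S-InW d) q m q∈) (SuppV-root (S-InW d) p m' p∈))
          (trans (EF.B-ρ c w (α q m) (α p m')) (trans (EF.B-αˡ c q m (α p m')) (trans (pair-cong (cut c) {m} (λ _ → refl) (cv-α-other q p m' p≢q))
            (trans (pair-negʳ (cut c) m (A (ee q p) m')) (cong -_ (sym (EF.A-adj c p q m m'))))))))

      E-mid : ∀ j c m m' → E c cs (vec mid m) (vec (cov w j) m') ≡ E c cs (ρ w (α q m)) (ρ w (α j m')) + E c cs (ρ w (α p (A (ee p q) m))) (ρ w (α j m'))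
      E-mid j c m m' = trans (EF.E-cong c cs (mid-vec m) (≈-refl {vec (cov w j) m'})) (trans (EF.E-+ˡ c cs (vec (cov w q) m) (vec (cov w p) (A (ee p q) m)) (vec (cov w j) m'))
        (cong₂ _+_ (E-cov q j c m m') (E-cov p j c (A (ee p q) m) m')))

      mid-pos : PosR mid
      mid-pos = cov-pos (w · gen p) q nq'

      mid-in-w : I w mid
      mid-in-w = cov-⊑ w p np mid mid-pos (cov-in (w · gen p) q)

      -- E(mid, β_p) is zero: by `rev` the contribution of β_q is minus the pairing with `A`, and by
      -- `E-self` that of the multiple of β_p cancels it.
      mid-in : (L : Lower cs w p) → I (Lower.y L) mid
      mid-in L = Lower.U L mid mid-pos mid-in-w (λ c m m' _ _ → ℤₚ.≤-reflexive (trans (E-mid p c m m')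
        (trans (cong₂ _+_ (rev c m m') (E-self d p uq p∈ (descent⇒Fix d p uq np) c (A (ee p q) m) m')) (ℤₚ.+-inverseˡ (pairing c (A (ee p q) m) m')))))

      -- By the orientation E(mid, β_q) equals E(β_q, β_q). If `mid` were in the lower cover, `H`
      -- would make this nonpositive, and `U` would put β_q itself below `w · gen q`.
      mid-out : (L : Lower cs w q) → ¬ I (Lower.y L) mid
      mid-out L h = cov-out w q (Lower.below L (cov w q) (cov-pos w q nq) (Lower.U L (cov w q) (cov-pos w q nq) (cov-in w q)
        λ c m m' hm hm' → subst (_≤ 0ℤ) (trans (E-mid q c m m') (trans (cong₂ _+_ (sym (E-cov q q c m m')) (or c (A (ee p q) m) m')) (ℤₚ.+-identityʳ _))) (Lower.H L mid mid-pos h c m m' hm hm')))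

      A-pos : ¬ (∀ c m m' → NN m → NN m' → pairing c (A (ee p q) m) m' ≤ 0ℤ)
      A-pos h with ee-suc
      ... | E' , eq = one≢0 (A-inj-NN E' 𝟙 𝟙-NN (λ k → trans (cong (λ t → A t 𝟙 k) (sym eq)) (zero' k)) 0)
        where
        one≢0 : ¬ (1ℤ ≡ 0ℤ)
        one≢0 ()
        zero' : ∀ k → A (ee p q) 𝟙 k ≡ 0ℤ
        zero' k = ℤₚ.≤-antisym (subst (_≤ 0ℤ) (trans (pair-comm (cut k) (A (ee p q) 𝟙) (δ k)) (pair-δ (cut k) k (A (ee p q) 𝟙) (cut-big k))) (h k 𝟙 (δ k) 𝟙-NN (δ-NN k))) (A-NN (ee p q) 𝟙-NN k)

  -- `low` need not be sortable, but the pentagon needs a sortable element below it that keeps β_q.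
  -- Letters are stripped until β_q becomes simple, and then that simple reflection is the witness.
  sortable-low : ∀ {cs w} (d : Sortable cs w) → Uniq cs → ∀ p q (np : Neg w p) (nq : Neg w q) (nc : gen p · gen q ≢ gen q · gen p) →
    (∀ c m m' → E c cs (ρ w (α p m)) (ρ w (α q m')) ≡ 0ℤ) → ∃[ z ] Sortable cs z × z ⊑ (w · gen p) · gen q × I z (cov w q)
  sortable-low done uq p q np nq nc or with Neg-InW {[]} one p np
  ... | ()
  sortable-low {w = w} (skip {s} {cs} d) uq p q np nq nc or = proj₁ ih , skip (proj₁ (proj₂ ih)) , proj₂ (proj₂ ih)
    where
    p≢s : p ≢ s
    p≢s refl = proj₁ uq (Neg-InW (S-InW d) p np)
    ih : ∃[ z ] Sortable cs z × z ⊑ (w · gen p) · gen q × I z (cov w q)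
    ih = sortable-low d (proj₂ uq) p q np nq nc (λ c m m' → trans (sym (EF.E-skip c s cs (ρ w (α p m)) (ρ w (α q m')) (λ k → trans (InW-vec (S-InW d) (α p m) s (proj₁ uq) k) (α-other p m p≢s k)))) (or c m m'))
  sortable-low (take {s} {cs} {w'} ¬ld d) uq p q np nq nc or = go (Neg? w' q) (Neg? w' p)
    where
    w = gen s · w'
    dw : Sortable (s ∷ cs) w
    dw = take ¬ld d
    module Pr = Pair w p q np nq nc
    module Or = Pr.Oriented (s ∷ cs) dw uq or
    go : Dec (Neg w' q) → Dec (Neg w' p) → ∃[ z ] Sortable (s ∷ cs) z × z ⊑ (w · gen p) · gen q × I z (cov w q)
    go (no ¬nq) _ = gen s , subst (Sortable (s ∷ cs)) (idʳ (gen s)) (take (λ h → ¬Neg-e s (subst (λ t → Neg t s) inv-e h)) (sortable-e (cs ∷ʳ s))) ,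
        gen-⊑ s Pr.low (I-LD {s} {Pr.low} (same-I (cov w q) (e , s) rc (cov-pos w q nq) (simple-pos s) Pr.low Pr.low-has)) ,
        same-I (e , s) (cov w q) (sym rc) (simple-pos s) (cov-pos w q nq) (gen s) (LD-I {s} {gen s} (subst (λ t → Neg t s) (trans (idˡ _) (sym (inv-gen s))) (Pos-flip e s (¬Neg-e s))))
      where
      rc : refl-of (cov w q) ≡ refl-of (e , s)
      rc = cov-simple s w q (trans (gen-cancelˡ s w') (sym (trans (cong (_· gen q) (exchange w' q s ¬nq nq)) (gen-cancelʳ q w'))))
    -- β_p cannot become simple first: then E(β_q, β_p) would be a pairing of nonnegative
    -- coordinates, whereas by `rev` it is minus a pairing with `A`, and `A` is nonzero for a
    -- non-commuting pair.
    go (yes _) (no ¬np) = ⊥-elim (Or.A-pos λ c m m' hm hm' → ℤₚ.neg-cancel-≤ (subst (0ℤ ≤_) (val c m m') (pair-NN (cut c) (posv m hm s) (posθ m' hm'))))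
      where
      ex : gen s · w ≡ w · gen p
      ex = trans (gen-cancelˡ s w') (sym (trans (cong (_· gen p) (exchange w' p s ¬np np)) (gen-cancelʳ p w')))
      θ : M → M
      θ m k = - ρ w (α p m) s k
      posθ : ∀ m → NN m → NN (θ m)
      posθ m hm k = neg-vec w p np hm s k
      posv : ∀ m → NN m → NNV (⊖ ρ w (α q m))
      posv m hm = neg-vec w q nq hm
      val : ∀ c m m' → pairing c (λ k → - ρ w (α q m) s k) (θ m') ≡ - pairing c (A (ee p q) m) m'
      val c m m' = trans (pair-negˡ (cut c) (ρ w (α q m) s) (θ m')) (trans (cong -_ (pair-negʳ (cut c) (ρ w (α q m) s) (ρ w (α p m') s))) (trans (ℤₚ.neg-involutive _)
        (trans (sym (EF.E-simpleʳ c s cs (ρ w (α q m)) (ρ w (α p m') s) (proj₁ uq))) (trans (EF.E-cong c (s ∷ cs) (≈-refl {ρ w (α q m)}) (≈-sym (conj-supp w p s ex m'))) (Or.rev c m m')))))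
    go (yes nq') (yes np') = gen s · z' , take ¬ldz (proj₁ (proj₂ ih)) ,
        subst (gen s · z' ⊑_) (trans (sym (assoc _ _ _)) (cong (_· gen q) (sym (assoc _ _ _)))) (add-⊑ s z' low' ¬ldl (proj₁ (proj₂ (proj₂ ih)))) ,
        I-add' s z' (cov w q) (subst (I z') (sym (cov-s s w' q)) (proj₂ (proj₂ (proj₂ ih))))
      where
      sp : ∀ p → Neg w' p → ∀ m → SuppV (s ∷ cs) (ρ w' (α p m))
      sp p np m = SuppV-mono {v = ρ w' (α p m)} (rot-∈ cs) (SuppV-root (S-InW d) p m (Neg-InW (S-InW d) p np))
      ih : ∃[ z ] Sortable (cs ∷ʳ s) z × z ⊑ (w' · gen p) · gen q × I z (cov w' q)
      ih = sortable-low d (Uniq-rot cs uq) p q np' nq' nc (λ c m m' → trans (sym (EF.E-rot c s cs (ρ w' (α p m)) (ρ w' (α q m')) uq (sp p np' m) (sp q nq' m')))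
        (trans (EF.E-cong c (s ∷ cs) (≈-sym (ρ-first s w' (α p m))) (≈-sym (ρ-first s w' (α q m')))) (or c m m')))
      module Pr' = Pair w' p q np' nq' nc
      low' = (w' · gen p) · gen q
      z' = proj₁ ih
      low'⊑ : low' ⊑ w'
      low'⊑ = ⊑-trans {low'} {w' · gen p} {w'} Pr'.low-⊑ (cov-⊑ w' p np')
      ¬ldl : ¬ LD s low'
      ¬ldl h = ¬ld (LD-⊑ {s} {low'} {w'} low'⊑ h)
      ¬ldz : ¬ LD s z'
      ¬ldz h = ¬ldl (LD-⊑ {s} {z'} {low'} (proj₁ (proj₂ (proj₂ ih))) h)

  -- Unless `y` is below `x`, the meet of the two in the weak order lies under some `y · gen p`.
  -- Every sortable lower bound then lies under the Cambrian lower cover of `y` at `p`, which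
  -- replaces `y`.
  sortable-below : ∀ {cs} → Uniq cs → ∀ y → Sortable cs y → ∀ x → ∃[ z ] Sortable cs z × z ⊑ y × z ⊑ x × (∀ v → Sortable cs v → v ⊑ y → v ⊑ x → v ⊑ z)
  sortable-below {cs} uq y dy x = go (len y) y dy ℕₚ.≤-refl
    where
    Goal : Fin N → Set
    Goal y = ∃[ z ] Sortable cs z × z ⊑ y × z ⊑ x × (∀ v → Sortable cs v → v ⊑ y → v ⊑ x → v ⊑ z)
    go : ∀ b y → Sortable cs y → len y ℕ.≤ b → Goal y
    go b y dy le = decide (G.meet ≟ y)
      where
      module G = Glb (glb y x)
      step : ∀ b → len y ℕ.≤ b → (∃[ p ] Neg y p × G.meet ⊑ y · gen p) → Goal y
      step zero le (p , np , _) = ⊥-elim (ℕₚ.n≮0 (ℕₚ.≤-trans np le))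
      step (suc b) le (p , np , mp) = z , proj₁ (proj₂ rec) , ⊑-trans {z} {L.y} {y} (proj₁ (proj₂ (proj₂ rec))) (⊑-trans {L.y} {y · gen p} {y} L.below (cov-⊑ y p np)) ,
          proj₁ (proj₂ (proj₂ (proj₂ rec))) , λ v dv vy vx → proj₂ (proj₂ (proj₂ (proj₂ rec))) v dv (mx v dv (⊑-trans {v} {G.meet} {y · gen p} (G.great v vy vx) mp)) vx
        where
        Lm = lower dy uq p np
        module L = Lower (proj₁ Lm)
        mx = proj₂ Lm
        rec : Goal L.y
        rec = go b L.y L.srt (ℕₚ.≤-pred (ℕₚ.≤-trans (ℕₚ.≤-trans (s≤s (⊑-len L.y (y · gen p) L.below)) np) le))
        z = proj₁ rec
      decide : Dec (G.meet ≡ y) → Goal y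
      decide (yes eq) = y , dy , ⊑-refl , subst (_⊑ x) eq G.leʳ , λ v _ vy _ → vy
      decide (no ¬eq) = step b le (⊑-cover G.meet y G.leˡ ¬eq)

-- Sorting words and the recursive description of sortability.

module SortingWords (C : CoxeterSystem) (cw : Vec (Fin (CoxeterSystem.n C)) (CoxeterSystem.n C)) (inj : IsCoxeterWord C cw) where

  open Representation C
  open Positivity C
  open WeakOrder C
  open EulerForm C
  open CambrianCovers C
  open Descents C
  open import Data.List.Membership.DecPropositional (_≟_ {n}) using (_∈?_)

  reduced-letters : ∀ {J} ws → InW J (prodW ws) → len (prodW ws) ≡ length ws → ∀ a → a ∈ ws → a ∈ J
  reduced-letters {J} (x ∷ ws) iw l = go
    where
    w = prodW (x ∷ ws)
    ld : LD x w
    ld with LD? x w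
    ... | yes p = p
    ... | no ¬p = ⊥-elim (ℕₚ.<-irrefl refl (ℕₚ.≤-trans (ℕₚ.≤-trans (s≤s (ℕₚ.n≤1+n (length ws))) (ℕₚ.≤-reflexive (cong suc (sym l))))
        (ℕₚ.≤-trans (ℕₚ.≤-reflexive (sym (len-add x w ¬p))) (subst (λ t → len t ℕ.≤ length ws) (sym (gen-cancelˡ x (prodW ws))) (len-min ws)))))
    x∈ : x ∈ J
    x∈ with x ∈? J
    ... | yes p = p
    ... | no ¬p = ⊥-elim (¬LD-InW ¬p iw ld)
    l' : len (prodW ws) ≡ length ws
    l' = ℕₚ.suc-injective (trans (cong (λ t → suc (len t)) (sym (gen-cancelˡ x (prodW ws)))) (trans (sym (len-strip x w ld)) l))
    go : ∀ a → a ∈ x ∷ ws → a ∈ J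
    go a (here refl) = x∈
    go a (there m) = reduced-letters ws (subst (InW J) (gen-cancelˡ x (prodW ws)) (mul x∈ iw)) l' a m

  P : Set
  P = Pos C

  infix 4 _<p_
  _<p_ : P → P → Set
  _<p_ = _<P_ C

  ltr : P → Fin n
  ltr p = lookup cw (proj₂ p)

  shift : P → P
  shift (k , a) = (suc k , a)

  <p-trans : ∀ {p q r} → p <p q → q <p r → p <p r
  <p-trans (inj₁ a) (inj₁ b) = inj₁ (ℕₚ.<-trans a b)
  <p-trans (inj₁ a) (inj₂ (refl , _)) = inj₁ a
  <p-trans (inj₂ (refl , _)) (inj₁ b) = inj₁ b
  <p-trans (inj₂ (refl , a)) (inj₂ (refl , b)) = inj₂ (refl , ℕₚ.<-trans a b)

  <p-irrefl : ∀ {p} → ¬ (p <p p)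
  <p-irrefl (inj₁ a) = ℕₚ.<-irrefl refl a
  <p-irrefl (inj₂ (_ , a)) = ℕₚ.<-irrefl refl a

  <p-shift : ∀ p → p <p shift p
  <p-shift (k , a) = inj₁ ℕₚ.≤-refl

  shift-mono : ∀ {p q} → p <p q → shift p <p shift q
  shift-mono (inj₁ a) = inj₁ (s≤s a)
  shift-mono (inj₂ (refl , a)) = inj₂ (refl , a)

  -- The same letter in the same or a later copy of the Coxeter word: the positions still open when
  -- `p` is the next occurrence of its letter.
  _⊴_ : P → P → Set
  p ⊴ q = proj₂ p ≡ proj₂ q × proj₁ p ℕ.≤ proj₁ q

  ⊴-< : ∀ {h p q} → h <p p → p ⊴ q → h <p q
  ⊴-< {h} {k , a} {l , .a} lt (refl , le) with ℕₚ.m≤n⇒m<n∨m≡n le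
  ... | inj₁ k<l = <p-trans {h} {k , a} {l , a} lt (inj₁ k<l)
  ... | inj₂ refl = lt

  ⊴-≮ : ∀ {h p q} → h ≡ p ⊎ h <p p → p ⊴ q → ¬ (q <p h)
  ⊴-≮ {p = k , a} {q = l , .a} (inj₁ refl) (refl , le) (inj₁ lt) = ℕₚ.<⇒≱ lt le
  ⊴-≮ {p = k , a} {q = l , .a} (inj₁ refl) (refl , le) (inj₂ (_ , lt)) = ℕₚ.<-irrefl refl lt
  ⊴-≮ {h} {p} {q} (inj₂ lt) le lt' = <p-irrefl {q} (<p-trans {q} {h} {q} lt' (⊴-< {h} {p} {q} lt le))

  ⊴-next : ∀ {h q} → h ⊴ q → h <p q → shift h ⊴ q
  ⊴-next (refl , le) (inj₁ lt) = refl , lt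
  ⊴-next (refl , le) (inj₂ (_ , lt)) = ⊥-elim (ℕₚ.<-irrefl refl lt)

  -- The next open occurrence of each letter not yet dropped. By `narrow` they fit into one turn of
  -- the Coxeter word, so after using the head its next copy belongs at the end, as in the rotation
  -- of `take`.
  record Window (ps : List P) : Set where
    field
      sorted : AllPairs _<p_ ps
      narrow : ∀ p p' → p ∈ ps → p' ∈ ps → p' <p shift p

  open Window

  win-tail : ∀ {h ps} → Window (h ∷ ps) → Window ps
  win-tail w = record { sorted = AP.tail (sorted w) ; narrow = λ p p' m m' → narrow w p p' (there m) (there m') }

  ∈-snocP : ∀ {q s : P} ps → q ∈ ps ∷ʳ s → q ∈ ps ⊎ q ≡ s
  ∈-snocP ps h with ∈-++⁻ ps h
  ... | inj₁ p = inj₁ p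
  ... | inj₂ (here p) = inj₂ p

  win-rot : ∀ {h ps} → Window (h ∷ ps) → Window (ps ∷ʳ shift h)
  win-rot {h} {ps} w = record { sorted = APₚ.++⁺ (AP.tail (sorted w)) ([] ∷ []) (All.tabulate (λ m → narrow w h _ (here refl) (there m) ∷ [])) ; narrow = nr }
    where
    nr : ∀ p p' → p ∈ ps ∷ʳ shift h → p' ∈ ps ∷ʳ shift h → p' <p shift p
    nr p p' m m' with ∈-snocP ps m | ∈-snocP ps m'
    ... | inj₁ a | inj₁ b = narrow w p p' (there a) (there b)
    ... | inj₁ a | inj₂ refl = shift-mono {h} {p} (All.lookup (AP.head (sorted w)) a)
    ... | inj₂ refl | inj₁ b = <p-trans {p'} {shift h} {shift (shift h)} (narrow w h p' (here refl) (there b)) (<p-shift (shift h))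
    ... | inj₂ refl | inj₂ refl = <p-shift (shift h)

  head-min : ∀ {h ps} → Window (h ∷ ps) → ∀ p → p ∈ h ∷ ps → h ≡ p ⊎ h <p p
  head-min w p (here refl) = inj₁ refl
  head-min w p (there m) = inj₂ (All.lookup (AP.head (sorted w)) m)

  rot-min : ∀ {h ps} → Window (h ∷ ps) → ∀ p → p ∈ ps ∷ʳ shift h → h <p p
  rot-min {h} {ps} w p m with ∈-snocP ps m
  ... | inj₁ a = All.lookup (AP.head (sorted w)) a
  ... | inj₂ refl = <p-shift h

  inc-tail : ∀ {p ps} → Increasing C (p ∷ ps) → Increasing C ps
  inc-tail [ p ] = []
  inc-tail (_ ∷ h) = h

  inc-lt : ∀ {p ps} → Increasing C (p ∷ ps) → ∀ q → q ∈ ps → p <p q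
  inc-lt (lt ∷ h) q (here refl) = lt
  inc-lt {p} (_∷_ {q = q'} lt h) q (there m) = <p-trans {p} {q'} {q} lt (inc-lt h q m)

  inc-cons : ∀ {p ps} → Increasing C ps → (∀ q → q ∈ ps → p <p q) → Increasing C (p ∷ ps)
  inc-cons {p} {[]} h lt = [ p ]
  inc-cons {p} {q ∷ ps} h lt = lt q (here refl) ∷ h

  prodL : List P → Fin N
  prodL ps = prodW (letters C cw ps)

  -- The word spelled by the `take` steps of a derivation. Minimality and nestedness are stated
  -- relative to the window so that they can be proved by recursion; at the initial window they are
  -- the original conditions.
  record Emit (ps : List P) (w : Fin N) : Set where
    field
      out    : List P
      inc    : Increasing C out
      later  : ∀ q → q ∈ out → ∃[ p ] p ∈ ps × p ⊴ q
      prod≡  : prodL out ≡ w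
      length≡ : length out ≡ len w
      nested : ∀ q → q ∈ out → q ∈ ps ⊎ ∃[ q' ] q' ∈ out × q ≡ shift q'
      first  : ∀ qs → Increasing C qs → (∀ q → q ∈ qs → ∃[ p ] p ∈ ps × p ⊴ q) → prodL qs ≡ w → length qs ≡ len w → ¬ LexLt C qs out

  length-letters : ∀ ps → length (letters C cw ps) ≡ length ps
  length-letters ps = Lₚ.length-map ltr ps

  emit : ∀ {cs w} → Sortable cs w → ∀ ps → map ltr ps ≡ cs → Uniq cs → Window ps → Emit ps w
  emit done [] refl uq win = record { out = [] ; inc = [] ; later = λ q () ; prod≡ = refl ; length≡ = sym len-e ; nested = λ q () ; first = λ { qs _ _ _ _ () } }
  emit (skip {w = w} d) (h ∷ ps) refl uq win = record { out = E'.out ; inc = E'.inc ; later = λ q m → let (p , pm , le) = E'.later q m in p , there pm , le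
      ; prod≡ = E'.prod≡ ; length≡ = E'.length≡ ; nested = ne ; first = fi }
    where
    module E' = Emit (emit d ps refl (proj₂ uq) (win-tail win))
    ne : ∀ q → q ∈ E'.out → q ∈ h ∷ ps ⊎ ∃[ q' ] q' ∈ E'.out × q ≡ shift q'
    ne q m with E'.nested q m
    ... | inj₁ a = inj₁ (there a)
    ... | inj₂ b = inj₂ b
    fi : ∀ qs → Increasing C qs → (∀ q → q ∈ qs → ∃[ p ] p ∈ h ∷ ps × p ⊴ q) → prodL qs ≡ w → length qs ≡ len w → ¬ LexLt C qs E'.out
    fi qs iq lt pr l = E'.first qs iq (λ q m → drop q m (lt q m)) pr l
      where
      drop : ∀ q → q ∈ qs → ∃[ p ] p ∈ h ∷ ps × p ⊴ q → ∃[ p ] p ∈ ps × p ⊴ q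
      drop q m (p , there a , le) = p , a , le
      -- The competitor is a reduced word for an element of the parabolic subgroup of the remaining
      -- letters, so the skipped letter cannot occur in it.
      drop q m (p , here refl , (eq , _)) = ⊥-elim (proj₁ uq (subst (_∈ map ltr ps) (cong (lookup cw) (sym eq))
        (reduced-letters (letters C cw qs) (subst (InW (map ltr ps)) (sym pr) (S-InW d)) (trans (cong len pr) (trans (sym l) (sym (length-letters qs)))) (ltr q) (∈-map⁺ ltr m))))
  emit (take {s} {cs} {w} ¬ld d) (h ∷ ps) refl uq win = record { out = h ∷ E'.out
      ; inc = inc-cons E'.inc (λ q m → let (p , pm , le) = E'.later q m in ⊴-< {h} {p} {q} (rot-min win p pm) le)
      ; later = la ; prod≡ = cong (gen (ltr h) ·_) E'.prod≡ ; length≡ = trans (cong suc E'.length≡) (sym (len-add (ltr h) w ¬ld)) ; nested = ne ; first = fi }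
    where
    module E' = Emit (emit d (ps ∷ʳ shift h) (Lₚ.map-++ ltr ps (shift h ∷ [])) (Uniq-rot (map ltr ps) uq) (win-rot win))
    la : ∀ q → q ∈ h ∷ E'.out → ∃[ p ] p ∈ h ∷ ps × p ⊴ q
    la q (here refl) = h , here refl , refl , ℕₚ.≤-refl
    la q (there m) with E'.later q m
    ... | p , pm , le with ∈-snocP ps pm
    ... | inj₁ a = p , there a , le
    ... | inj₂ refl = h , here refl , proj₁ le , ℕₚ.≤-trans (ℕₚ.n≤1+n _) (proj₂ le)
    ne : ∀ q → q ∈ h ∷ E'.out → q ∈ h ∷ ps ⊎ ∃[ q' ] q' ∈ h ∷ E'.out × q ≡ shift q'
    ne q (here refl) = inj₁ (here refl)
    ne q (there m) with E'.nested q m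
    ... | inj₂ (q' , m' , eq) = inj₂ (q' , there m' , eq)
    ... | inj₁ a with ∈-snocP ps a
    ... | inj₁ b = inj₁ (there b)
    ... | inj₂ refl = inj₂ (h , here refl , refl)
    fi : ∀ qs → Increasing C qs → (∀ q → q ∈ qs → ∃[ p ] p ∈ h ∷ ps × p ⊴ q) → prodL qs ≡ gen (ltr h) · w → length qs ≡ len (gen (ltr h) · w) → ¬ LexLt C qs (h ∷ E'.out)
    -- In `LexLt` the empty list precedes every nonempty one; the prescribed length excludes it.
    fi .[] iq lt pr l nil = ℕₚ.0≢1+n (trans l (len-add (ltr h) w ¬ld))
    fi (q ∷ qs) iq lt pr l (here q<h) with lt q (here refl)
    ... | p , pm , le = ⊴-≮ {h} {p} {q} (head-min win p pm) le q<h
    fi (.h ∷ qs) iq lt pr l (next lx) = E'.first qs (inc-tail iq) (λ q m → move q m (lt q (there m))) (cancelˡ (gen (ltr h)) pr) (ℕₚ.suc-injective (trans l (len-add (ltr h) w ¬ld))) lx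
      where
      move : ∀ q → q ∈ qs → ∃[ p ] p ∈ h ∷ ps × p ⊴ q → ∃[ p ] p ∈ ps ∷ʳ shift h × p ⊴ q
      move q m (p , there a , le) = p , ∈-++⁺ˡ a , le
      move q m (p , here refl , le) = shift h , ∈-++⁺ʳ ps (here refl) , ⊴-next {h} {q} le (inc-lt iq q m)

  _≟p_ : (p q : P) → Dec (p ≡ q)
  _≟p_ = ≡-dec ℕ._≟_ _≟_

  parse : ∀ b qs ps → length qs ℕ.+ length ps ℕ.≤ b → Window ps → Uniq (map ltr ps) → Increasing C qs → (∀ q → q ∈ qs → ∃[ p ] p ∈ ps × p ⊴ q) →
    (∀ q → q ∈ qs → q ∈ ps ⊎ ∃[ q' ] q' ∈ qs × q ≡ shift q') → length qs ≡ len (prodL qs) → Sortable (map ltr ps) (prodL qs)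
  parse b [] ps h win uq iq lt ne l = sortable-e (map ltr ps)
  parse b (q ∷ qs) [] h win uq iq lt ne l with lt q (here refl)
  ... | p , () , _
  parse zero (q ∷ qs) (p ∷ ps) () win uq iq lt ne l
  parse (suc b) (q ∷ qs) (p ∷ ps) h win uq iq lt ne l with q ≟p p
  ... | yes refl = take ¬ld (subst (λ t → Sortable t (prodL qs)) (Lₚ.map-++ ltr ps (shift p ∷ []))
        (parse b qs (ps ∷ʳ shift p) h' (win-rot win) (subst Uniq (sym (Lₚ.map-++ ltr ps (shift p ∷ []))) (Uniq-rot (map ltr ps) uq)) (inc-tail iq) lt' ne' l'))
    where
    short : len (prodL qs) ℕ.≤ length qs
    short = subst (len (prodL qs) ℕ.≤_) (length-letters qs) (len-min (letters C cw qs))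
    ¬ld : ¬ LD (ltr p) (prodL qs)
    ¬ld = ¬LD-len (ltr p) (prodL qs) (ℕₚ.≤-trans (s≤s short) (ℕₚ.≤-reflexive l))
    l' : length qs ≡ len (prodL qs)
    l' = ℕₚ.suc-injective (trans l (len-add (ltr p) (prodL qs) ¬ld))
    h' : length qs ℕ.+ length (ps ∷ʳ shift p) ℕ.≤ b
    h' = subst (λ t → length qs ℕ.+ t ℕ.≤ b) (sym (trans (Lₚ.length-++ ps) (ℕₚ.+-comm (length ps) 1))) (ℕₚ.≤-pred h)
    lt' : ∀ q → q ∈ qs → ∃[ p' ] p' ∈ ps ∷ʳ shift p × p' ⊴ q
    lt' q m with lt q (there m)
    ... | p' , there a , le = p' , ∈-++⁺ˡ a , le
    ... | .p , here refl , le = shift p , ∈-++⁺ʳ ps (here refl) , ⊴-next {p} {q} le (inc-lt iq q m)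
    ne' : ∀ q → q ∈ qs → q ∈ ps ∷ʳ shift p ⊎ ∃[ q' ] q' ∈ qs × q ≡ shift q'
    ne' q m with ne q (there m)
    ... | inj₁ (here refl) = ⊥-elim (<p-irrefl {q} (inc-lt iq q m))
    ... | inj₁ (there a) = inj₁ (∈-++⁺ˡ a)
    ... | inj₂ (.p , here refl , eq) = inj₁ (subst (_∈ ps ∷ʳ shift p) (sym eq) (∈-++⁺ʳ ps (here refl)))
    ... | inj₂ (q' , there m' , eq) = inj₂ (q' , m' , eq)
  ... | no q≢p = skip (parse b (q ∷ qs) ps (ℕₚ.≤-pred (subst (ℕ._≤ suc b) (ℕₚ.+-suc (suc (length qs)) (length ps)) h)) (win-tail win) (proj₂ uq) iq lt' ne' l)
    where
    p∉ : p ∉ q ∷ qs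
    p∉ (here eq) = q≢p (sym eq)
    p∉ (there m) with lt q (here refl)
    ... | p' , m' , le = ⊴-≮ {p} {p'} {q} (head-min win p' m') le (inc-lt iq p m)
    dead : ∀ k q' → proj₁ q' ≡ k → q' ∈ q ∷ qs → proj₂ q' ≢ proj₂ p
    dead k q' eqk m eq with ne q' m
    ... | inj₁ (here refl) = p∉ m
    ... | inj₁ (there a) = proj₁ uq (subst (_∈ map ltr ps) (cong (lookup cw) eq) (∈-map⁺ ltr a))
    dead (suc k) q' eqk m eq | inj₂ (q'' , m'' , refl) = dead k q'' (ℕₚ.suc-injective eqk) m'' eq
    dead zero q' () m eq | inj₂ (q'' , m'' , refl)
    lt' : ∀ q' → q' ∈ q ∷ qs → ∃[ p' ] p' ∈ ps × p' ⊴ q'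
    lt' q' m with lt q' m
    ... | p' , there a , le = p' , a , le
    ... | .p , here refl , le = ⊥-elim (dead (proj₁ q') q' refl m (sym (proj₁ le)))
    ne' : ∀ q' → q' ∈ q ∷ qs → q' ∈ ps ⊎ ∃[ q'' ] q'' ∈ q ∷ qs × q' ≡ shift q''
    ne' q' m with ne q' m
    ... | inj₁ (here refl) = ⊥-elim (p∉ m)
    ... | inj₁ (there a) = inj₁ a
    ... | inj₂ b = inj₂ b

  start : List P
  start = tabulate (λ a → (0 , a))

  c₀ : List (Fin n)
  c₀ = map ltr start

  start-win : Window start
  start-win = record { sorted = APₚ.tabulate⁺-< (λ lt → inj₂ (refl , lt)) ; narrow = nr }
    where
    nr : ∀ p p' → p ∈ start → p' ∈ start → p' <p shift p
    nr p p' m m' with ∈-tabulate⁻ m | ∈-tabulate⁻ m'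
    ... | a , refl | a' , refl = inj₁ (s≤s z≤n)

  c₀-uniq : Uniq c₀
  c₀-uniq = Unique⇒Uniq (subst Unique (sym (Lₚ.map-tabulate (λ a → (0 , a)) ltr)) (Uₚ.tabulate⁺ (λ {a} {b} eq → inj a b eq)))

  start-all : ∀ (qs : List P) q → q ∈ qs → ∃[ p ] p ∈ start × p ⊴ q
  start-all qs (k , a) _ = (0 , a) , ∈-tabulate⁺ {f = λ a → (0 , a)} a , refl , z≤n

  reduced-len : ∀ ps → Reduced C (letters C cw ps) → length ps ≡ len (prodL ps)
  reduced-len ps h = trans (sym (length-letters ps)) (isLen-unique (prodL ps) (length (letters C cw ps)) h)

  IsSortable⇒Sortable : ∀ {w} → IsSortable C cw w → Sortable c₀ w
  IsSortable⇒Sortable {w} (ps , ((iq , pr , rd) , _) , nest) = subst (Sortable c₀) pr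
    (parse _ ps start ℕₚ.≤-refl start-win c₀-uniq iq (start-all ps) ne (reduced-len ps rd))
    where
    ne : ∀ q → q ∈ ps → q ∈ start ⊎ ∃[ q' ] q' ∈ ps × q ≡ shift q'
    ne (zero , a) m = inj₁ (∈-tabulate⁺ {f = λ a → (0 , a)} a)
    ne (suc k , a) m with nest k (lookup cw a) (a , m , refl)
    ... | a' , m' , eq = inj₂ ((k , a') , m' , cong (suc k ,_) (inj a a' (sym eq)))

  Sortable⇒IsSortable : ∀ {w} → Sortable c₀ w → IsSortable C cw w
  Sortable⇒IsSortable {w} d = out , ((inc , prod≡ , red) , λ { qs (iq , pr , rd) → first qs iq (start-all qs) pr (trans (reduced-len qs rd) (cong len pr)) }) , nest
    where
    open Emit (emit d start refl c₀-uniq start-win)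
    red : Reduced C (letters C cw out)
    red = subst (Defs.IsLength C (prodL out)) (sym (trans (length-letters out) (trans length≡ (cong len (sym prod≡))))) (isLen (prodL out))
    nest : ∀ k s → InI C cw out (suc k) s → InI C cw out k s
    nest k s (a , m , eq) with nested (suc k , a) m
    ... | inj₂ ((.k , .a) , m' , refl) = a , m' , eq
    ... | inj₁ b with ∈-tabulate⁻ b
    ... | a' , ()

-- Boolean intervals and pentagons below an element.

module PopIntervals (C : CoxeterSystem) (_≼_ : Fin (CoxeterSystem.N C) → Fin (CoxeterSystem.N C) → Set)
  (≼⇒⊑ : ∀ {u v} → u ≼ v → WeakOrder._⊑_ C u v) (⊑⇒≼ : ∀ {u v} → WeakOrder._⊑_ C u v → u ≼ v) where

  open Representation C
  open Positivity C
  open WeakOrder C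
  open EulerForm C
  open CambrianCovers C
  open Descents C

  ≼-trans : ∀ {u v w} → u ≼ v → v ≼ w → u ≼ w
  ≼-trans {u} {v} {w} p q = ⊑⇒≼ (⊑-trans {u} {v} {w} (≼⇒⊑ p) (≼⇒⊑ q))

  glb-le : ∀ {D a b m} → IsMeet D _≼_ a b m → m ≼ a × m ≼ b
  glb-le (_ , h , _) = h _ (inj₁ refl) , h _ (inj₂ refl)

  lub-ge : ∀ {D a b m} → IsJoin D _≼_ a b m → a ≼ m × b ≼ m
  lub-ge (_ , h , _) = h _ (inj₁ refl) , h _ (inj₂ refl)

  glb-great : ∀ {D a b m} → IsMeet D _≼_ a b m → ∀ z → D z → z ≼ a → z ≼ b → z ≼ m
  glb-great (_ , _ , g) z dz za zb = g z dz (λ { _ (inj₁ refl) → za ; _ (inj₂ refl) → zb })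

  lub-least : ∀ {D a b m} → IsJoin D _≼_ a b m → ∀ z → D z → a ≼ z → b ≼ z → m ≼ z
  lub-least (_ , _ , g) z dz za zb = g z dz (λ { _ (inj₁ refl) → za ; _ (inj₂ refl) → zb })

  mkMeet : ∀ {D a b m} → D m → m ≼ a → m ≼ b → (∀ z → D z → z ≼ a → z ≼ b → z ≼ m) → IsMeet D _≼_ a b m
  mkMeet dm ma mb g = dm , (λ { _ (inj₁ refl) → ma ; _ (inj₂ refl) → mb }) , λ z dz h → g z dz (h _ (inj₁ refl)) (h _ (inj₂ refl))

  mkJoin : ∀ {D a b m} → D m → a ≼ m → b ≼ m → (∀ z → D z → a ≼ z → b ≼ z → m ≼ z) → IsJoin D _≼_ a b m
  mkJoin dm ma mb g = dm , (λ { _ (inj₁ refl) → ma ; _ (inj₂ refl) → mb }) , λ z dz h → g z dz (h _ (inj₁ refl)) (h _ (inj₂ refl))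

  -- y₁, y₂ and x < y₁ generate a pentagon.
  not-distributive : ∀ {D} → IsDistributiveLattice D _≼_ → ∀ y₁ y₂ x → D y₁ → D y₂ → D x → x ≼ y₁ →
    (∀ g → D g → g ≼ y₁ → g ≼ y₂ → g ≼ x) → (∀ j → D j → x ≼ j → y₂ ≼ j → y₁ ≼ j) → y₁ ≼ x
  not-distributive {D} (lat , dist) y₁ y₂ x d₁ d₂ dx x≤y₁ low high =
      ≼-trans {y₁} {l} {x} (glb-great hl y₁ d₁ (⊑⇒≼ {y₁} {y₁} ⊑-refl) (high j (proj₁ hj) (proj₁ (lub-ge hj)) (proj₂ (lub-ge hj))))
        (subst (_≼ x) (sym eq) (lub-least hr x dx (proj₂ (glb-le h₁)) (low m₂ (proj₁ h₂) (proj₁ (glb-le h₂)) (proj₂ (glb-le h₂)))))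
    where
    J = proj₂ (lat x y₂ dx d₂)
    j = proj₁ J
    hj = proj₂ J
    L = proj₁ (lat y₁ j d₁ (proj₁ hj))
    l = proj₁ L
    hl = proj₂ L
    M₁ = proj₁ (lat y₁ x d₁ dx)
    m₁ = proj₁ M₁
    h₁ = proj₂ M₁
    M₂ = proj₁ (lat y₁ y₂ d₁ d₂)
    m₂ = proj₁ M₂
    h₂ = proj₂ M₂
    R = proj₂ (lat m₁ m₂ (proj₁ h₁) (proj₁ h₂))
    r' = proj₁ R
    hr = proj₂ R
    eq : l ≡ r'
    eq = dist y₁ x y₂ d₁ dx d₂ j l m₁ m₂ r' hj hl h₁ h₂ hr

  module Boolean (w : Fin N) (cm : Commuting w) where
    open Del w cm

    descents : List (Fin n)
    descents = filter (Neg? w) (allFin n)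

    -- Members of the box correspond to sets of deleted descents, here those satisfying `Q`. Meets,
    -- joins and complements below are choices of `Q`: not in both, not in either, and in the given
    -- element.
    module Element {Q : Fin n → Set} (Q? : ∀ p → Dec (Q p)) where
      ps : List (Fin n)
      ps = filter Q? descents
      private
        uq : Uniq ps
        uq = Unique⇒Uniq (Uₚ.filter⁺ Q? (Uₚ.filter⁺ (Neg? w) (Uₚ.allFin⁺ n)))
        ds : Desc ps
        ds q m = proj₂ (∈-filter⁻ (Neg? w) {xs = allFin n} (proj₁ (∈-filter⁻ Q? {xs = descents} m)))

      el : Fin N
      el = del w ps

      el-out : ∀ p → Neg w p → Q p → ¬ I el (cov w p)
      el-out p np q = del-out ps uq ds p (∈-filter⁺ Q? (∈-filter⁺ (Neg? w) (∈-allFin p) np) q)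

      el-in : ∀ p → Neg w p → ¬ Q p → I el (cov w p)
      el-in p np ¬q with I? el (cov w p)
      ... | yes h = h
      ... | no ¬h with del-in ps uq ds (cov w p) (cov-pos w p np) (cov-in w p) ¬h
      ... | p' , m , eq = ⊥-elim (¬q (subst Q (sym (refl-cov-inj w p p' eq)) (proj₂ (∈-filter⁻ Q? {xs = descents} m))))

      el-box : Box w el
      el-box = del-⊑ ps uq ds , λ β pos h ¬h → let (p , m , eq) = del-in ps uq ds β pos h ¬h in p , ds p m , eq

    opaque
      bottom : ∃[ b ] Box w b × (∀ p → Neg w p → ¬ I b (cov w p))
      bottom = A.el , A.el-box , λ p np → A.el-out p np tt
        where module A = Element {λ _ → ⊤} (λ _ → yes tt)

    -- An inversion of `w` missing from a member of the box is a cover root, so nothing else has to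
    -- be compared.
    box-⊑ : ∀ {z z'} → Box w z → Box w z' → (∀ p → Neg w p → I z (cov w p) → I z' (cov w p)) → z ⊑ z'
    box-⊑ {z} {z'} (le , _) (_ , bx) h β pos hz with I? z' β
    ... | yes q = q
    ... | no ¬q with bx β pos (le β pos hz) ¬q
    ... | p , np , eq = same-I (cov w p) β (sym eq) (cov-pos w p np) pos z' (h p np (same-I β (cov w p) eq pos (cov-pos w p np) z hz))

    mem : ∀ {z z'} → z ≼ z' → ∀ p → Neg w p → I z (cov w p) → I z' (cov w p)
    mem {z} {z'} le p np = ≼⇒⊑ {z} {z'} le (cov w p) (cov-pos w p np)

    module Lattice (D : Fin N → Set) (D→ : ∀ z → D z → Box w z) (D← : ∀ z → Box w z → D z) where
      box-≼ : ∀ {z z'} → D z → D z' → (∀ p → Neg w p → I z (cov w p) → I z' (cov w p)) → z ≼ z'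
      box-≼ {z} {z'} dz dz' h = ⊑⇒≼ {z} {z'} (box-⊑ {z} {z'} (D→ z dz) (D→ z' dz') h)

      module Both (a b : Fin N) where
        in? : ∀ p → Dec (¬ (I a (cov w p) × I b (cov w p)))
        in? p = ¬? (I? a (cov w p) ×-dec I? b (cov w p))
        open Element in?
        meet-mem : ∀ p → Neg w p → I el (cov w p) → I a (cov w p) × I b (cov w p)
        meet-mem p np h with I? a (cov w p) ×-dec I? b (cov w p)
        ... | yes q = q
        ... | no ¬q = ⊥-elim (el-out p np ¬q h)
        mem-meet : ∀ p → Neg w p → I a (cov w p) → I b (cov w p) → I el (cov w p)
        mem-meet p np ha hb = el-in p np (λ f → f (ha , hb))

        isMeet : D a → D b → IsMeet D _≼_ a b el
        isMeet da db = mkMeet de (box-≼ de da (λ p np h → proj₁ (meet-mem p np h))) (box-≼ de db (λ p np h → proj₂ (meet-mem p np h)))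
          (λ z dz za zb → box-≼ dz de (λ p np h → mem-meet p np (mem {z} {a} za p np h) (mem {z} {b} zb p np h)))
          where
          de : D el
          de = D← el el-box

      module Either (a b : Fin N) where
        out? : ∀ p → Dec (¬ (I a (cov w p) ⊎ I b (cov w p)))
        out? p = ¬? (I? a (cov w p) ⊎-dec I? b (cov w p))
        open Element out?
        join-mem : ∀ p → Neg w p → I el (cov w p) → I a (cov w p) ⊎ I b (cov w p)
        join-mem p np h with I? a (cov w p) ⊎-dec I? b (cov w p)
        ... | yes q = q
        ... | no ¬q = ⊥-elim (el-out p np ¬q h)
        mem-join : ∀ p → Neg w p → I a (cov w p) ⊎ I b (cov w p) → I el (cov w p)
        mem-join p np h = el-in p np (λ f → f h)

        isJoin : D a → D b → IsJoin D _≼_ a b el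
        isJoin da db = mkJoin de (box-≼ da de (λ p np h → mem-join p np (inj₁ h))) (box-≼ db de (λ p np h → mem-join p np (inj₂ h)))
          (λ z dz az bz → box-≼ de dz (λ p np h → either az bz p np (join-mem p np h)))
          where
          de : D el
          de = D← el el-box
          either : ∀ {z} → a ≼ z → b ≼ z → ∀ p → Neg w p → I a (cov w p) ⊎ I b (cov w p) → I z (cov w p)
          either {z} az bz p np (inj₁ h) = mem {a} {z} az p np h
          either {z} az bz p np (inj₂ h) = mem {b} {z} bz p np h

      meet-in : ∀ {a b m} → D a → D b → IsMeet D _≼_ a b m → ∀ p → Neg w p → I a (cov w p) → I b (cov w p) → I m (cov w p)
      meet-in {a} {b} {m} da db hm p np ha hb = mem {el} {m} (glb-great hm el (proj₁ im) (proj₁ (glb-le im)) (proj₂ (glb-le im))) p np (mem-meet p np ha hb)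
        where
        open Both a b
        open Element in? using (el)
        im = isMeet da db

      join-out : ∀ {a b m} → D a → D b → IsJoin D _≼_ a b m → ∀ p → Neg w p → I m (cov w p) → I a (cov w p) ⊎ I b (cov w p)
      join-out {a} {b} {m} da db hm p np h = join-mem p np (mem {m} {el} (lub-least hm el (proj₁ ij) (proj₁ (lub-ge ij)) (proj₂ (lub-ge ij))) p np h)
        where
        open Either a b
        open Element out? using (el)
        ij = isJoin da db

      distributive : IsDistributiveLattice D _≼_
      distributive = (λ a b da db → (_ , Both.isMeet a b da db) , (_ , Either.isJoin a b da db)) ,
        λ a b c da db dc j l m₁ m₂ r' hj hl h₁ h₂ hr → ⊑-antisym l r'
          (≼⇒⊑ {l} {r'} (box-≼ (proj₁ hl) (proj₁ hr) λ p np h → up a b c da db dc j l m₁ m₂ r' hj hl h₁ h₂ hr p np h (join-out db dc hj p np (mem {l} {j} (proj₂ (glb-le hl)) p np h))))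
          (≼⇒⊑ {r'} {l} (box-≼ (proj₁ hr) (proj₁ hl) λ p np h → down a b c da db dc j l m₁ m₂ r' hj hl h₁ h₂ hr p np (join-out (proj₁ h₁) (proj₁ h₂) hr p np h)))
        where
        up : ∀ a b c → D a → D b → D c → ∀ j l m₁ m₂ r' → IsJoin D _≼_ b c j → IsMeet D _≼_ a j l → IsMeet D _≼_ a b m₁ → IsMeet D _≼_ a c m₂ → IsJoin D _≼_ m₁ m₂ r' →
          ∀ p → Neg w p → I l (cov w p) → I b (cov w p) ⊎ I c (cov w p) → I r' (cov w p)
        up a b c da db dc j l m₁ m₂ r' hj hl h₁ h₂ hr p np h (inj₁ hb) = mem {m₁} {r'} (proj₁ (lub-ge hr)) p np (meet-in da db h₁ p np (mem {l} {a} (proj₁ (glb-le hl)) p np h) hb)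
        up a b c da db dc j l m₁ m₂ r' hj hl h₁ h₂ hr p np h (inj₂ hc) = mem {m₂} {r'} (proj₂ (lub-ge hr)) p np (meet-in da dc h₂ p np (mem {l} {a} (proj₁ (glb-le hl)) p np h) hc)
        down : ∀ a b c → D a → D b → D c → ∀ j l m₁ m₂ r' → IsJoin D _≼_ b c j → IsMeet D _≼_ a j l → IsMeet D _≼_ a b m₁ → IsMeet D _≼_ a c m₂ → IsJoin D _≼_ m₁ m₂ r' →
          ∀ p → Neg w p → I m₁ (cov w p) ⊎ I m₂ (cov w p) → I l (cov w p)
        down a b c da db dc j l m₁ m₂ r' hj hl h₁ h₂ hr p np (inj₁ h) = meet-in da (proj₁ hj) hl p np (mem {m₁} {a} (proj₁ (glb-le h₁)) p np h)
          (mem {b} {j} (proj₁ (lub-ge hj)) p np (mem {m₁} {b} (proj₂ (glb-le h₁)) p np h))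
        down a b c da db dc j l m₁ m₂ r' hj hl h₁ h₂ hr p np (inj₂ h) = meet-in da (proj₁ hj) hl p np (mem {m₂} {a} (proj₁ (glb-le h₂)) p np h)
          (mem {c} {j} (proj₂ (lub-ge hj)) p np (mem {m₂} {c} (proj₂ (glb-le h₂)) p np h))

      boolean : IsBooleanLattice D _≼_
      boolean = distributive , (_ , bot) , (w , dw , λ y dy → ⊑⇒≼ {y} {w} (proj₁ (D→ y dy))) , comp
        where
        dw : D w
        dw = D← w (⊑-refl , λ β _ h ¬h → ⊥-elim (¬h h))
        bot : IsBottom D _≼_ (proj₁ bottom)
        bot = db , λ y dy → box-≼ db dy (λ p np h → ⊥-elim (proj₂ (proj₂ bottom) p np h))
          where
          db : D (proj₁ bottom)
          db = D← (proj₁ bottom) (proj₁ (proj₂ bottom))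
        comp : ∀ a → D a → ∃[ b ] D b × (∀ bot top → IsBottom D _≼_ bot → IsTop D _≼_ top → IsMeet D _≼_ a b bot × IsJoin D _≼_ a b top)
        comp a da = el , de , λ bt tp hb ht →
            mkMeet (proj₁ hb) (proj₂ hb a da) (proj₂ hb el de) (λ z dz za zb → box-≼ dz (proj₁ hb) (λ p np h → ⊥-elim (el-out p np (mem {z} {a} za p np h) (mem {z} {el} zb p np h)))) ,
            mkJoin (proj₁ ht) (proj₂ ht a da) (proj₂ ht el de) (λ z dz az bz → box-≼ (proj₁ ht) dz (λ p np h → either p np az bz (I? a (cov w p))))
          where
          open Element (λ p → I? a (cov w p))
          de : D el
          de = D← el el-box
          either : ∀ {z} p → Neg w p → a ≼ z → el ≼ z → Dec (I a (cov w p)) → I z (cov w p)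
          either {z} p np az bz (yes h) = mem {a} {z} az p np h
          either {z} p np az bz (no ¬h) = mem {el} {z} bz p np (el-in p np ¬h)

  descent-cover : ∀ {D : Fin N → Set} w p → Neg w p → D (w · gen p) → D w → Covers D _≼_ (w · gen p) w
  descent-cover w p np dp dw = dp , dw , ⊑⇒≼ {w · gen p} {w} (cov-⊑ w p np) , (λ eq → ℕₚ.<-irrefl (cong len eq) np) , between
    where
    between : ∀ z → _ → (w · gen p) ≼ z → z ≼ w → z ≡ w · gen p ⊎ z ≡ w
    between z dz pz zw with z ≟ w
    ... | yes eq = inj₂ eq
    ... | no ¬eq with ⊑-cover z w (≼⇒⊑ {z} {w} zw) ¬eq
    ... | q , nq , zq with p ≟ q
    ... | yes refl = inj₁ (⊑-antisym z (w · gen p) zq (≼⇒⊑ {w · gen p} {z} pz))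
    ... | no p≢q = ⊥-elim (cov-out w q (zq (cov w q) (cov-pos w q nq) (≼⇒⊑ {w · gen p} {z} pz (cov w q) (cov-pos w q nq) hq)))
      where
      hq : I (w · gen p) (cov w q)
      hq with I? (w · gen p) (cov w q)
      ... | yes h = h
      ... | no ¬h = ⊥-elim (p≢q (sym (refl-cov-inj w q p (cov-unique w p (cov w q) (cov-in w q) ¬h))))

  cover-descent : ∀ {D : Fin N → Set} w → (∀ p → Neg w p → D (w · gen p)) → ∀ y → Covers D _≼_ y w → ∃[ p ] Neg w p × y ≡ w · gen p
  cover-descent w dp y (dy , dw , le , y≢w , btw) with ⊑-cover y w (≼⇒⊑ {y} {w} le) y≢w
  ... | p , np , yp with btw (w · gen p) (dp p np) (⊑⇒≼ {y} {w · gen p} yp) (⊑⇒≼ {w · gen p} {w} (cov-⊑ w p np))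
  ... | inj₁ eq = p , np , sym eq
  ... | inj₂ eq = ⊥-elim (ℕₚ.<-irrefl (cong len eq) np)

  -- One argument serves both lattices. As soon as `D` contains the box, the elements covered by `w`
  -- in `D` are the `w · gen p`, and the element `pop` lacks every cover root and lies above
  -- `bottom`; this identifies the interval with the box.
  module PopBox (w : Fin N) (cm : Commuting w) (D : Fin N → Set) (bD : ∀ z → Box w z → D z) (pop : Fin N) (hp : IsPopDown D _≼_ w pop) where
    open Boolean w cm
    private
      box-desc : ∀ p → Neg w p → Box w (w · gen p)
      box-desc p np = cov-⊑ w p np , λ β pos h ¬h → p , np , cov-unique w p β h ¬h
      dw : D w
      dw = bD w (⊑-refl , λ β _ h ¬h → ⊥-elim (¬h h))
      bt : Fin N
      bt = proj₁ bottom
      bt-box : Box w bt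
      bt-box = proj₁ (proj₂ bottom)
      pop≤ : ∀ p → Neg w p → pop ≼ (w · gen p)
      pop≤ p np = proj₁ (proj₂ hp) (w · gen p) (inj₂ (descent-cover w p np (bD (w · gen p) (box-desc p np)) dw))
      pop≤w : pop ≼ w
      pop≤w = proj₁ (proj₂ hp) w (inj₁ refl)
      bt≤pop : bt ≼ pop
      bt≤pop = proj₂ (proj₂ hp) bt (bD bt bt-box) lower-bound
        where
        below : ∀ a → ∃[ p ] Neg w p × a ≡ w · gen p → bt ≼ a
        below a (p , np , eq) = subst (bt ≼_) (sym eq) (⊑⇒≼ {bt} {w · gen p} (cov-below bt w p np (proj₁ bt-box) (proj₂ (proj₂ bottom) p np)))
        lower-bound : ∀ a → a ≡ w ⊎ Covers D _≼_ a w → bt ≼ a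
        lower-bound a (inj₁ eq) = subst (bt ≼_) (sym eq) (⊑⇒≼ {bt} {w} (proj₁ bt-box))
        lower-bound a (inj₂ cv') = below a (cover-descent w (λ p np → bD (w · gen p) (box-desc p np)) a cv')

    interval→box : ∀ z → Interval D _≼_ pop w z → Box w z
    interval→box z (dz , pz , zw) = ≼⇒⊑ {z} {w} zw , λ β pos h ¬h → proj₂ bt-box β pos h (λ h' → ¬h (≼⇒⊑ {pop} {z} pz β pos (≼⇒⊑ {bt} {pop} bt≤pop β pos h')))

    box→interval : ∀ z → Box w z → Interval D _≼_ pop w z
    box→interval z bz@(zw , bx) = bD z bz , ⊑⇒≼ {pop} {z} low , ⊑⇒≼ {z} {w} zw
      where
      low : pop ⊑ z
      low β pos h = decide (I? z β)
        where
        out : ∃[ p ] Neg w p × refl-of β ≡ refl-of (cov w p) → I z β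
        out (p , np , eq) = ⊥-elim (cov-out w p (≼⇒⊑ {pop} {w · gen p} (pop≤ p np) (cov w p) (cov-pos w p np) (same-I β (cov w p) eq pos (cov-pos w p np) pop h)))
        decide : Dec (I z β) → I z β
        decide (yes q) = q
        decide (no ¬q) = out (bx β pos (≼⇒⊑ {pop} {w} pop≤w β pos h) ¬q)

    interval-boolean : IsBooleanLattice (Interval D _≼_ pop w) _≼_
    interval-boolean = Lattice.boolean (Interval D _≼_ pop w) interval→box box→interval

  module Weak (w pW : Fin N) (hW : IsPopDown (λ _ → ⊤) _≼_ w pW) (p q : Fin n) (np : Neg w p) (nq : Neg w q) (nc : gen p · gen q ≢ gen q · gen p) where
    open Pair w p q np nq nc
    private
      D = Interval (λ _ → ⊤) _≼_ pW w
      pop⊑ : ∀ p → Neg w p → pW ⊑ w · gen p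
      pop⊑ p np = ≼⇒⊑ {pW} {w · gen p} (proj₁ (proj₂ hW) (w · gen p) (inj₂ (descent-cover w p np tt tt)))
      inD : ∀ z → pW ⊑ z → z ⊑ w → D z
      inD z a b = tt , ⊑⇒≼ {pW} {z} a , ⊑⇒≼ {z} {w} b

    desc-in : D (w · gen q)
    desc-in = inD (w · gen q) (pop⊑ q nq) (cov-⊑ w q nq)

    contra : ¬ IsDistributiveLattice D _≼_
    contra dist = ℕₚ.<-irrefl refl (ℕₚ.≤-trans nq' (⊑-len (w · gen p) low (≼⇒⊑ {w · gen p} {low} le)))
      where
      le : (w · gen p) ≼ low
      le = not-distributive dist (w · gen p) (w · gen q) low (inD (w · gen p) (pop⊑ p np) (cov-⊑ w p np)) desc-in
        (inD low (low-glb pW (pop⊑ p np) (pop⊑ q nq)) (⊑-trans {low} {w · gen p} {w} low-⊑ (cov-⊑ w p np))) (⊑⇒≼ {low} {w · gen p} low-⊑)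
        (λ g dg gp gq → ⊑⇒≼ {g} {low} (low-glb g (≼⇒⊑ {g} {w · gen p} gp) (≼⇒⊑ {g} {w · gen q} gq)))
        high
        where
        -- Between `w · gen q` and `w` there is nothing else, and `w · gen q` lacks the cover root
        -- of `q`, which `low` still has; so `j` is `w`.
        high : ∀ j → D j → low ≼ j → (w · gen q) ≼ j → (w · gen p) ≼ j
        high j (_ , _ , jw) lj qj with j ≟ w
        ... | yes refl = ⊑⇒≼ {w · gen p} {w} (cov-⊑ w p np)
        ... | no ¬eq with proj₂ (proj₂ (proj₂ (proj₂ (descent-cover {λ _ → ⊤} w q nq tt tt)))) j tt qj jw
        ... | inj₂ eq = ⊥-elim (¬eq eq)
        ... | inj₁ refl = ⊥-elim (cov-out w q (≼⇒⊑ {low} {w · gen q} lj (cov w q) (cov-pos w q nq) low-has))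

  module Camb (cs : List (Fin n)) (uq : Uniq cs) (D : Fin N → Set) (D→ : ∀ {z} → D z → Sortable cs z) (D← : ∀ {z} → Sortable cs z → D z)
    (w pC : Fin N) (dw : Sortable cs w) (hC : IsPopDown D _≼_ w pC) (p q : Fin n) (np : Neg w p) (nq : Neg w q) (nc : gen p · gen q ≢ gen q · gen p)
    (or : ∀ c m m' → E c cs (ρ w (α p m)) (ρ w (α q m')) ≡ 0ℤ) where
    open Pair w p q np nq nc
    open Oriented cs dw uq or
    private
      Lp = lower dw uq p np
      Lq = lower dw uq q nq
      module Lp = Lower (proj₁ Lp)
      module Lq = Lower (proj₁ Lq)
      D' = Interval D _≼_ pC w

      ⊑w : ∀ i (ni : Neg w i) (L : Lower cs w i) → Lower.y L ⊑ w
      ⊑w i ni L = ⊑-trans {Lower.y L} {w · gen i} {w} (Lower.below L) (cov-⊑ w i ni)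

      -- `j` lies below `w · gen k` for some descent `k`, and the lower cover contains all the other
      -- cover roots, which forces `k` to be `i`.
      coatom : ∀ i (ni : Neg w i) (L : Lower cs w i) → ∀ j → j ⊑ w → j ≢ w → Lower.y L ⊑ j → j ⊑ w · gen i
      coatom i ni L j jw j≢w yj with ⊑-cover j w jw j≢w
      ... | k , nk , jk with k ≟ i
      ... | yes refl = jk
      ... | no k≢i = ⊥-elim (cov-out w k (jk (cov w k) (cov-pos w k nk) (yj (cov w k) (cov-pos w k nk) (Lower.others L k k≢i nk))))

      covers : ∀ i (ni : Neg w i) (L : Σ (Lower cs w i) λ L → MaxBelow cs (w · gen i) (Lower.y L)) → Covers D _≼_ (Lower.y (proj₁ L)) w
      covers i ni (L , mx) = D← L.srt , D← dw , ⊑⇒≼ {L.y} {w} (⊑w i ni L) , (λ eq → cov-out w i (L.below (cov w i) (cov-pos w i ni) (subst (λ t → I t (cov w i)) (sym eq) (cov-in w i)))) , btw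
        where
        module L = Lower L
        btw : ∀ z → D z → L.y ≼ z → z ≼ w → z ≡ L.y ⊎ z ≡ w
        btw z dz yz zw with z ≟ w
        ... | yes eq = inj₂ eq
        ... | no ¬eq = inj₁ (⊑-antisym z L.y (mx z (D→ dz) (coatom i ni L z (≼⇒⊑ {z} {w} zw) ¬eq (≼⇒⊑ {L.y} {z} yz))) (≼⇒⊑ {L.y} {z} yz))

      pop⊑ : ∀ i (ni : Neg w i) (L : Σ (Lower cs w i) λ L → MaxBelow cs (w · gen i) (Lower.y L)) → pC ⊑ Lower.y (proj₁ L)
      pop⊑ i ni L = ≼⇒⊑ {pC} {Lower.y (proj₁ L)} (proj₁ (proj₂ hC) (Lower.y (proj₁ L)) (inj₂ (covers i ni L)))

      inD : ∀ z → Sortable cs z → pC ⊑ z → z ⊑ w → D' z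
      inD z dz a b = D← dz , ⊑⇒≼ {pC} {z} a , ⊑⇒≼ {z} {w} b

      low-below : ∀ g → g ⊑ Lp.y → g ⊑ Lq.y → g ⊑ low
      low-below g gp gq = low-glb g (⊑-trans {g} {Lp.y} {w · gen p} gp Lp.below) (⊑-trans {g} {Lq.y} {w · gen q} gq Lq.below)

      -- The third element of the pentagon: `low` is replaced by the largest sortable element below
      -- it and below the lower cover at `p`.
      S = sortable-below uq Lp.y Lp.srt low
      x = proj₁ S
      sx = proj₁ (proj₂ S)
      x⊑y = proj₁ (proj₂ (proj₂ S))
      x⊑low = proj₁ (proj₂ (proj₂ (proj₂ S)))
      x-max = proj₂ (proj₂ (proj₂ (proj₂ S)))

      Z = sortable-low dw uq p q np nq nc or
      x-has : I x (cov w q)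
      x-has = x-max (proj₁ Z) (proj₁ (proj₂ Z)) (proj₂ Lp (proj₁ Z) (proj₁ (proj₂ Z)) (⊑-trans {proj₁ Z} {low} {w · gen p} (proj₁ (proj₂ (proj₂ Z))) low-⊑)) (proj₁ (proj₂ (proj₂ Z)))
        (cov w q) (cov-pos w q nq) (proj₂ (proj₂ (proj₂ Z)))

    contra : ¬ IsDistributiveLattice D' _≼_
    -- The collapsed pentagon puts the lower cover at `p` below `low`, but `mid` is an inversion of
    -- the former and exactly the root dropped on reaching the latter.
    contra dist = cov-out (w · gen p) q (x⊑low mid mid-pos (≼⇒⊑ {Lp.y} {x} le mid mid-pos (mid-in (proj₁ Lp))))
      where
      high : ∀ j → D' j → x ≼ j → Lq.y ≼ j → Lp.y ≼ j
      high j (dj , _ , jw) xj qj with j ≟ w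
      ... | yes refl = ⊑⇒≼ {Lp.y} {w} (⊑w p np (proj₁ Lp))
      ... | no ¬eq = ⊥-elim (cov-out w q (coatom q nq (proj₁ Lq) j (≼⇒⊑ {j} {w} jw) ¬eq (≼⇒⊑ {Lq.y} {j} qj) (cov w q) (cov-pos w q nq) (≼⇒⊑ {x} {j} xj (cov w q) (cov-pos w q nq) x-has)))
      le : Lp.y ≼ x
      le = not-distributive dist Lp.y Lq.y x (inD Lp.y Lp.srt (pop⊑ p np Lp) (⊑w p np (proj₁ Lp))) (inD Lq.y Lq.srt (pop⊑ q nq Lq) (⊑w q nq (proj₁ Lq)))
        (inD x sx (x-max pC (D→ (proj₁ hC)) (pop⊑ p np Lp) (low-below pC (pop⊑ p np Lp) (pop⊑ q nq Lq))) (⊑-trans {x} {Lp.y} {w} x⊑y (⊑w p np (proj₁ Lp)))) (⊑⇒≼ {x} {Lp.y} x⊑y)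
        (λ g (dg , _) gp gq → ⊑⇒≼ {g} {x} (x-max g (D→ dg) (≼⇒⊑ {g} {Lp.y} gp) (low-below g (≼⇒⊑ {g} {Lp.y} gp) (≼⇒⊑ {g} {Lq.y} gq))))
        high

    -- If it were sortable, maximality would put it below the lower cover at `q`, which lacks `mid`,
    -- although `w · gen q` has it.
    desc-not-sortable : ¬ Sortable cs (w · gen q)
    desc-not-sortable s = mid-out (proj₁ Lq) (proj₂ Lq (w · gen q) s ⊑-refl mid mid-pos mid-in-q)

-- Assembly of the equivalences.

module Main (C : CoxeterSystem) (cw : Vec (Fin (CoxeterSystem.n C)) (CoxeterSystem.n C)) (inj : IsCoxeterWord C cw)
  (w : Fin (CoxeterSystem.N C)) (srt : IsSortable C cw w) (pW pC : Fin (CoxeterSystem.N C))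
  (hW : IsPopDown (λ _ → ⊤) (_≤W_ C) w pW) (hC : IsPopDown (IsSortable C cw) (_≤W_ C) w pC) where
  open CoxeterSystem C
  open Representation C using (ρ; α)
  open Positivity C using (Neg)
  open WeakOrder C using (shorter→; shorter←; ≤W⇒⊑; ⊑⇒≤W)
  open EulerForm C using (Sortable; E; covers-exceptional)
  open Descents C using (Commuting; Box; box-sortable)
  open SortingWords C cw inj using (c₀; c₀-uniq; IsSortable⇒Sortable; Sortable⇒IsSortable)
  open PopIntervals C (_≤W_ C) (λ {u} {v} → ≤W⇒⊑ {u} {v}) (λ {u} {v} → ⊑⇒≤W {u} {v}) using (module PopBox; module Weak; module Camb)

  WeakInt CambInt : Fin N → Set
  WeakInt = Interval (λ _ → ⊤) (_≤W_ C) pW w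
  CambInt = Interval (IsSortable C cw) (_≤W_ C) pC w

  sortable : Sortable c₀ w
  sortable = IsSortable⇒Sortable srt

  commuting : DescentsCommute C w → Commuting w
  commuting h p q np nq = h p q (shorter← np) (shorter← nq)

  module Forward (h : DescentsCommute C w) where
    cm : Commuting w
    cm = commuting h
    module W = PopBox w cm (λ _ → ⊤) (λ _ _ → tt) pW hW
    module K = PopBox w cm (IsSortable C cw) (λ z b → Sortable⇒IsSortable (box-sortable sortable c₀-uniq cm z b)) pC hC

    equal : ∀ z → CambInt z ⇔ WeakInt z
    equal z = mk⇔ (λ i → W.box→interval z (K.interval→box z i)) (λ i → K.box→interval z (W.interval→box z i))

  NonCommuting Oriented : Fin n → Fin n → Set
  NonCommuting p q = gen p · gen q ≢ gen q · gen p
  Oriented p q = ∀ c m m' → E c c₀ (ρ w (α p m)) (ρ w (α q m')) ≡ 0ℤ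

  oriented : ∀ p q → Neg w p → Neg w q → NonCommuting p q → Oriented p q ⊎ Oriented q p
  oriented p q np nq nc = covers-exceptional sortable c₀-uniq p q (λ { refl → nc refl }) np nq

  -- Equality in W is decidable, so each converse only has to refute a non-commuting pair. The pair
  -- may be taken in the order in which the Euler form vanishes, since the roles of the two descents
  -- can be exchanged.
  backward : (∀ p q → Neg w p → Neg w q → NonCommuting p q → Oriented p q → ⊥) → DescentsCommute C w
  backward contra i j di dj = decide (gen i · gen j ≟ gen j · gen i)
    where
    ni : Neg w i
    ni = shorter→ di
    nj : Neg w j
    nj = shorter→ dj
    orient : NonCommuting i j → Oriented i j ⊎ Oriented j i → ⊥
    orient nc (inj₁ o) = contra i j ni nj nc o
    orient nc (inj₂ o) = contra j i nj ni (nc ∘ sym) o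
    decide : Dec (gen i · gen j ≡ gen j · gen i) → gen i · gen j ≡ gen j · gen i
    decide (yes eq) = eq
    decide (no nc) = ⊥-elim (orient nc (oriented i j ni nj nc))

  weak-distributive⇒ : IsDistributiveLattice WeakInt (_≤W_ C) → DescentsCommute C w
  weak-distributive⇒ dist = backward λ p q np nq nc _ → Weak.contra w pW hW p q np nq nc dist

  camb-distributive⇒ : IsDistributiveLattice CambInt (_≤W_ C) → DescentsCommute C w
  camb-distributive⇒ dist = backward λ p q np nq nc o →
    Camb.contra c₀ c₀-uniq (IsSortable C cw) IsSortable⇒Sortable Sortable⇒IsSortable w pC sortable hC p q np nq nc o dist

  equal⇒ : (∀ z → CambInt z ⇔ WeakInt z) → DescentsCommute C w
  equal⇒ eq = backward λ p q np nq nc o →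
    Camb.desc-not-sortable c₀ c₀-uniq (IsSortable C cw) IsSortable⇒Sortable Sortable⇒IsSortable w pC sortable hC p q np nq nc o
      (IsSortable⇒Sortable (proj₁ (Equivalence.from (eq (w · gen q)) (Weak.desc-in w pW hW p q np nq nc))))

theorem7p6 : (C : CoxeterSystem) →
    (cw : Vec (Fin (CoxeterSystem.n C)) (CoxeterSystem.n C)) → IsCoxeterWord C cw →
    (w : Fin (CoxeterSystem.N C)) → IsSortable C cw w →
    (pW pC : Fin (CoxeterSystem.N C)) →
    IsPopDown (λ _ → ⊤) (_≤W_ C) w pW →
    IsPopDown (IsSortable C cw) (_≤W_ C) w pC →
    (DescentsCommute C w ⇔ IsDistributiveLattice (Interval (λ _ → ⊤) (_≤W_ C) pW w) (_≤W_ C)) ×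
    (DescentsCommute C w ⇔ IsBooleanLattice (Interval (λ _ → ⊤) (_≤W_ C) pW w) (_≤W_ C)) ×
    (DescentsCommute C w ⇔ IsDistributiveLattice (Interval (IsSortable C cw) (_≤W_ C) pC w) (_≤W_ C)) ×
    (DescentsCommute C w ⇔ IsBooleanLattice (Interval (IsSortable C cw) (_≤W_ C) pC w) (_≤W_ C)) ×
    (DescentsCommute C w ⇔
    (∀ z → Interval (IsSortable C cw) (_≤W_ C) pC w z ⇔ Interval (λ _ → ⊤) (_≤W_ C) pW w z))
theorem7p6 C cw inj w srt pW pC hW hC =
  mk⇔ (proj₁ ∘ Forward.W.interval-boolean) weak-distributive⇒ ,
  mk⇔ Forward.W.interval-boolean (weak-distributive⇒ ∘ proj₁) ,
  mk⇔ (proj₁ ∘ Forward.K.interval-boolean) camb-distributive⇒ ,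
  mk⇔ Forward.K.interval-boolean (camb-distributive⇒ ∘ proj₁) ,
  mk⇔ Forward.equal equal⇒
  where open Main C cw inj w srt pW pC hW hC
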